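{- For every integer $d\geq 4$ and every integer $k\geq 2$, the generic $d$-dimensional rigidity matroid $\mathcal{R}_d$ does not have the $k$-fold circuit property; that is, there exists a positive integer $n$ such that $\mathcal{R}_d(K_n)$ (the generic $d$-dimensional rigidity matroid on the edge set of the complete graph $K_n$) has a $k$-fold circuit which is not balanced.
   Context: Let $\mathcal{M}=(E,r)$ be a matroid on a finite set $E$ with rank function $r$ and closure operator $\mathrm{cl}(X)=\{x\in E: r(X\cup\{x\})=r(X)\}$. A set $D\subseteq E$ is cyclic if it is a union of circuits (equivalently $r(D-e)=r(D)$ for all $e\in D$). For an integer $k\geq 0$, a $k$-fold circuit of $\mathcal{M}$ is a cyclic set $D$ with $r(D)=|D|-k$. If $D$ is a $k$-fold circuit with $k\ge1$, its principal partition is the partition $\{A_1,\dots,A_\ell\}$ of $D$ such that $\{D\setminus A_i: 1\le i\le \ell\}$ is exactly the set of all $(k-1)$-fold circuits of $\mathcal{M}$ contained in $D$. A $k$-fold circuit $D$ with principal partition $\{A_1,\dots,A_\ell\}$ is balanced if $r\big(\bigcap_{i=1}^\ell \mathrm{cl}(D\setminus A_i)\big)=\ell-k$. A matroid has the $k$-fold circuit property if all its $k$-fold circuits are balanced. For a graph $G=(V,E)$ and a generic $p:V\to\mathbb{R}^d$ (coordinates algebraically independent over $\mathbb{Q}$), the rigidity matrix $R(G,p)$ is the $|E|\times d|V|$ matrix whose row for $uv\in E$ has $p(u)-p(v)$ in the $d$ columns of $u$, $p(v)-p(u)$ in the $d$ columns of $v$, and zeros elsewhere. The generic $d$-dimensional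 rigidity matroid $\mathcal{R}_d(G)$ is the row matroid of $R(G,p)$ on $E$ (independent of the generic choice of $p$). $\mathcal{R}_d$ refers to the family $\mathcal{R}_d(K_n)$, $n\ge1$. -}

module Defs where

open import Algebra.Bundles.Raw using (RawRing)
import Algebra.Definitions.RawSemiring as RawSemiringDefs
open import Data.Fin using (Fin; _<?_)
open import Data.Fin.Properties using () renaming (_≟_ to _≟ᶠ_)
open import Data.Fin.Subset
  using (Subset; _∈_; _∉_; _⊆_; _⊂_; _∪_; _─_; ⁅_⁆; ∣_∣; Nonempty)
open import Data.List using (List; length; lookup; filter; allFin; cartesianProduct)
open import Data.Nat as ℕ using (ℕ; pred; _⊔_)
import Data.Nat.Properties as ℕₚ
open import Data.Product using (∃-syntax; _×_; _,_; uncurry)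
open import Data.Rational as ℚ using (ℚ; 0ℚ; 1ℚ; ½; Positive)
import Data.Rational.Properties as ℚₚ
open import Data.Rational.Solver using (module +-*-Solver)
open import Function.Bundles using (_⇔_)
open import Level using (0ℓ)
open import Relation.Binary.PropositionalEquality
  using (_≡_; _≢_; refl; sym; trans; cong; subst; module ≡-Reasoning)
open import Relation.Nullary using (¬_; yes; no)

------------------------------------------------------------------------
-- The real numbers: Cauchy sequences of rationals, with equality
-- x ≈ y meaning that the difference is a null sequence.

Cauchy : (ℕ → ℚ) → Set
Cauchy x = ∀ ε → 0ℚ ℚ.< ε →
  ∃[ N ] (∀ m n → N ℕ.≤ m → N ℕ.≤ n → ℚ.∣ x m ℚ.- x n ∣ ℚ.< ε)

record ℝ : Set where
  constructor mkℝ
  field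
    seq    : ℕ → ℚ
    cauchy : Cauchy seq

open ℝ public

infix 4 _≈ℝ_

_≈ℝ_ : ℝ → ℝ → Set
x ≈ℝ y = ∀ ε → 0ℚ ℚ.< ε →
  ∃[ N ] (∀ n → N ℕ.≤ n → ℚ.∣ seq x n ℚ.- seq y n ∣ ℚ.< ε)

fromℚ : ℚ → ℝ
fromℚ q = mkℝ (λ _ → q) λ ε 0<ε → 0 , λ _ _ _ _ →
  subst (ℚ._< ε) (sym (cong ℚ.∣_∣ (ℚₚ.+-inverseʳ q))) 0<ε

module CauchyLemmas where

  half-sum : ∀ p → ½ ℚ.* p ℚ.+ ½ ℚ.* p ≡ p
  half-sum p = begin
    ½ ℚ.* p ℚ.+ ½ ℚ.* p  ≡⟨ sym (ℚₚ.*-distribʳ-+ p ½ ½) ⟩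
    (½ ℚ.+ ½) ℚ.* p      ≡⟨ ℚₚ.*-identityˡ p ⟩
    p                    ∎
    where open ≡-Reasoning

  half-pos : ∀ {ε} → 0ℚ ℚ.< ε → 0ℚ ℚ.< ½ ℚ.* ε
  half-pos 0<ε = ℚₚ.*-monoʳ-<-pos ½ 0<ε

  sum-split : ∀ a b c d → (a ℚ.+ b) ℚ.- (c ℚ.+ d) ≡ (a ℚ.- c) ℚ.+ (b ℚ.- d)
  sum-split = solve 4 (λ a b c d → (a :+ b) :- (c :+ d) := (a :- c) :+ (b :- d)) refl
    where open +-*-Solver

  neg-split : ∀ a b → (ℚ.- a) ℚ.- (ℚ.- b) ≡ ℚ.- (a ℚ.- b)
  neg-split = solve 2 (λ a b → (:- a) :- (:- b) := :- (a :- b)) refl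
    where open +-*-Solver

  prod-split : ∀ a b c d →
    (a ℚ.* b) ℚ.- (c ℚ.* d) ≡ a ℚ.* (b ℚ.- d) ℚ.+ d ℚ.* (a ℚ.- c)
  prod-split = solve 4 (λ a b c d →
    (a :* b) :- (c :* d) := a :* (b :- d) :+ d :* (a :- c)) refl
    where open +-*-Solver

  shift : ∀ a b → (a ℚ.- b) ℚ.+ b ≡ a
  shift = solve 2 (λ a b → (a :- b) :+ b := a) refl
    where open +-*-Solver

  Bounded : (ℕ → ℚ) → Set
  Bounded x = ∃[ B ] 0ℚ ℚ.< B × ∃[ N ] (∀ n → N ℕ.≤ n → ℚ.∣ x n ∣ ℚ.≤ B)

  cauchy⇒bounded : ∀ x → Cauchy x → Bounded x
  cauchy⇒bounded x cx with cx 1ℚ (ℚₚ.positive⁻¹ 1ℚ)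
  ... | N , close = 1ℚ ℚ.+ ℚ.∣ x N ∣
                  , ℚₚ.+-mono-<-≤ (ℚₚ.positive⁻¹ 1ℚ) (ℚₚ.0≤∣p∣ (x N))
                  , N , bound
    where
    open ℚₚ.≤-Reasoning
    bound : ∀ n → N ℕ.≤ n → ℚ.∣ x n ∣ ℚ.≤ 1ℚ ℚ.+ ℚ.∣ x N ∣
    bound n N≤n = begin
      ℚ.∣ x n ∣                          ≡⟨ cong ℚ.∣_∣ (sym (shift (x n) (x N))) ⟩
      ℚ.∣ (x n ℚ.- x N) ℚ.+ x N ∣        ≤⟨ ℚₚ.∣p+q∣≤∣p∣+∣q∣ (x n ℚ.- x N) (x N) ⟩
      ℚ.∣ x n ℚ.- x N ∣ ℚ.+ ℚ.∣ x N ∣    ≤⟨ ℚₚ.+-monoˡ-≤ ℚ.∣ x N ∣ (ℚₚ.<⇒≤ (close n N N≤n ℕₚ.≤-refl)) ⟩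
      1ℚ ℚ.+ ℚ.∣ x N ∣                   ∎

  shrink : ∀ B ε → 0ℚ ℚ.< B → 0ℚ ℚ.< ε → ∃[ δ ] 0ℚ ℚ.< δ × B ℚ.* δ ≡ ε
  shrink B ε 0<B 0<ε = B⁻¹ ℚ.* ε , 0<δ , Bδ≡ε
    where
    instance
      B-pos : Positive B
      B-pos = ℚ.positive 0<B
      B-nonZero : ℚ.NonZero B
      B-nonZero = ℚₚ.pos⇒nonZero B
    B⁻¹ : ℚ
    B⁻¹ = ℚ.1/ B
    instance
      B⁻¹-pos : Positive B⁻¹
      B⁻¹-pos = ℚₚ.1/pos⇒pos B
    0<δ : 0ℚ ℚ.< B⁻¹ ℚ.* ε
    0<δ = subst (ℚ._< B⁻¹ ℚ.* ε) (ℚₚ.*-zeroʳ B⁻¹) (ℚₚ.*-monoʳ-<-pos B⁻¹ 0<ε)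
    Bδ≡ε : B ℚ.* (B⁻¹ ℚ.* ε) ≡ ε
    Bδ≡ε = begin
      B ℚ.* (B⁻¹ ℚ.* ε)  ≡⟨ sym (ℚₚ.*-assoc B B⁻¹ ε) ⟩
      (B ℚ.* B⁻¹) ℚ.* ε  ≡⟨ cong (ℚ._* ε) (ℚₚ.*-inverseʳ B) ⟩
      1ℚ ℚ.* ε           ≡⟨ ℚₚ.*-identityˡ ε ⟩
      ε                  ∎
      where open ≡-Reasoning

  small-product : ∀ a b {B δ η} → 0ℚ ℚ.< B → B ℚ.* δ ≡ η →
    ℚ.∣ a ∣ ℚ.≤ B → ℚ.∣ b ∣ ℚ.< δ → ℚ.∣ a ℚ.* b ∣ ℚ.< η
  small-product a b {B} {δ} {η} 0<B Bδ≡η a≤B b<δ = begin-strict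
    ℚ.∣ a ℚ.* b ∣          ≡⟨ ℚₚ.∣p*q∣≡∣p∣*∣q∣ a b ⟩
    ℚ.∣ a ∣ ℚ.* ℚ.∣ b ∣    ≤⟨ ℚₚ.*-monoʳ-≤-nonNeg ℚ.∣ b ∣ a≤B ⟩
    B ℚ.* ℚ.∣ b ∣          <⟨ ℚₚ.*-monoʳ-<-pos B b<δ ⟩
    B ℚ.* δ                ≡⟨ Bδ≡η ⟩
    η                      ∎
    where
    open ℚₚ.≤-Reasoning
    instance
      B-pos : Positive B
      B-pos = ℚ.positive 0<B
      ∣b∣-nonNeg : ℚ.NonNegative ℚ.∣ b ∣
      ∣b∣-nonNeg = ℚₚ.∣-∣-nonNeg b

  small-sum : ∀ a b {ε} → ℚ.∣ a ∣ ℚ.< ½ ℚ.* ε → ℚ.∣ b ∣ ℚ.< ½ ℚ.* ε →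
    ℚ.∣ a ℚ.+ b ∣ ℚ.< ε
  small-sum a b {ε} a< b< = begin-strict
    ℚ.∣ a ℚ.+ b ∣          ≤⟨ ℚₚ.∣p+q∣≤∣p∣+∣q∣ a b ⟩
    ℚ.∣ a ∣ ℚ.+ ℚ.∣ b ∣    <⟨ ℚₚ.+-mono-< a< b< ⟩
    ½ ℚ.* ε ℚ.+ ½ ℚ.* ε    ≡⟨ half-sum ε ⟩
    ε                      ∎
    where open ℚₚ.≤-Reasoning

open CauchyLemmas

infixl 6 _+ℝ_
infixl 7 _*ℝ_
infix  8 -ℝ_

_+ℝ_ : ℝ → ℝ → ℝ
x +ℝ y = mkℝ (λ n → seq x n ℚ.+ seq y n) λ ε 0<ε →
  let N₁ , h₁ = cauchy x (½ ℚ.* ε) (half-pos 0<ε)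
      N₂ , h₂ = cauchy y (½ ℚ.* ε) (half-pos 0<ε)
  in N₁ ⊔ N₂ , λ m n N≤m N≤n →
    subst (ℚ._< ε) (cong ℚ.∣_∣ (sym (sum-split (seq x m) (seq y m) (seq x n) (seq y n))))
      (small-sum (seq x m ℚ.- seq x n) (seq y m ℚ.- seq y n)
        (h₁ m n (ℕₚ.m⊔n≤o⇒m≤o N₁ N₂ N≤m) (ℕₚ.m⊔n≤o⇒m≤o N₁ N₂ N≤n))
        (h₂ m n (ℕₚ.m⊔n≤o⇒n≤o N₁ N₂ N≤m) (ℕₚ.m⊔n≤o⇒n≤o N₁ N₂ N≤n)))

-ℝ_ : ℝ → ℝ
-ℝ x = mkℝ (λ n → ℚ.- seq x n) λ ε 0<ε →
  let N , h = cauchy x ε 0<ε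
  in N , λ m n N≤m N≤n →
    subst (ℚ._< ε)
      (sym (trans
        (cong ℚ.∣_∣ (neg-split (seq x m) (seq x n)))
        (ℚₚ.∣-p∣≡∣p∣ (seq x m ℚ.- seq x n))))
      (h m n N≤m N≤n)

_*ℝ_ : ℝ → ℝ → ℝ
x *ℝ y = mkℝ (λ n → seq x n ℚ.* seq y n) λ ε 0<ε →
  let Bx , 0<Bx , M₁ , b₁ = cauchy⇒bounded (seq x) (cauchy x)
      By , 0<By , M₂ , b₂ = cauchy⇒bounded (seq y) (cauchy y)
      δ₁ , 0<δ₁ , e₁ = shrink Bx (½ ℚ.* ε) 0<Bx (half-pos 0<ε)
      δ₂ , 0<δ₂ , e₂ = shrink By (½ ℚ.* ε) 0<By (half-pos 0<ε)
      N₁ , h₁ = cauchy y δ₁ 0<δ₁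
      N₂ , h₂ = cauchy x δ₂ 0<δ₂
      M = M₁ ⊔ M₂
      N = N₁ ⊔ N₂
      M≤ : ∀ {m} → M ⊔ N ℕ.≤ m → M ℕ.≤ m
      M≤ = ℕₚ.m⊔n≤o⇒m≤o M N
      N≤ : ∀ {m} → M ⊔ N ℕ.≤ m → N ℕ.≤ m
      N≤ = ℕₚ.m⊔n≤o⇒n≤o M N
  in M ⊔ N , λ m n K≤m K≤n →
    subst (ℚ._< ε) (cong ℚ.∣_∣ (sym (prod-split (seq x m) (seq y m) (seq x n) (seq y n))))
      (small-sum (seq x m ℚ.* (seq y m ℚ.- seq y n)) (seq y n ℚ.* (seq x m ℚ.- seq x n))
        (small-product (seq x m) (seq y m ℚ.- seq y n) 0<Bx e₁
          (b₁ m (ℕₚ.m⊔n≤o⇒m≤o M₁ M₂ (M≤ K≤m)))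
          (h₁ m n (ℕₚ.m⊔n≤o⇒m≤o N₁ N₂ (N≤ K≤m)) (ℕₚ.m⊔n≤o⇒m≤o N₁ N₂ (N≤ K≤n))))
        (small-product (seq y n) (seq x m ℚ.- seq x n) 0<By e₂
          (b₂ n (ℕₚ.m⊔n≤o⇒n≤o M₁ M₂ (M≤ K≤n)))
          (h₂ m n (ℕₚ.m⊔n≤o⇒n≤o N₁ N₂ (N≤ K≤m)) (ℕₚ.m⊔n≤o⇒n≤o N₁ N₂ (N≤ K≤n)))))

ℝ-rawRing : RawRing 0ℓ 0ℓ
ℝ-rawRing = record
  { Carrier = ℝ
  ; _≈_     = _≈ℝ_
  ; _+_     = _+ℝ_
  ; _*_     = _*ℝ_
  ; -_      = -ℝ_
  ; 0#      = fromℚ 0ℚ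
  ; 1#      = fromℚ 1ℚ
  }

open RawSemiringDefs (RawRing.rawSemiring ℝ-rawRing)
  using () renaming (sum to sumℝ; product to productℝ; _^_ to _^ℝ_) public

------------------------------------------------------------------------
-- Matroid notions on the ground set Fin m, for a matroid presented by
-- its independent sets.  Independence over ℝ is not decidable, so the
-- rank is a functional relation rather than a ℕ-valued function.

IndependenceSystem : ℕ → Set₁
IndependenceSystem m = Subset m → Set

module _ {m : ℕ} (Indep : IndependenceSystem m) where

  HasRank : Subset m → ℕ → Set
  HasRank X r =
      (∃[ I ] I ⊆ X × Indep I × ∣ I ∣ ≡ r)
    × (∀ J → J ⊆ X → Indep J → ∣ J ∣ ℕ.≤ r)

  InClosure : Fin m → Subset m → Set
  InClosure x X = ∃[ r ] HasRank X r × HasRank (X ∪ ⁅ x ⁆) r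

  IsCircuit : Subset m → Set
  IsCircuit C = ¬ Indep C × (∀ X → X ⊂ C → Indep X)

  IsCyclic : Subset m → Set
  IsCyclic D = ∀ e → e ∈ D → ∃[ C ] IsCircuit C × C ⊆ D × e ∈ C

  IsFoldCircuit : ℕ → Subset m → Set
  IsFoldCircuit k D = IsCyclic D × (∃[ r ] HasRank D r × r ℕ.+ k ≡ ∣ D ∣)

  -- Meaningful for k ≥ 1 only: at k = 0, pred k is not k - 1.
  record IsPrincipalPartition (k : ℕ) (D : Subset m)
                              {ℓ : ℕ} (A : Fin ℓ → Subset m) : Set where
    field
      nonempty : ∀ i → Nonempty (A i)
      disjoint : ∀ i j → i ≢ j → ∀ e → e ∈ A i → e ∉ A j
      covers   : ∀ e → e ∈ D ⇔ (∃[ i ] e ∈ A i)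
      sound    : ∀ i → IsFoldCircuit (pred k) (D ─ A i)
      complete : ∀ X → X ⊆ D → IsFoldCircuit (pred k) X → ∃[ i ] X ≡ D ─ A i

  -- F is the intersection of the closures of the sets D ─ A i, and the
  -- rank condition r(F) = ℓ - k is written additively.
  IsBalanced : ℕ → Subset m → Set
  IsBalanced k D =
    ∀ {ℓ} (A : Fin ℓ → Subset m) → IsPrincipalPartition k D A →
    ∀ F → (∀ x → x ∈ F ⇔ (∀ i → InClosure x (D ─ A i))) →
    ∃[ r ] HasRank F r × r ℕ.+ k ≡ ℓ

------------------------------------------------------------------------
-- Row matroid of a real matrix with rows Fin m and columns indexed by C.

rowMatroid : ∀ {m} {C : Set} → (Fin m → C → ℝ) → IndependenceSystem m
rowMatroid {m} {C} M S =
  (c : Fin m → ℝ) → (∀ e → e ∉ S → c e ≈ℝ fromℚ 0ℚ) →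
  (∀ j → sumℝ (λ e → c e *ℝ M e j) ≈ℝ fromℚ 0ℚ) →
  ∀ e → c e ≈ℝ fromℚ 0ℚ

------------------------------------------------------------------------
-- Generic rigidity matroids.

Placement : ℕ → ℕ → Set
Placement d n = Fin n → Fin d → ℝ

Exponent : ℕ → ℕ → Set
Exponent d n = Fin n → Fin d → ℕ

monomial : ∀ {d n} → Placement d n → Exponent d n → ℝ
monomial p a = productℝ (λ v → productℝ (λ i → p v i ^ℝ a v i))

-- The coordinates of p are algebraically independent over ℚ.  A
-- polynomial is given by coefficients c on pairwise distinct exponents a;
-- it is the zero polynomial exactly when all of its coefficients vanish.
Generic : ∀ {d n} → Placement d n → Set
Generic {d} {n} p =
  ∀ {t} (c : Fin t → ℚ) (a : Fin t → Exponent d n) →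
  (∀ s s′ → (∀ v i → a s v i ≡ a s′ v i) → s ≡ s′) →
  sumℝ (λ s → fromℚ (c s) *ℝ monomial p (a s)) ≈ℝ fromℚ 0ℚ →
  ∀ s → c s ≡ 0ℚ

-- A graph on Fin n is given by the list of its edges uv, each listed once.
EdgeList : ℕ → Set
EdgeList n = List (Fin n × Fin n)

completeGraph : ∀ n → EdgeList n
completeGraph n = filter (uncurry _<?_) (cartesianProduct (allFin n) (allFin n))

rigidityRow : ∀ {d n} → Placement d n → Fin n × Fin n → Fin n × Fin d → ℝ
rigidityRow p (u , v) (w , i) with w ≟ᶠ u | w ≟ᶠ v
... | yes _ | _     = p u i +ℝ -ℝ p v i
... | no  _ | yes _ = p v i +ℝ -ℝ p u i
... | no  _ | no  _ = fromℚ 0ℚ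

rigidityMatrix : ∀ {d n} (G : EdgeList n) → Placement d n →
                 Fin (length G) → Fin n × Fin d → ℝ
rigidityMatrix G p e = rigidityRow p (lookup G e)

rigidityMatroid : ∀ {d n} (G : EdgeList n) → Placement d n →
                  IndependenceSystem (length G)
rigidityMatroid G p = rowMatroid (rigidityMatrix G p)

{-# OPTIONS --safe #-}

-- The complete bipartite graph on d + 2 points p and d + 3 points q is a 2-fold circuit whose
-- principal partition consists of the stars of the points q.  Indeed (Bolker and Roth), multiplying
-- the equilibrium conditions of a stress by homogeneous coordinates gives a linear relation between
-- the squares of all 2d + 5 points in Sym²(ℝᵈ⁺¹).  These squares are generically independent for
-- d ≥ 4, so the stress is a matrix whose rows are affine dependencies of the q and whose columns are
-- affine dependencies of the p; generically those of the p form a line and those of the q a plane.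
-- There is still room in Sym² for the square of one difference of two points p, so no edge between
-- two points p lies in the closure of the graph, whereas an edge at a point q does not lie in the
-- closure of the graph without the star of that q.  Hence the intersection of the closures is empty,
-- instead of having rank d + 1.  For k > 2 add k - 2 vertex-disjoint copies of the circuit between
-- d + 2 and d + 2 points.
--
-- Nonvanishing of a polynomial at a generic placement is inferred from its nonvanishing at a
-- special one, and linear independence is transported in the same way by fraction-free elimination.
module Submission where

-- The bound on d is a dimension count. Sym²(ℝᵈ⁺¹) has dimension (d + 1)(d + 2)/2 and has to hold 2d
-- + 6 independent vectors, the squares of 2d + 5 points and of one difference. For d = 4 these are
-- 14 vectors in dimension 15, for d = 3 already 12 in dimension 10. Each added circuit raises both
-- k and the number ℓ of parts by one, so the rank ℓ - k demanded by balance stays d + 1. The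
-- obstacle is constructive: equality in ℝ is undecidable, so pivots cannot be searched for, kernel
-- vectors exist only under double negation, and ranks cannot be computed by linear algebra. This is
-- harmless where a real number is shown to vanish, which is a stable statement, and where a
-- negation is proved. The matroid theory is therefore detached from ℝ: inside the blocks
-- independence is equivalent to a decidable condition on edges, and ranks, circuits and the
-- principal partition are found from that condition by finite search.

open import Defs
open import Data.Nat using (ℕ; _≤_)
open import Data.Product using (∃-syntax; _×_)
open import Relation.Nullary using (¬_)

open import Algebra.Bundles using (CommutativeRing)
import Algebra.Properties.CommutativeMonoid.Sum as CommutativeMonoidSum
import Algebra.Properties.Monoid.Mult as MonoidMult
import Algebra.Properties.Ring as RingProperties
import Algebra.Properties.Semiring.Sum as SemiringSum
import Algebra.Solver.Ring as RingSolver
open import Algebra.Solver.Ring.AlmostCommutativeRing using (fromCommutativeRing; _-Raw-AlmostCommutative⟶_)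
open import Algebra.Structures using (IsCommutativeRing)
open import Data.Empty using (⊥-elim)
import Data.Empty as Empty
open import Data.Fin
  using (Fin; zero; suc; _<_; _<?_; punchIn; punchOut; splitAt; join; _↑ˡ_; _↑ʳ_; combine; remQuot)
open import Data.Fin.Patterns using (0F; 1F; 2F; 3F)
open import Data.Fin.Permutation as Perm using (Permutation; transpose; _∘ₚ_; _⟨$⟩ʳ_; _⟨$⟩ˡ_)
import Data.Fin.Permutation.Components as PC
open import Data.Fin.Properties
  using ( any?; all?; ¬∀⟶∃¬; <-cmp; <-irrefl; toℕ<n; toℕ-↑ˡ; toℕ-↑ʳ
        ; punchInᵢ≢i; punchIn-injective; punchIn-punchOut
        ; splitAt-↑ˡ; splitAt-↑ʳ; splitAt⁻¹-↑ˡ; splitAt⁻¹-↑ʳ; splitAt-join; join-splitAt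
        ; remQuot-combine; combine-remQuot; combine-injective; ↑ˡ-injective; ↑ʳ-injective )
  renaming (_≟_ to _≟ᶠ_)
open import Data.Fin.Subset using (Subset; _∈_; _∉_; _⊆_; _⊂_; _∪_; _─_; ⁅_⁆; ∣_∣) renaming (⊥ to ∅)
open import Data.Fin.Subset.Properties
  using ( _∈?_; ∉⊥; ∣⊥∣≡0; p─⊥≡p; p─q⊆p; x∈p∧x∉q⇒x∈p─q; x∈p∧x≢y⇒x∈p-y; x∈p⇒p-x⊂p
        ; p⊆q⇒∣p∣≤∣q∣; p⊂q⇒∣p∣<∣q∣; ⊆-antisym; x∈⁅x⁆; x∈⁅y⁆⇒x≡y; p⊆p∪q; q⊆p∪q; x∈p∪q⁻ )
open import Data.List
  using (List; []; _∷_; _++_; length; lookup; foldr; concat; tabulate; allFin; cartesianProduct)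
import Data.List as List
open import Data.List.Membership.Propositional using () renaming (_∈_ to _∈ˡ_; _∉_ to _∉ˡ_)
open import Data.List.Membership.Propositional.Properties
  using (∈-lookup; ∈-concat⁺′; ∈-tabulate⁺; ∈-filter⁺; ∈-filter⁻; ∈-cartesianProduct⁺; ∈-allFin)
open import Data.List.Properties using (length-++)
open import Data.List.Relation.Unary.All as All using (All; []; _∷_)
import Data.List.Relation.Unary.All.Properties as Allₚ
open import Data.List.Relation.Unary.AllPairs using (AllPairs; []; _∷_)
import Data.List.Relation.Unary.AllPairs.Properties as AllPairsₚ
open import Data.List.Relation.Unary.Any using (index)
open import Data.List.Relation.Unary.Any.Properties using (lookup-index)
open import Data.List.Relation.Unary.Unique.Propositional using (Unique)
import Data.List.Relation.Unary.Unique.Propositional.Properties as Uniqueₚ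
open import Data.Maybe as Maybe using (Maybe)
open import Data.Nat as ℕ using (zero; suc)
import Data.Nat.Properties as ℕₚ
open import Data.Product using (Σ; _,_; proj₁; proj₂; uncurry)
open import Data.Rational as ℚ using (ℚ; 0ℚ; 1ℚ; ½)
import Data.Rational.Properties as ℚₚ
open import Data.Rational.Solver using (module +-*-Solver)
open import Data.Sum using (_⊎_; inj₁; inj₂; [_,_]′)
open import Data.Unit using (⊤; tt)
open import Data.Vec using (_∷_)
import Data.Vec as Vec
open import Data.Vec.Functional using (insertAt)
import Data.Vec.Functional.Properties as VFₚ
import Data.Vec.Properties as Vecₚ
open import Function using (_∘_; _⇔_; mk⇔)
open import Level using (0ℓ)
open import Relation.Binary.Definitions using (tri<; tri≈; tri>)
open import Relation.Binary.PropositionalEquality as ≡ using (_≡_; _≢_)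
import Relation.Binary.Reasoning.Setoid as SetoidReasoning
open import Relation.Nullary using (Dec; yes; no; contradiction; does)
open import Relation.Nullary.Decidable using (dec⇒maybe; ¬?; _×-dec_; _→-dec_; decidable-stable; dec-true)
open import Relation.Unary using (Decidable)

-- Linear algebra

-- The classical features of ℝ that survive constructively: equality with 0
-- is stable under double negation, and products of nonzero elements are nonzero.
record StableDomain : Set₁ where
  field
    commutativeRing : CommutativeRing 0ℓ 0ℓ
  open CommutativeRing commutativeRing
  field
    ι       : ℚ → Carrier
    ι-+     : ∀ p q → ι (p ℚ.+ q) ≈ ι p + ι q
    ι-*     : ∀ p q → ι (p ℚ.* q) ≈ ι p * ι q
    ι-neg   : ∀ p → ι (ℚ.- p) ≈ - ι p
    ι-0     : ι 0ℚ ≈ 0#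
    ι-1     : ι 1ℚ ≈ 1#
    ι-≉0    : ∀ {q} → q ≢ 0ℚ → ¬ ι q ≈ 0#
    ≈0-stable : ∀ {x} → ¬ ¬ x ≈ 0# → x ≈ 0#
    *-cancel-0 : ∀ {x y} → ¬ x ≈ 0# → x * y ≈ 0# → y ≈ 0#

module LinearAlgebra (F : StableDomain) where
  open StableDomain F public
  open CommutativeRing commutativeRing public hiding (zero)
  open RingProperties ring public
  open SemiringSum semiring public
  open SetoidReasoning setoid public

  private
    ι-homomorphism : ℚₚ.+-*-rawRing -Raw-AlmostCommutative⟶ fromCommutativeRing commutativeRing
    ι-homomorphism = record
      { ⟦_⟧ = ι ; +-homo = ι-+ ; *-homo = ι-* ; -‿homo = ι-neg ; 0-homo = ι-0 ; 1-homo = ι-1 }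

    ι-≟ : ∀ p q → Maybe (ι p ≈ ι q)
    ι-≟ p q = Maybe.map (reflexive ∘ ≡.cong ι) (dec⇒maybe (p ℚ.≟ q))

  open RingSolver ℚₚ.+-*-rawRing (fromCommutativeRing commutativeRing) ι-homomorphism ι-≟ public
    using (solve; _:=_; _:+_; _:*_; _:-_; :-_; con)

  infix 4 _≉0
  _≉0 : Carrier → Set
  x ≉0 = ¬ x ≈ 0#

  1≉0 : 1# ≉0
  1≉0 1≈0 = ι-≉0 {1ℚ} (λ ()) (trans ι-1 1≈0)

  *-≉0 : ∀ {x y} → x ≉0 → y ≉0 → x * y ≉0
  *-≉0 x≉0 y≉0 xy≈0 = y≉0 (*-cancel-0 x≉0 xy≈0)

  -- The choice of a pivot. Its users prove `≈ 0#` or a negation, where a doubly negated choice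
  -- suffices.
  zero-or-not : ∀ {A : Set} (f : A → Carrier) → ¬ ¬ ((∃[ a ] f a ≉0) ⊎ (∀ a → f a ≈ 0#))
  zero-or-not f k = k (inj₂ λ a → ≈0-stable λ fa≉0 → k (inj₁ (a , fa≉0)))

  sum-zero : ∀ {n} {f : Fin n → Carrier} → (∀ i → f i ≈ 0#) → sum f ≈ 0#
  sum-zero {n} f≈0 = trans (sum-cong-≋ f≈0) (sum-replicate-zero n)

  sum-++ : ∀ a {b} (f : Fin (a ℕ.+ b) → Carrier) →
    sum f ≈ sum (λ i → f (i ↑ˡ b)) + sum (λ i → f (a ↑ʳ i))
  sum-++ zero    f = sym (+-identityˡ _)
  sum-++ (suc a) f = trans (+-congˡ (sum-++ a (f ∘ suc))) (sym (+-assoc _ _ _))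

  sum-at : ∀ {n} (f : Fin n → Carrier) i → (∀ j → j ≢ i → f j ≈ 0#) → sum f ≈ f i
  sum-at {suc n} f i h = begin
    sum f                            ≈⟨ sum-remove {i = i} f ⟩
    f i + sum (λ j → f (punchIn i j)) ≈⟨ +-congˡ (sum-zero λ j → h _ (punchInᵢ≢i i j)) ⟩
    f i + 0#                         ≈⟨ +-identityʳ _ ⟩
    f i                              ∎

  δ : ∀ {n} → Fin n → Fin n → Carrier
  δ i j with i ≟ᶠ j
  ... | yes _ = 1#
  ... | no  _ = 0#

  δ-≡ : ∀ {n} {i j : Fin n} → i ≡ j → δ i j ≈ 1#
  δ-≡ {i = i} {j} i≡j with i ≟ᶠ j
  ... | yes _  = refl
  ... | no i≢j = contradiction i≡j i≢j

  δ-≢ : ∀ {n} {i j : Fin n} → i ≢ j → δ i j ≈ 0#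
  δ-≢ {i = i} {j} i≢j with i ≟ᶠ j
  ... | yes i≡j = contradiction i≡j i≢j
  ... | no _    = refl

  sum-δ : ∀ {n} (f : Fin n → Carrier) i → sum (λ j → δ j i * f j) ≈ f i
  sum-δ f i = trans (sum-at (λ j → δ j i * f j) i λ j j≢i → trans (*-congʳ (δ-≢ j≢i)) (zeroˡ _))
                    (trans (*-congʳ (δ-≡ {i = i} ≡.refl)) (*-identityˡ _))

  -- Writes `f e` as the sum of `δ e (g i) * f e` over `i` and exchanges the two sums. It reduces
  -- the equilibrium at a vertex from all edges to the relevant ones.
  sum-reindex : ∀ {m n} (f : Fin m → Carrier) (g : Fin n → Fin m) →
    (∀ i j → g i ≡ g j → i ≡ j) → (∀ e → (∀ i → g i ≢ e) → f e ≈ 0#) →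
    sum f ≈ sum (λ i → f (g i))
  sum-reindex f g inj h = begin
    sum f                                        ≈⟨ sum-cong-≋ hit ⟩
    sum (λ e → sum (λ i → δ e (g i) * f e))      ≈⟨ ∑-comm (λ e i → δ e (g i) * f e) ⟩
    sum (λ i → sum (λ e → δ e (g i) * f e))      ≈⟨ sum-cong-≋ (λ i → sum-δ f (g i)) ⟩
    sum (λ i → f (g i))                          ∎
    where
    hit : ∀ e → f e ≈ sum (λ i → δ e (g i) * f e)
    hit e with any? (λ i → g i ≟ᶠ e)
    ... | yes (i , ≡.refl) = sym (trans
            (sum-at _ i λ j j≢i → trans (*-congʳ (δ-≢ (j≢i ∘ ≡.sym ∘ inj i j))) (zeroˡ _))
            (trans (*-congʳ (δ-≡ {i = g i} ≡.refl)) (*-identityˡ _)))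
    ... | no ∄i = trans fe≈0 (sym (sum-zero λ i → trans (*-congˡ fe≈0) (zeroʳ (δ e (g i)))))
      where fe≈0 = h e λ i gi≡e → ∄i (i , gi≡e)

  sum-neg : ∀ {n} (f : Fin n → Carrier) → sum (λ i → - f i) ≈ - sum f
  sum-neg f = begin
    sum (λ i → - f i)       ≈⟨ sum-cong-≋ (λ i → sym (-1*x≈-x (f i))) ⟩
    sum (λ i → - 1# * f i)  ≈⟨ sym (*-distribˡ-sum (- 1#) f) ⟩
    - 1# * sum f            ≈⟨ -1*x≈-x _ ⟩
    - sum f                 ∎

  -- `ι 1ℚ` rather than `1#`, so that the leading coordinate is a constant both for the ring solver
  -- and for `const-isPoly`.
  homogeneous : ∀ {d} → (Fin d → Carrier) → Fin (suc d) → Carrier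
  homogeneous x zero    = ι 1ℚ
  homogeneous x (suc r) = x r

  LinearlyIndependent : ∀ {r} {C : Set} → (Fin r → C → Carrier) → Set
  LinearlyIndependent {r} M =
    ∀ (c : Fin r → Carrier) → (∀ j → sum (λ i → c i * M i j) ≈ 0#) → ∀ i → c i ≈ 0#

  -- One step of fraction-free elimination, seen in a single column: `p` is the pivot, `a i` the
  -- entry of row i below it, and `m i` and `b` are the entries of row i and of the pivot row in the
  -- current column.
  pivot-sum : ∀ {n} p b (y m a : Fin n → Carrier) →
    sum (λ i → y i * (p * m i - a i * b)) ≈ p * sum (λ i → y i * m i) - sum (λ i → y i * a i) * b
  pivot-sum p b y m a = begin
    sum (λ i → y i * (p * m i - a i * b))
      ≈⟨ sum-cong-≋ (λ i → solve 5 (λ y p m a b → y :* (p :* m :- a :* b) := p :* (y :* m) :+ (:- (y :* a :* b)))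
           refl (y i) p (m i) (a i) b) ⟩
    sum (λ i → p * (y i * m i) + - (y i * a i * b))
      ≈⟨ ∑-distrib-+ (λ i → p * (y i * m i)) (λ i → - (y i * a i * b)) ⟩
    sum (λ i → p * (y i * m i)) + sum (λ i → - (y i * a i * b))
      ≈⟨ +-cong (sym (*-distribˡ-sum p (λ i → y i * m i)))
           (trans (sum-neg (λ i → y i * a i * b)) (-‿cong (sym (*-distribʳ-sum b (λ i → y i * a i))))) ⟩
    p * sum (λ i → y i * m i) - sum (λ i → y i * a i) * b ∎

  insertAt-sum : ∀ {n} (y : Fin n → Carrier) i x (m : Fin (suc n) → Carrier) →
    sum (λ k → insertAt y i x k * m k) ≈ x * m i + sum (λ k → y k * m (punchIn i k))
  insertAt-sum y i x m = trans (sum-remove {i = i} (λ k → insertAt y i x k * m k))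
    (+-cong (*-congʳ (reflexive (VFₚ.insertAt-lookup y i x)))
            (sum-cong-≋ λ k → *-congʳ (reflexive (VFₚ.insertAt-punchIn y i x k))))

  -- Elimination of the first coordinate. In the absence of division the solution `y` of the smaller
  -- system is scaled by the pivot, and the pivot row receives the coefficient `- s` that cancels
  -- the first coordinate.
  kernel : ∀ m (M : Fin (suc m) → Fin m → Carrier) →
    ¬ ¬ (Σ (Fin (suc m) → Carrier) λ x → (∃[ i ] x i ≉0) × (∀ j → sum (λ i → x i * M i j) ≈ 0#))
  kernel zero    M k = k ((λ _ → 1#) , (zero , 1≉0) , λ ())
  kernel (suc m) M k = zero-or-not (λ i → M i zero) λ where
    -- A vanishing column imposes no condition, so one vector, here the first, can be given up.
    (inj₂ z) → kernel m (λ i j → M (suc i) (suc j)) λ (y , (i , yi≉0) , h) →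
      k ( insertAt y zero 0# , (suc i , yi≉0)
        , λ { zero → sum-zero λ i → trans (*-congˡ (z i)) (zeroʳ (insertAt y zero 0# i))
            ; (suc j) → trans (+-cong (zeroˡ _) (h j)) (+-identityˡ _) })
    (inj₁ (i , p≉0)) →
      let p = M i zero
          a = λ k → M (punchIn i k) zero
      in kernel m (λ k j → p * M (punchIn i k) (suc j) - a k * M i (suc j)) λ (y , (l , yl≉0) , h) →
      let s = sum (λ k → y k * a k)
          x = insertAt (λ k → p * y k) i (- s)
          column : ∀ j → sum (λ k → x k * M k j) ≈ sum (λ k → y k * (p * M (punchIn i k) j - a k * M i j))
          column j = begin
            sum (λ k → x k * M k j)
              ≈⟨ insertAt-sum (λ k → p * y k) i (- s) (λ k → M k j) ⟩
            - s * M i j + sum (λ k → p * y k * M (punchIn i k) j)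
              ≈⟨ +-congˡ (sum-cong-≋ λ k → *-assoc p (y k) (M (punchIn i k) j)) ⟩
            - s * M i j + sum (λ k → p * (y k * M (punchIn i k) j))
              ≈⟨ +-congˡ (*-distribˡ-sum p (λ k → y k * M (punchIn i k) j)) ⟨
            - s * M i j + p * sum (λ k → y k * M (punchIn i k) j)
              ≈⟨ solve 3 (λ s m t → (:- s) :* m :+ t := t :- s :* m) refl s (M i j) _ ⟩
            p * sum (λ k → y k * M (punchIn i k) j) - s * M i j
              ≈⟨ pivot-sum p (M i j) y (λ k → M (punchIn i k) j) a ⟨
            sum (λ k → y k * (p * M (punchIn i k) j - a k * M i j)) ∎
      in k ( x
           , (punchIn i l , λ x≈0 → *-≉0 p≉0 yl≉0
               (trans (reflexive (≡.sym (VFₚ.insertAt-punchIn (λ k → p * y k) i (- s) l))) x≈0))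
           , λ { zero → trans (column zero) (sum-zero λ k →
                   trans (solve 3 (λ y p a → y :* (p :* a :- a :* p) := con 0ℚ) refl (y k) p (a k)) ι-0)
               ; (suc j) → trans (column (suc j)) (h j) })

  -- There are two vectors more than the dimension, so one can be discarded in advance. This later
  -- provides a stress that avoids a prescribed star.
  kernel-avoiding : ∀ m (M : Fin (2 ℕ.+ m) → Fin m → Carrier) i₀ →
    ¬ ¬ (Σ (Fin (2 ℕ.+ m) → Carrier) λ x → (∃[ i ] x i ≉0) × x i₀ ≈ 0# × (∀ j → sum (λ i → x i * M i j) ≈ 0#))
  kernel-avoiding m M i₀ k = kernel m (M ∘ punchIn i₀) λ (y , (i , yi≉0) , h) →
    let x = insertAt y i₀ 0# in
    k ( x
      , (punchIn i₀ i , λ x≈0 → yi≉0 (trans (reflexive (≡.sym (VFₚ.insertAt-punchIn y i₀ 0# i))) x≈0))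
      , reflexive (VFₚ.insertAt-lookup y i₀ 0#)
      , λ j → trans (insertAt-sum y i₀ 0# (λ i → M i j)) (trans (+-cong (zeroˡ _) (h j)) (+-identityˡ _)))

  module Specialisation
    (X : Set) (IsPoly : (X → Carrier) → Set)
    (*-isPoly : ∀ {f g} → IsPoly f → IsPoly g → IsPoly (λ x → f x * g x))
    (∸-isPoly : ∀ {f g} → IsPoly f → IsPoly g → IsPoly (λ x → f x - g x))
    (p : X) (generic : ∀ {f} → IsPoly f → ∀ q → f q ≉0 → f p ≉0)
    where

    -- Induction on the rows in place of minors: an entry of the first row that is nonzero at `q` is
    -- nonzero at `p`, so the same position serves as pivot at both points. Elimination keeps the
    -- entries polynomial and keeps the remaining rows independent at `q`.
    specialise : ∀ {r} {C : Set} (M : Fin r → C → X → Carrier) → (∀ i j → IsPoly (M i j)) →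
      ∀ q → LinearlyIndependent (λ i j → M i j q) → LinearlyIndependent (λ i j → M i j p)
    specialise {zero}  M _ q _ c h ()
    specialise {suc r} {C} M isPoly q li c h i = ≈0-stable λ ci≉0 →
      zero-or-not (λ j → M zero j q) λ where
        (inj₂ z) → 1≉0 (li (insertAt (λ _ → 0#) zero 1#)
          (λ j → trans (+-cong (trans (*-congˡ (z j)) (zeroʳ _)) (sum-zero {r} λ _ → zeroˡ _))
                       (+-identityˡ _)) zero)
        (inj₁ (j , pivot≉0)) → ci≉0 (conclude j pivot≉0 i)
      where
      module _ (j : C) (pivot≉0 : M zero j q ≉0) where
        N : Fin r → C → X → Carrier
        N i j′ x = M zero j x * M (suc i) j′ x - M (suc i) j x * M zero j′ x

        N-independent : LinearlyIndependent (λ i j′ → N i j′ q)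
        N-independent y hy i = *-cancel-0 pivot≉0 (li
          (insertAt (λ i → π * y i) zero (- s))
          (λ j′ → begin
            - s * M zero j′ q + sum (λ i → π * y i * M (suc i) j′ q)
              ≈⟨ +-congˡ (sum-cong-≋ λ i → *-assoc π (y i) (M (suc i) j′ q)) ⟩
            - s * M zero j′ q + sum (λ i → π * (y i * M (suc i) j′ q))
              ≈⟨ +-congˡ (*-distribˡ-sum π (λ i → y i * M (suc i) j′ q)) ⟨
            - s * M zero j′ q + π * sum (λ i → y i * M (suc i) j′ q)
              ≈⟨ solve 3 (λ s m t → (:- s) :* m :+ t := t :- s :* m) refl s (M zero j′ q) _ ⟩
            π * sum (λ i → y i * M (suc i) j′ q) - s * M zero j′ q
              ≈⟨ pivot-sum π (M zero j′ q) y (λ i → M (suc i) j′ q) (λ i → M (suc i) j q) ⟨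
            sum (λ i → y i * N i j′ q)
              ≈⟨ hy j′ ⟩
            0# ∎)
          (suc i))
          where
          π = M zero j q
          s = sum (λ i → y i * M (suc i) j q)

        tail≈0 : ∀ i → c (suc i) ≈ 0#
        tail≈0 = specialise N
          (λ i j′ → ∸-isPoly (*-isPoly (isPoly zero j) (isPoly (suc i) j′))
                             (*-isPoly (isPoly (suc i) j) (isPoly zero j′)))
          q N-independent (c ∘ suc)
          λ j′ → begin
            sum (λ i → c (suc i) * N i j′ p)
              ≈⟨ pivot-sum (M zero j p) (M zero j′ p) (c ∘ suc) (λ i → M (suc i) j′ p) (λ i → M (suc i) j p) ⟩
            M zero j p * t j′ - t j * M zero j′ p
              -- Elimination annihilates the pivot row, so both sums may be completed by the term of
              -- `c zero`; the completed sums vanish by `h`.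
              ≈⟨ solve 5 (λ c₀ m m′ t t′ → m :* t′ :- t :* m′ := m :* (c₀ :* m′ :+ t′) :- (c₀ :* m :+ t) :* m′)
                   refl (c zero) (M zero j p) (M zero j′ p) (t j) (t j′) ⟩
            M zero j p * (c zero * M zero j′ p + t j′) - (c zero * M zero j p + t j) * M zero j′ p
              ≈⟨ +-cong (*-congˡ (h j′)) (-‿cong (*-congʳ (h j))) ⟩
            M zero j p * 0# - 0# * M zero j′ p
              ≈⟨ +-cong (zeroʳ _) (-‿cong (zeroˡ _)) ⟩
            0# - 0#
              ≈⟨ -‿inverseʳ 0# ⟩
            0# ∎
          where
          t : C → Carrier
          t j′ = sum (λ i → c (suc i) * M (suc i) j′ p)

        conclude : ∀ i → c i ≈ 0#
        conclude (suc i) = tail≈0 i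
        conclude zero    = *-cancel-0 (generic (isPoly zero j) q pivot≉0) (begin
          M zero j p * c zero        ≈⟨ *-comm _ _ ⟩
          c zero * M zero j p        ≈⟨ +-identityʳ _ ⟨
          c zero * M zero j p + 0#   ≈⟨ +-congˡ (sum-zero λ i → trans (*-congʳ (tail≈0 i)) (zeroˡ _)) ⟨
          c zero * M zero j p + sum (λ i → c (suc i) * M (suc i) j p)  ≈⟨ h j ⟩
          0#                         ∎)

-- Polynomials and generic placements

module Polynomials (F : StableDomain) (n d : ℕ) where
  open LinearAlgebra F
  private
    module Π = CommutativeMonoidSum *-commutativeMonoid
    module Pow = MonoidMult *-monoid

  Pl : Set
  Pl = Fin n → Fin d → Carrier

  Exp : Set
  Exp = Fin n → Fin d → ℕ

  monomialAt : Pl → Exp → Carrier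
  monomialAt p a = Π.sum (λ v → Π.sum (λ i → a v i Pow.× p v i))

  infix 4 _≗₂_
  _≗₂_ : Exp → Exp → Set
  a ≗₂ b = ∀ v i → a v i ≡ b v i

  GenericPlacement : Pl → Set
  GenericPlacement p = ∀ {t} (c : Fin t → ℚ) (a : Fin t → Exp) →
    (∀ s s′ → a s ≗₂ a s′ → s ≡ s′) →
    sum (λ s → ι (c s) * monomialAt p (a s)) ≈ 0# → ∀ s → c s ≡ 0ℚ

  private
    Π-at : ∀ {m} (f : Fin m → Carrier) i → (∀ j → j ≢ i → f j ≈ 1#) → Π.sum f ≈ f i
    Π-at {suc m} f i h = begin
      Π.sum f                                 ≈⟨ Π.sum-remove {i = i} f ⟩
      f i * Π.sum (λ j → f (punchIn i j))     ≈⟨ *-congˡ (Π.sum-cong-≋ (λ j → h _ (punchInᵢ≢i i j))) ⟩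
      f i * Π.sum {m} (λ j → 1#)              ≈⟨ *-congˡ (Π.sum-replicate-zero m) ⟩
      f i * 1#                                ≈⟨ *-identityʳ _ ⟩
      f i                                     ∎

    monomial-cong : ∀ p {a b} → a ≗₂ b → monomialAt p a ≈ monomialAt p b
    monomial-cong p a≗b = Π.sum-cong-≋ λ v → Π.sum-cong-≋ λ i → Pow.×-congˡ (a≗b v i)

    monomial-0 : ∀ p → monomialAt p (λ _ _ → 0) ≈ 1#
    monomial-0 p = trans (Π.sum-cong-≋ {n} λ v → Π.sum-replicate-zero d) (Π.sum-replicate-zero n)

    monomial-+ : ∀ p a b → monomialAt p (λ v i → a v i ℕ.+ b v i) ≈ monomialAt p a * monomialAt p b
    monomial-+ p a b = begin
      monomialAt p (λ v i → a v i ℕ.+ b v i)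
        ≈⟨ Π.sum-cong-≋ (λ v → Π.sum-cong-≋ λ i → Pow.×-homo-+ (p v i) (a v i) (b v i)) ⟩
      Π.sum (λ v → Π.sum (λ i → (a v i Pow.× p v i) * (b v i Pow.× p v i)))
        ≈⟨ Π.sum-cong-≋ (λ v → Π.∑-distrib-+ (λ i → a v i Pow.× p v i) (λ i → b v i Pow.× p v i)) ⟩
      Π.sum (λ v → Π.sum (λ i → a v i Pow.× p v i) * Π.sum (λ i → b v i Pow.× p v i))
        ≈⟨ Π.∑-distrib-+ (λ v → Π.sum (λ i → a v i Pow.× p v i)) (λ v → Π.sum (λ i → b v i Pow.× p v i)) ⟩
      monomialAt p a * monomialAt p b ∎

    unit : Fin n → Fin d → Exp
    unit v i w j with v ≟ᶠ w | i ≟ᶠ j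
    ... | yes _ | yes _ = 1
    ... | _     | _     = 0

    unit-≢₁ : ∀ {v w} i j → v ≢ w → unit v i w j ≡ 0
    unit-≢₁ {v} {w} i j v≢w with v ≟ᶠ w | i ≟ᶠ j
    ... | yes v≡w | _     = contradiction v≡w v≢w
    ... | no _    | yes _ = ≡.refl
    ... | no _    | no _  = ≡.refl

    unit-≢₂ : ∀ v w {i j} → i ≢ j → unit v i w j ≡ 0
    unit-≢₂ v w {i} {j} i≢j with v ≟ᶠ w | i ≟ᶠ j
    ... | _     | yes i≡j = contradiction i≡j i≢j
    ... | yes _ | no _    = ≡.refl
    ... | no _  | no _    = ≡.refl

    unit-≡ : ∀ v i → unit v i v i ≡ 1
    unit-≡ v i with v ≟ᶠ v | i ≟ᶠ i
    ... | yes _  | yes _  = ≡.refl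
    ... | no v≢v | _      = contradiction ≡.refl v≢v
    ... | yes _  | no i≢i = contradiction ≡.refl i≢i

    monomial-unit : ∀ p v i → monomialAt p (unit v i) ≈ p v i
    monomial-unit p v i = begin
      monomialAt p (unit v i)
        ≈⟨ Π-at _ v (λ w w≢v → trans (Π.sum-cong-≋ λ j → Pow.×-congˡ (unit-≢₁ i j (w≢v ∘ ≡.sym)))
                                      (Π.sum-replicate-zero d)) ⟩
      Π.sum (λ j → unit v i v j Pow.× p v j)
        ≈⟨ Π-at _ i (λ j j≢i → Pow.×-congˡ (unit-≢₂ v v (j≢i ∘ ≡.sym))) ⟩
      unit v i v i Pow.× p v i
        ≈⟨ Pow.×-congˡ (unit-≡ v i) ⟩
      p v i * 1#
        ≈⟨ *-identityʳ _ ⟩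
      p v i ∎

    -- Exponents may repeat, so that sums and products are plain list operations. The distinct
    -- exponents that genericity asks for are restored by `normalise`.
    Polynomial : Set
    Polynomial = List (ℚ × Exp)

    eval : Polynomial → Pl → Carrier
    eval []            p = 0#
    eval ((c , a) ∷ P) p = ι c * monomialAt p a + eval P p

    eval-++ : ∀ P Q p → eval (P ++ Q) p ≈ eval P p + eval Q p
    eval-++ []            Q p = sym (+-identityˡ _)
    eval-++ ((c , a) ∷ P) Q p = trans (+-congˡ (eval-++ P Q p)) (sym (+-assoc _ _ _))

    scale : ℚ × Exp → Polynomial → Polynomial
    scale (c , a) = List.map λ (c′ , b) → c ℚ.* c′ , λ v i → a v i ℕ.+ b v i

    eval-scale : ∀ c a P p → eval (scale (c , a) P) p ≈ ι c * monomialAt p a * eval P p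
    eval-scale c a []             p = sym (zeroʳ _)
    eval-scale c a ((c′ , b) ∷ P) p = begin
      ι (c ℚ.* c′) * monomialAt p (λ v i → a v i ℕ.+ b v i) + eval (scale (c , a) P) p
        ≈⟨ +-cong (*-cong (ι-* c c′) (monomial-+ p a b)) (eval-scale c a P p) ⟩
      ι c * ι c′ * (monomialAt p a * monomialAt p b) + ι c * monomialAt p a * eval P p
        ≈⟨ solve 5 (λ c c′ a b e → c :* c′ :* (a :* b) :+ c :* a :* e := c :* a :* (c′ :* b :+ e))
             refl (ι c) (ι c′) (monomialAt p a) (monomialAt p b) (eval P p) ⟩
      ι c * monomialAt p a * (ι c′ * monomialAt p b + eval P p) ∎

    multiply : Polynomial → Polynomial → Polynomial
    multiply []      Q = []
    multiply (t ∷ P) Q = scale t Q ++ multiply P Q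

    eval-multiply : ∀ P Q p → eval (multiply P Q) p ≈ eval P p * eval Q p
    eval-multiply []            Q p = sym (zeroˡ _)
    eval-multiply ((c , a) ∷ P) Q p = begin
      eval (scale (c , a) Q ++ multiply P Q) p              ≈⟨ eval-++ (scale (c , a) Q) (multiply P Q) p ⟩
      eval (scale (c , a) Q) p + eval (multiply P Q) p      ≈⟨ +-cong (eval-scale c a Q p) (eval-multiply P Q p) ⟩
      ι c * monomialAt p a * eval Q p + eval P p * eval Q p   ≈⟨ distribʳ _ _ _ ⟨
      (ι c * monomialAt p a + eval P p) * eval Q p            ∎

  IsPoly : (Pl → Carrier) → Set
  IsPoly f = ∃[ P ] (∀ p → f p ≈ eval P p)

  const-isPoly : ∀ q → IsPoly (λ _ → ι q)
  const-isPoly q = (q , λ _ _ → 0) ∷ [] , λ p →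
    sym (trans (+-identityʳ _) (trans (*-congˡ (monomial-0 p)) (*-identityʳ _)))

  coordinate-isPoly : ∀ v i → IsPoly (λ p → p v i)
  coordinate-isPoly v i = (1ℚ , unit v i) ∷ [] , λ p →
    sym (trans (+-identityʳ _) (trans (*-cong ι-1 (monomial-unit p v i)) (*-identityˡ _)))

  ≈-isPoly : ∀ {f g} → (∀ p → f p ≈ g p) → IsPoly f → IsPoly g
  ≈-isPoly f≈g (P , h) = P , λ p → trans (sym (f≈g p)) (h p)

  +-isPoly : ∀ {f g} → IsPoly f → IsPoly g → IsPoly (λ p → f p + g p)
  +-isPoly (P , hP) (Q , hQ) = P ++ Q , λ p → trans (+-cong (hP p) (hQ p)) (sym (eval-++ P Q p))

  *-isPoly : ∀ {f g} → IsPoly f → IsPoly g → IsPoly (λ p → f p * g p)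
  *-isPoly (P , hP) (Q , hQ) = multiply P Q , λ p → trans (*-cong (hP p) (hQ p)) (sym (eval-multiply P Q p))

  ∸-isPoly : ∀ {f g} → IsPoly f → IsPoly g → IsPoly (λ p → f p - g p)
  ∸-isPoly {f} {g} hf hg = ≈-isPoly (λ p → +-congˡ (trans (*-congʳ (trans (ι-neg 1ℚ) (-‿cong ι-1))) (-1*x≈-x (g p))))
    (+-isPoly hf (*-isPoly (const-isPoly (ℚ.- 1ℚ)) hg))

  private
    _≗₂?_ : ∀ a b → Dec (a ≗₂ b)
    a ≗₂? b = all? λ v → all? λ i → a v i ℕ.≟ b v i

    Distinct : Polynomial → Set
    Distinct = AllPairs λ (_ , a) (_ , b) → ¬ a ≗₂ b

    insert : ℚ × Exp → Polynomial → Polynomial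
    insert (c , a) [] = (c , a) ∷ []
    insert (c , a) ((c′ , b) ∷ P) with a ≗₂? b
    ... | yes _ = (c ℚ.+ c′ , b) ∷ P
    ... | no  _ = (c′ , b) ∷ insert (c , a) P

    eval-insert : ∀ c a P p → eval (insert (c , a) P) p ≈ ι c * monomialAt p a + eval P p
    eval-insert c a []             p = refl
    eval-insert c a ((c′ , b) ∷ P) p with a ≗₂? b
    ... | yes a≗b = trans (+-congʳ (trans (*-congʳ (ι-+ c c′)) (trans (distribʳ _ _ _)
                      (+-congʳ (*-congˡ (sym (monomial-cong p a≗b)))))))
                    (+-assoc _ _ _)
    ... | no _ = trans (+-congˡ (eval-insert c a P p))
      (solve 3 (λ x y z → x :+ (y :+ z) := y :+ (x :+ z)) refl _ _ _)

    insert-all : ∀ {R : Exp → Set} {c a} P → R a → All (R ∘ proj₂) P → All (R ∘ proj₂) (insert (c , a) P)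
    insert-all []             ra []         = ra ∷ []
    insert-all {a = a} ((c′ , b) ∷ P) ra (rb ∷ rP) with a ≗₂? b
    ... | yes _ = rb ∷ rP
    ... | no  _ = rb ∷ insert-all P ra rP

    insert-distinct : ∀ {c a} P → Distinct P → Distinct (insert (c , a) P)
    insert-distinct []                     []        = [] ∷ []
    insert-distinct {a = a} ((c′ , b) ∷ P) (bP ∷ dP) with a ≗₂? b
    ... | yes _ = bP ∷ dP
    ... | no a≉b = insert-all P (λ b≗a → a≉b λ v i → ≡.sym (b≗a v i)) bP ∷ insert-distinct P dP

    normalise : Polynomial → Polynomial
    normalise = foldr insert []

    eval-normalise : ∀ P p → eval (normalise P) p ≈ eval P p
    eval-normalise []            p = refl
    eval-normalise ((c , a) ∷ P) p = trans (eval-insert c a (normalise P) p) (+-congˡ (eval-normalise P p))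

    normalise-distinct : ∀ P → Distinct (normalise P)
    normalise-distinct []      = []
    normalise-distinct (t ∷ P) = insert-distinct (normalise P) (normalise-distinct P)

    lookup-distinct : ∀ P → Distinct P →
      ∀ s s′ → proj₂ (lookup P s) ≗₂ proj₂ (lookup P s′) → s ≡ s′
    lookup-distinct (_ ∷ P) (_ ∷ _)  zero    zero     _  = ≡.refl
    lookup-distinct (_ ∷ P) (h ∷ _)  zero    (suc s′) eq = contradiction eq (All.lookup h (∈-lookup s′))
    lookup-distinct (_ ∷ P) (h ∷ _)  (suc s) zero     eq =
      contradiction (λ v i → ≡.sym (eq v i)) (All.lookup h (∈-lookup s))
    lookup-distinct (_ ∷ P) (_ ∷ dP) (suc s) (suc s′) eq = ≡.cong suc (lookup-distinct P dP s s′ eq)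

    eval-as-sum : ∀ P p → sum (λ s → ι (proj₁ (lookup P s)) * monomialAt p (proj₂ (lookup P s))) ≈ eval P p
    eval-as-sum []      p = refl
    eval-as-sum (_ ∷ P) p = +-congˡ (eval-as-sum P p)

    eval-zero : ∀ P p → (∀ s → proj₁ (lookup P s) ≡ 0ℚ) → eval P p ≈ 0#
    eval-zero []            p h = refl
    eval-zero ((c , a) ∷ P) p h = begin
      ι c * monomialAt p a + eval P p
        ≈⟨ +-cong (*-congʳ (trans (reflexive (≡.cong ι (h zero))) ι-0)) (eval-zero P p (h ∘ suc)) ⟩
      0# * monomialAt p a + 0#   ≈⟨ +-identityʳ _ ⟩
      0# * monomialAt p a        ≈⟨ zeroˡ _ ⟩
      0#                       ∎

  -- If `f` vanished at `p`, genericity would annihilate every coefficient of its normal form, and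
  -- `f` would vanish at `q` as well.
  generic-≉0 : ∀ {p} → GenericPlacement p → ∀ {f} → IsPoly f → ∀ q → f q ≉0 → f p ≉0
  generic-≉0 {p} gen {f} (P , f≈P) q fq≉0 fp≈0 = fq≉0 (begin
    f q                  ≈⟨ f≈P q ⟩
    eval P q             ≈⟨ eval-normalise P q ⟨
    eval (normalise P) q ≈⟨ eval-zero (normalise P) q coefficients≡0 ⟩
    0#                   ∎)
    where
    N = normalise P
    coefficients≡0 : ∀ s → proj₁ (lookup N s) ≡ 0ℚ
    coefficients≡0 = gen (proj₁ ∘ lookup N) (proj₂ ∘ lookup N) (lookup-distinct N (normalise-distinct P))
      (begin
        sum (λ s → ι (proj₁ (lookup N s)) * monomialAt p (proj₂ (lookup N s)))  ≈⟨ eval-as-sum N p ⟩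
        eval N p  ≈⟨ eval-normalise P p ⟩
        eval P p  ≈⟨ f≈P p ⟨
        f p       ≈⟨ fp≈0 ⟩
        0#        ∎)

  module _ {p : Pl} (gen : GenericPlacement p) where
    open Specialisation Pl IsPoly *-isPoly ∸-isPoly p (generic-≉0 gen) public

-- Points in general position

-- The first transposition takes `a` to `x`. The second takes the image of `b` to `y` and fixes `x`,
-- since `x` is neither of the two.
two-point-permutation : ∀ {n} {a b x y : Fin n} → a ≢ b → x ≢ y →
  Σ (Permutation n n) λ π → π ⟨$⟩ʳ a ≡ x × π ⟨$⟩ʳ b ≡ y
two-point-permutation {n} {a} {b} {x} {y} a≢b x≢y =
  transpose a x ∘ₚ transpose b′ y
  , ≡.trans (≡.cong (PC.transpose b′ y) (transpose-at a x)) (transpose-off (x≢b′) x≢y)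
  , transpose-at b′ y
  where
  transpose-at : ∀ i j → PC.transpose i j i ≡ j
  transpose-at i j with i ≟ᶠ i
  ... | yes _  = ≡.refl
  ... | no i≢i = contradiction ≡.refl i≢i
  transpose-off : ∀ {i j k} → k ≢ i → k ≢ j → PC.transpose i j k ≡ k
  transpose-off {i} {j} {k} k≢i k≢j with k ≟ᶠ i
  ... | yes k≡i = contradiction k≡i k≢i
  ... | no _ with k ≟ᶠ j
  ...   | yes k≡j = contradiction k≡j k≢j
  ...   | no _    = ≡.refl
  b′ = PC.transpose a x b
  x≢b′ : x ≢ b′
  x≢b′ x≡b′ = a≢b (≡.trans (≡.sym (≡.trans (≡.cong (PC.transpose x a) (≡.sym x≡b′)) (transpose-at x a)))
    (PC.transpose-inverse x a))

module Stack (F : StableDomain) where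
  open LinearAlgebra F

  stack : ∀ {m n} {C T : Set} → (C → T) → (Fin m → C → T) → (Fin n → C → T) → Fin (suc (m ℕ.+ n)) → C → T
  stack             X A B zero    = X
  stack {m = m}     X A B (suc k) = [ A , B ]′ (splitAt m k)

  -- Linear independence of the family `stack X A B`, with the coefficients of the three groups kept
  -- apart.
  JointlyIndependent : ∀ {m n} {C : Set} → (C → Carrier) → (Fin m → C → Carrier) → (Fin n → C → Carrier) → Set
  JointlyIndependent {m} {n} X A B = ∀ σ (α : Fin m → Carrier) (β : Fin n → Carrier) →
    (∀ j → σ * X j + (sum (λ i → α i * A i j) + sum (λ i → β i * B i j)) ≈ 0#) →
    σ ≈ 0# × (∀ i → α i ≈ 0#) × (∀ i → β i ≈ 0#)

  -- The symmetric square sits inside the full tensor square; the repeated coordinates `(s , s′)`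
  -- and `(s′ , s)` do not affect independence.
  square : ∀ {d} → (Fin d → Carrier) → Fin (suc d) × Fin (suc d) → Carrier
  square x (s , s′) = homogeneous x s * homogeneous x s′

  difference-square : ∀ {d} → (Fin d → Carrier) → (Fin d → Carrier) → Fin (suc d) × Fin (suc d) → Carrier
  difference-square x y (s , s′) =
    (homogeneous x s - homogeneous y s) * (homogeneous x s′ - homogeneous y s′)

  module _ {n d : ℕ} {p} (gen : Polynomials.GenericPlacement F n d p) where
    open Polynomials F n d

    specialise-joint : ∀ {m k} {C : Set} (X : C → Pl → Carrier) (A : Fin m → C → Pl → Carrier) (B : Fin k → C → Pl → Carrier) →
      (∀ j → IsPoly (X j)) → (∀ i j → IsPoly (A i j)) → (∀ i j → IsPoly (B i j)) →
      ∀ q → JointlyIndependent (λ j → X j q) (λ i j → A i j q) (λ i j → B i j q) →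
      JointlyIndependent (λ j → X j p) (λ i j → A i j p) (λ i j → B i j p)
    specialise-joint {m} {k} {C} X A B polyX polyA polyB q joint σ α β h =
      all zero , (λ i → trans (reflexive (≡.cong [ α , β ]′ (≡.sym (splitAt-↑ˡ m i k)))) (all (suc (i ↑ˡ k))))
               , (λ i → trans (reflexive (≡.cong [ α , β ]′ (≡.sym (splitAt-↑ʳ m k i)))) (all (suc (m ↑ʳ i))))
      where
      M = stack X A B
      polyM : ∀ i j → IsPoly (M i j)
      polyM zero    j = polyX j
      polyM (suc l) j with splitAt m l
      ... | inj₁ i = polyA i j
      ... | inj₂ i = polyB i j
      split : ∀ r (c : Fin (m ℕ.+ k) → Carrier) j →
        sum (λ l → c l * M (suc l) j r) ≈ sum (λ i → c (i ↑ˡ k) * A i j r) + sum (λ i → c (m ↑ʳ i) * B i j r)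
      split r c j = trans (sum-++ m (λ l → c l * M (suc l) j r)) (+-cong
        (sum-cong-≋ λ i → *-congˡ (reflexive (≡.cong (λ z → [ A , B ]′ z j r) (splitAt-↑ˡ m i k))))
        (sum-cong-≋ λ i → *-congˡ (reflexive (≡.cong (λ z → [ A , B ]′ z j r) (splitAt-↑ʳ m k i)))))
      li : LinearlyIndependent (λ i j → M i j q)
      li c h′ = λ { zero → proj₁ vanish ; (suc l) → onSplit l }
        where
        vanish = joint (c zero) (λ i → c (suc (i ↑ˡ k))) (λ i → c (suc (m ↑ʳ i)))
          λ j → trans (+-congˡ (sym (split q (c ∘ suc) j))) (h′ j)
        onSplit : ∀ l → c (suc l) ≈ 0#
        onSplit l with splitAt m l in eq
        ... | inj₁ i = trans (reflexive (≡.cong (c ∘ suc) (≡.sym (splitAt⁻¹-↑ˡ eq)))) (proj₁ (proj₂ vanish) i)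
        ... | inj₂ i = trans (reflexive (≡.cong (c ∘ suc) (≡.sym (splitAt⁻¹-↑ʳ eq)))) (proj₂ (proj₂ vanish) i)
      c : Fin (suc (m ℕ.+ k)) → Carrier
      c zero    = σ
      c (suc l) = [ α , β ]′ (splitAt m l)
      all : ∀ i → c i ≈ 0#
      all = specialise gen M polyM q li c λ j → trans (+-congˡ (trans (split p (c ∘ suc) j) (+-cong
        (sum-cong-≋ λ i → *-congʳ (reflexive (≡.cong [ α , β ]′ (splitAt-↑ˡ m i k))))
        (sum-cong-≋ λ i → *-congʳ (reflexive (≡.cong [ α , β ]′ (splitAt-↑ʳ m k i))))))) (h j)

module Affine (F : StableDomain) (n d : ℕ) where
  open LinearAlgebra F
  open Polynomials F n d

  hat : Pl → Fin n → Fin (suc d) → Carrier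
  hat p v = homogeneous (p v)

  hat-isPoly : ∀ v s → IsPoly (λ p → hat p v s)
  hat-isPoly v zero    = const-isPoly 1ℚ
  hat-isPoly v (suc r) = coordinate-isPoly v r

  sum-punchIn : ∀ {m} (f : Fin (suc m) → Carrier) i → f i ≈ 0# → sum (λ j → f (punchIn i j)) ≈ sum f
  sum-punchIn f i fi≈0 = sym (trans (sum-remove {i = i} f) (trans (+-congʳ fi≈0) (+-identityˡ _)))

  module _ {p} (gen : GenericPlacement p) where

    affinely-independent : (g : Fin (suc d) → Fin n) → (∀ i j → g i ≡ g j → i ≡ j) →
      LinearlyIndependent (λ i → hat p (g i))
    affinely-independent g inj = specialise gen (λ i s p → hat p (g i) s) (λ i s → hat-isPoly (g i) s) q li
      where
      -- A simplex: `g zero` at the origin and `g (suc r)` at the unit vector r.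
      q : Pl
      q v r = δ v (g (suc r))
      li : LinearlyIndependent (λ i → hat q (g i))
      li c h = c≈0
        where
        tail : ∀ r → c (suc r) ≈ 0#
        tail r = begin
          c (suc r)                                ≈⟨ *-identityʳ _ ⟨
          c (suc r) * 1#                           ≈⟨ *-congˡ (δ-≡ {i = g (suc r)} ≡.refl) ⟨
          c (suc r) * δ (g (suc r)) (g (suc r))    ≈⟨ sum-at (λ i → c i * δ (g i) (g (suc r))) (suc r)
                                                        (λ i i≢ → trans (*-congˡ (δ-≢ (i≢ ∘ inj i (suc r)))) (zeroʳ _)) ⟨
          sum (λ i → c i * δ (g i) (g (suc r)))    ≈⟨ h (suc r) ⟩
          0#                                       ∎
        c≈0 : ∀ i → c i ≈ 0#
        c≈0 (suc r) = tail r
        c≈0 zero    = begin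
          c zero                    ≈⟨ *-identityʳ _ ⟨
          c zero * 1#               ≈⟨ *-congˡ ι-1 ⟨
          c zero * ι 1ℚ             ≈⟨ sum-at (λ i → c i * ι 1ℚ) zero (λ { zero 0≢0 → contradiction ≡.refl 0≢0
                                                    ; (suc r) _ → trans (*-congʳ (tail r)) (zeroˡ _) }) ⟨
          sum (λ i → c i * ι 1ℚ)    ≈⟨ h zero ⟩
          0#                        ∎

    -- Dropping the index with coefficient 0 leaves d + 1 points, which are affinely independent. So
    -- one coefficient determines a dependency of d + 2 points, and by the same argument two
    -- coefficients determine one of d + 3 points.
    independent-but-one : (g : Fin (2 ℕ.+ d) → Fin n) → (∀ i j → g i ≡ g j → i ≡ j) →
      ∀ x → (∀ s → sum (λ i → x i * hat p (g i) s) ≈ 0#) → ∀ i₀ → x i₀ ≈ 0# → ∀ i → x i ≈ 0#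
    independent-but-one g inj x h i₀ x₀≈0 i with i₀ ≟ᶠ i
    ... | yes ≡.refl = x₀≈0
    ... | no i₀≢i = trans (reflexive (≡.cong x (≡.sym (punchIn-punchOut i₀≢i))))
      (affinely-independent (g ∘ punchIn i₀) (λ j k eq → punchIn-injective i₀ j k (inj _ _ eq)) (x ∘ punchIn i₀)
        (λ s → trans (sum-punchIn (λ i → x i * hat p (g i) s) i₀ (trans (*-congʳ x₀≈0) (zeroˡ _))) (h s))
        (punchOut i₀≢i))

    independent-but-two : (g : Fin (3 ℕ.+ d) → Fin n) → (∀ i j → g i ≡ g j → i ≡ j) →
      ∀ x → (∀ s → sum (λ i → x i * hat p (g i) s) ≈ 0#) →
      ∀ {i₀ i₁} → i₀ ≢ i₁ → x i₀ ≈ 0# → x i₁ ≈ 0# → ∀ i → x i ≈ 0#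
    independent-but-two g inj x h {i₀} {i₁} i₀≢i₁ x₀≈0 x₁≈0 i with i₀ ≟ᶠ i
    ... | yes ≡.refl = x₀≈0
    ... | no i₀≢i = trans (reflexive (≡.cong x (≡.sym (punchIn-punchOut i₀≢i))))
      (independent-but-one (g ∘ punchIn i₀) (λ j k eq → punchIn-injective i₀ j k (inj _ _ eq)) (x ∘ punchIn i₀)
        (λ s → trans (sum-punchIn (λ i → x i * hat p (g i) s) i₀ (trans (*-congʳ x₀≈0) (zeroˡ _))) (h s))
        (punchOut i₀≢i₁)
        (trans (reflexive (≡.cong x (punchIn-punchOut i₀≢i₁))) x₁≈0)
        (punchOut i₀≢i))

-- A special position in which the squares of the points are independent

module BaseConfiguration (F : StableDomain) (d′ : ℕ) where
  open LinearAlgebra F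
  open Stack F

  d : ℕ
  d = 4 ℕ.+ d′

  -- Rational, so that `e r u` at closed indices unfolds to `ι 0ℚ` or `ι 1ℚ`, which the ring solver
  -- treats as constants.
  kronecker : Fin d → Fin d → ℚ
  kronecker r u with r ≟ᶠ u
  ... | yes _ = 1ℚ
  ... | no  _ = 0ℚ

  e : Fin d → Fin d → Carrier
  e r u = ι (kronecker r u)

  e-≡ : ∀ {r u} → r ≡ u → e r u ≈ 1#
  e-≡ {r} {u} r≡u with r ≟ᶠ u
  ... | yes _  = ι-1
  ... | no r≢u = contradiction r≡u r≢u

  e-≢ : ∀ {r u} → r ≢ u → e r u ≈ 0#
  e-≢ {r} {u} r≢u with r ≟ᶠ u
  ... | yes r≡u = contradiction r≡u r≢u
  ... | no _    = ι-0

  -- Together with `baseQ` these are the origin, the 2d points ± eᵣ and four sums of two unit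
  -- vectors. The four sums and the one difference need five different mixed monomials xᵣxᵤ; three
  -- coordinates offer only three of them, four coordinates offer six.
  baseP : Fin (2 ℕ.+ d) → Fin d → Carrier
  baseP 0F            u = ι 0ℚ
  baseP 1F            u = e 0F u + e 1F u
  baseP (suc (suc r)) u = e r u

  baseQ : Fin (3 ℕ.+ d) → Fin d → Carrier
  baseQ 0F                  u = e 2F u + e 3F u
  baseQ 1F                  u = e 0F u + e 2F u
  baseQ 2F                  u = e 1F u + e 3F u
  baseQ (suc (suc (suc r))) u = - e r u

  private
    sum-e : ∀ (x : Fin d → Carrier) u (f : Fin d → Carrier) → sum (λ r → x r * (e r u * f r)) ≈ x u * f u
    sum-e x u f = trans
      (sum-at (λ r → x r * (e r u * f r)) u
        λ r r≢u → trans (*-congˡ (trans (*-congʳ (e-≢ r≢u)) (zeroˡ _))) (zeroʳ _))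
      (*-congˡ (trans (*-congʳ (e-≡ {u} ≡.refl)) (*-identityˡ _)))

    sum-−e : ∀ (x : Fin d → Carrier) u (f : Fin d → Carrier) → sum (λ r → x r * (- e r u * f r)) ≈ - (x u * f u)
    sum-−e x u f = trans
      (sum-cong-≋ λ r → solve 3 (λ x e f → x :* (:- e :* f) := :- (x :* (e :* f))) refl (x r) (e r u) (f r))
      (trans (sum-neg (λ r → x r * (e r u * f r))) (-‿cong (sum-e x u f)))

    off-diagonal : ∀ (x : Fin d → Carrier) {u v} → u ≢ v → sum (λ r → x r * (e r u * e r v)) ≈ 0#
    off-diagonal x {u} {v} u≢v = trans (sum-e x u (λ r → e r v)) (trans (*-congˡ (e-≢ u≢v)) (zeroʳ _))

    off-diagonal-− : ∀ (x : Fin d → Carrier) {u v} → u ≢ v → sum (λ r → x r * (- e r u * - e r v)) ≈ 0#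
    off-diagonal-− x {u} {v} u≢v = trans (sum-−e x u (λ r → - e r v)) (begin
      - (x u * - e u v)   ≈⟨ solve 2 (λ x e → :- (x :* :- e) := x :* e) refl (x u) (e u v) ⟩
      x u * e u v         ≈⟨ *-congˡ (e-≢ u≢v) ⟩
      x u * 0#            ≈⟨ zeroʳ _ ⟩
      0#                  ∎)

  -- The monomial x₁x₄ isolates (e₁ - e₄)², the monomials x₁x₂, x₃x₄, x₁x₃ and x₂x₄
  -- isolate the four sums of two basis vectors, xᵣ and xᵣ² separate ± eᵣ, and
  -- finally 1 isolates the origin.
  base-independent : JointlyIndependent (difference-square (baseP 2F) (baseP (suc (suc 3F))))
                       (square ∘ baseP) (square ∘ baseQ)
  base-independent σ α β h = σ≈0 , α≈0 , β≈0
    where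
    α′ β′ : Fin d → Carrier
    α′ r = α (suc (suc r))
    β′ r = β (suc (suc (suc r)))

    -- In a mixed coordinate the squares of the points ± eᵣ contribute nothing. Here `u` and `v`
    -- index the coordinates of a point, so `h` is used at indices larger by one, its index `zero`
    -- being the homogeneous coordinate.
    isolate : ∀ {u v} → u ≢ v → ∀ {x w} →
      x ≈ w + (sum (λ r → α′ r * (e r u * e r v)) + sum (λ r → β′ r * (- e r u * - e r v))) →
      x ≈ 0# → w ≈ 0#
    isolate {u} {v} u≢v {x} {w} eq x≈0 = begin
      w  ≈⟨ +-identityʳ w ⟨
      w + 0#  ≈⟨ +-congˡ (trans (+-cong (off-diagonal α′ u≢v) (off-diagonal-− β′ u≢v)) (+-identityˡ _)) ⟨
      w + (sum (λ r → α′ r * (e r u * e r v)) + sum (λ r → β′ r * (- e r u * - e r v))) ≈⟨ eq ⟨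
      x ≈⟨ x≈0 ⟩
      0# ∎

    -- Below z stands for the coordinate 0 and o for the coordinate 1.
    σ≈0 : σ ≈ 0#
    σ≈0 = -x≈0⇒x≈0 (isolate {0F} {3F} (λ ()) (solve 8
      (λ σ a₀ a₁ S b₀ b₁ b₂ T →
        let z = con 0ℚ ; o = con 1ℚ in
        σ :* ((o :- z) :* (z :- o)) :+ ((a₀ :* (z :* z) :+ (a₁ :* ((o :+ z) :* (z :+ z)) :+ S))
          :+ (b₀ :* ((z :+ z) :* (z :+ o)) :+ (b₁ :* ((o :+ z) :* (z :+ z)) :+ (b₂ :* ((z :+ z) :* (z :+ o)) :+ T))))
        := :- σ :+ (S :+ T)) refl σ (α 0F) (α 1F) _ (β 0F) (β 1F) (β 2F) _) (h (1F , suc 3F)))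
      where
      -x≈0⇒x≈0 : ∀ {x} → - x ≈ 0# → x ≈ 0#
      -x≈0⇒x≈0 {x} -x≈0 = trans (solve 1 (λ x → x := :- (:- x)) refl x)
        (trans (-‿cong -x≈0) -0#≈0#)

    α₁≈0 : α 1F ≈ 0#
    α₁≈0 = isolate {0F} {1F} (λ ()) (solve 8
      (λ σ a₀ a₁ S b₀ b₁ b₂ T →
        let z = con 0ℚ ; o = con 1ℚ in
        σ :* ((o :- z) :* (z :- z)) :+ ((a₀ :* (z :* z) :+ (a₁ :* ((o :+ z) :* (z :+ o)) :+ S))
          :+ (b₀ :* ((z :+ z) :* (z :+ z)) :+ (b₁ :* ((o :+ z) :* (z :+ z)) :+ (b₂ :* ((z :+ z) :* (o :+ z)) :+ T))))
        := a₁ :+ (S :+ T)) refl σ (α 0F) (α 1F) _ (β 0F) (β 1F) (β 2F) _) (h (1F , 2F))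

    β₀≈0 : β 0F ≈ 0#
    β₀≈0 = isolate {2F} {3F} (λ ()) (solve 8
      (λ σ a₀ a₁ S b₀ b₁ b₂ T →
        let z = con 0ℚ ; o = con 1ℚ in
        σ :* ((z :- z) :* (z :- o)) :+ ((a₀ :* (z :* z) :+ (a₁ :* ((z :+ z) :* (z :+ z)) :+ S))
          :+ (b₀ :* ((o :+ z) :* (z :+ o)) :+ (b₁ :* ((z :+ o) :* (z :+ z)) :+ (b₂ :* ((z :+ z) :* (z :+ o)) :+ T))))
        := b₀ :+ (S :+ T)) refl σ (α 0F) (α 1F) _ (β 0F) (β 1F) (β 2F) _) (h (3F , suc 3F))

    β₁≈0 : β 1F ≈ 0#
    β₁≈0 = isolate {0F} {2F} (λ ()) (solve 8
      (λ σ a₀ a₁ S b₀ b₁ b₂ T →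
        let z = con 0ℚ ; o = con 1ℚ in
        σ :* ((o :- z) :* (z :- z)) :+ ((a₀ :* (z :* z) :+ (a₁ :* ((o :+ z) :* (z :+ z)) :+ S))
          :+ (b₀ :* ((z :+ z) :* (o :+ z)) :+ (b₁ :* ((o :+ z) :* (z :+ o)) :+ (b₂ :* ((z :+ z) :* (z :+ z)) :+ T))))
        := b₁ :+ (S :+ T)) refl σ (α 0F) (α 1F) _ (β 0F) (β 1F) (β 2F) _) (h (1F , 3F))

    β₂≈0 : β 2F ≈ 0#
    β₂≈0 = isolate {1F} {3F} (λ ()) (solve 8
      (λ σ a₀ a₁ S b₀ b₁ b₂ T →
        let z = con 0ℚ ; o = con 1ℚ in
        σ :* ((z :- z) :* (z :- o)) :+ ((a₀ :* (z :* z) :+ (a₁ :* ((z :+ o) :* (z :+ z)) :+ S))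
          :+ (b₀ :* ((z :+ z) :* (z :+ o)) :+ (b₁ :* ((z :+ z) :* (z :+ z)) :+ (b₂ :* ((o :+ z) :* (z :+ o)) :+ T))))
        := b₂ :+ (S :+ T)) refl σ (α 0F) (α 1F) _ (β 0F) (β 1F) (β 2F) _) (h (2F , suc 3F))

    drop : ∀ {x y z} → x ≈ 0# → x * y + z ≈ z
    drop x≈0 = trans (+-congʳ (trans (*-congʳ x≈0) (zeroˡ _))) (+-identityˡ _)

    remaining : ∀ s s′ → α 0F * (homogeneous (baseP 0F) s * homogeneous (baseP 0F) s′)
      + sum (λ r → α′ r * (homogeneous (e r) s * homogeneous (e r) s′))
      + sum (λ r → β′ r * (homogeneous (-_ ∘ e r) s * homogeneous (-_ ∘ e r) s′)) ≈ 0#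
    remaining s s′ = trans (sym (trans (drop σ≈0)
      (+-cong (+-congˡ (drop α₁≈0)) (trans (drop β₀≈0) (trans (drop β₁≈0) (drop β₂≈0)))))) (h (s , s′))

    linear : ∀ r → α′ r ≈ β′ r
    linear r = begin
      α′ r
        ≈⟨ solve 3 (λ a₀ a b →
             a := (a₀ :* (con 0ℚ :* con 1ℚ) :+ a :* con 1ℚ :+ :- (b :* con 1ℚ)) :+ b) refl (α 0F) (α′ r) (β′ r) ⟩
      (α 0F * (ι 0ℚ * ι 1ℚ) + α′ r * ι 1ℚ + - (β′ r * ι 1ℚ)) + β′ r
        ≈⟨ +-congʳ (+-cong (+-congˡ (sum-e α′ r (λ _ → ι 1ℚ))) (sum-−e β′ r (λ _ → ι 1ℚ))) ⟨
      _ + β′ r                 ≈⟨ +-congʳ (remaining (suc r) zero) ⟩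
      0# + β′ r                ≈⟨ +-identityˡ _ ⟩
      β′ r                     ∎

    quadratic : ∀ r → α′ r + β′ r ≈ 0#
    quadratic r = begin
      α′ r + β′ r
        ≈⟨ solve 4 (λ a₀ a b o → a :+ b := a₀ :* (con 0ℚ :* con 0ℚ) :+ a :+ b) refl (α 0F) (α′ r) (β′ r) (ι 0ℚ) ⟩
      α 0F * (ι 0ℚ * ι 0ℚ) + α′ r + β′ r
        ≈⟨ +-cong (+-congˡ (trans (sum-e α′ r (λ u → e u r)) (trans (*-congˡ (e-≡ {r} ≡.refl)) (*-identityʳ _))))
             (trans (sum-−e β′ r (λ u → - e u r)) (trans (solve 2 (λ b e → :- (b :* :- e) := b :* e) refl (β′ r) (e r r))
               (trans (*-congˡ (e-≡ {r} ≡.refl)) (*-identityʳ _)))) ⟨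
      _ ≈⟨ remaining (suc r) (suc r) ⟩
      0# ∎

    α′≈0 : ∀ r → α′ r ≈ 0#
    α′≈0 r = *-cancel-0 (ι-≉0 {1ℚ ℚ.+ 1ℚ} λ ()) (begin
      ι (1ℚ ℚ.+ 1ℚ) * α′ r   ≈⟨ solve 1 (λ a → con (1ℚ ℚ.+ 1ℚ) :* a := a :+ a) refl (α′ r) ⟩
      α′ r + α′ r            ≈⟨ +-congˡ (linear r) ⟩
      α′ r + β′ r            ≈⟨ quadratic r ⟩
      0#                     ∎)

    β′≈0 : ∀ r → β′ r ≈ 0#
    β′≈0 r = trans (sym (linear r)) (α′≈0 r)

    α₀≈0 : α 0F ≈ 0#
    α₀≈0 = begin
      α 0F   ≈⟨ solve 1 (λ a → a := a :* (con 1ℚ :* con 1ℚ)) refl (α 0F) ⟩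
      α 0F * (ι 1ℚ * ι 1ℚ)   ≈⟨ trans (+-congʳ (+-identityʳ _)) (+-identityʳ _) ⟨
      α 0F * (ι 1ℚ * ι 1ℚ) + 0# + 0#
        ≈⟨ +-cong (+-congˡ (sum-zero λ r → trans (*-congʳ (α′≈0 r)) (zeroˡ (ι 1ℚ * ι 1ℚ))))
                  (sum-zero λ r → trans (*-congʳ (β′≈0 r)) (zeroˡ (ι 1ℚ * ι 1ℚ))) ⟨
      _ ≈⟨ remaining zero zero ⟩
      0# ∎

    α≈0 : ∀ i → α i ≈ 0#
    α≈0 0F            = α₀≈0
    α≈0 1F            = α₁≈0
    α≈0 (suc (suc r)) = α′≈0 r

    β≈0 : ∀ j → β j ≈ 0#
    β≈0 0F                  = β₀≈0
    β≈0 1F                  = β₁≈0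
    β≈0 2F                  = β₂≈0
    β≈0 (suc (suc (suc r))) = β′≈0 r

-- Stresses of complete bipartite graphs

module BipartiteStress (F : StableDomain) {d m k : ℕ} where
  open LinearAlgebra F
  open Stack F

  module _ (P : Fin m → Fin d → Carrier) (Q : Fin k → Fin d → Carrier) where

    -- ω is a stress on the edges P i – Q j and σ one on the edge P a – P c.
    module _ {a c : Fin m}
      (independent : JointlyIndependent (difference-square (P a) (P c)) (square ∘ P) (square ∘ Q))
      (σ : Carrier) (ω : Fin m → Fin k → Carrier)
      (equilibrium-P : ∀ i r → σ * ((δ i a - δ i c) * (P a r - P c r))
                             + sum (λ j → ω i j * (P i r - Q j r)) ≈ 0#)
      (equilibrium-Q : ∀ j r → sum (λ i → ω i j * (P i r - Q j r)) ≈ 0#)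
      where

      private
        P̂ : Fin m → Fin (suc d) → Carrier
        P̂ i = homogeneous (P i)

        Q̂ : Fin k → Fin (suc d) → Carrier
        Q̂ j = homogeneous (Q j)

        X : Fin (suc d) → Carrier
        X s = P̂ a s - P̂ c s

        hat-P : ∀ i s → σ * ((δ i a - δ i c) * X s) + sum (λ j → ω i j * (P̂ i s - Q̂ j s)) ≈ 0#
        hat-P i zero    = trans (+-cong
            (trans (*-congˡ (trans (*-congˡ (-‿inverseʳ _)) (zeroʳ _))) (zeroʳ _))
            (sum-zero λ j → trans (*-congˡ {ω i j} (-‿inverseʳ _)) (zeroʳ _))) (+-identityˡ _)
        hat-P i (suc r) = equilibrium-P i r

        hat-Q : ∀ j s → sum (λ i → ω i j * (P̂ i s - Q̂ j s)) ≈ 0#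
        hat-Q j zero    = sum-zero λ i → trans (*-congˡ {ω i j} (-‿inverseʳ _)) (zeroʳ _)
        hat-Q j (suc r) = equilibrium-Q j r

        α : Fin m → Carrier
        α i = sum (λ j → ω i j)

        β : Fin k → Carrier
        β j = sum (λ i → ω i j)

        sum-endpoints : ∀ (f : Fin m → Carrier) → sum (λ i → (δ i a - δ i c) * f i) ≈ f a - f c
        sum-endpoints f = begin
          sum (λ i → (δ i a - δ i c) * f i)
            ≈⟨ sum-cong-≋ (λ i → solve 3 (λ x y z → (x :- y) :* z := x :* z :+ (:- (y :* z))) refl (δ i a) (δ i c) (f i)) ⟩
          sum (λ i → δ i a * f i + - (δ i c * f i))
            ≈⟨ ∑-distrib-+ (λ i → δ i a * f i) (λ i → - (δ i c * f i)) ⟩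
          sum (λ i → δ i a * f i) + sum (λ i → - (δ i c * f i))
            ≈⟨ +-cong (sum-δ f a) (trans (sum-neg (λ i → δ i c * f i)) (-‿cong (sum-δ f c))) ⟩
          f a - f c ∎

        -- Weighting the equilibrium at P i by its coordinate s′, and the equilibrium
        -- at Q j by its coordinate s, the mixed products cancel.
        quadric-relation : ∀ s s′ → σ * (X s * X s′)
          + (sum (λ i → α i * (P̂ i s * P̂ i s′)) + sum (λ j → - β j * (Q̂ j s * Q̂ j s′))) ≈ 0#
        quadric-relation s s′ = begin
          σ * (X s * X s′) + (sum (λ i → α i * (P̂ i s * P̂ i s′)) + sum (λ j → - β j * (Q̂ j s * Q̂ j s′)))
            ≈⟨ +-congˡ (+-cong (sum-cong-≋ α-term) (trans (sum-cong-≋ β-term) (∑-comm (λ j i → - (ω i j * (Q̂ j s * Q̂ j s′)))))) ⟩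
          σ * (X s * X s′) + (sum (λ i → sum (λ j → ω i j * (P̂ i s * P̂ i s′)))
                           + sum (λ i → sum (λ j → - (ω i j * (Q̂ j s * Q̂ j s′)))))
            ≈⟨ +-congˡ (trans (sum₂-+ _ _) (trans (sum-cong-≋ λ i → sum-cong-≋ λ j → rearrange i j) (sym (sum₂-+ _ _)))) ⟩
          σ * (X s * X s′) + (sum (λ i → sum (λ j → ω i j * (P̂ i s - Q̂ j s) * P̂ i s′))
                           + sum (λ i → sum (λ j → Q̂ j s * (ω i j * (P̂ i s′ - Q̂ j s′)))))
            ≈⟨ sym (+-assoc _ _ _) ⟩
          σ * (X s * X s′) + sum (λ i → sum (λ j → ω i j * (P̂ i s - Q̂ j s) * P̂ i s′))
            + sum (λ i → sum (λ j → Q̂ j s * (ω i j * (P̂ i s′ - Q̂ j s′))))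
            ≈⟨ +-cong P-part Q-part ⟩
          0# + 0#
            ≈⟨ +-identityˡ _ ⟩
          0# ∎
          where
          α-term : ∀ i → α i * (P̂ i s * P̂ i s′) ≈ sum (λ j → ω i j * (P̂ i s * P̂ i s′))
          α-term i = *-distribʳ-sum (P̂ i s * P̂ i s′) (ω i)

          β-term : ∀ j → - β j * (Q̂ j s * Q̂ j s′) ≈ sum (λ i → - (ω i j * (Q̂ j s * Q̂ j s′)))
          β-term j = trans (sym (-‿distribˡ-* _ _))
            (trans (-‿cong (*-distribʳ-sum (Q̂ j s * Q̂ j s′) (λ i → ω i j))) (sym (sum-neg (λ i → ω i j * (Q̂ j s * Q̂ j s′)))))

          sum₂-+ : ∀ (f g : Fin m → Fin k → Carrier) →
            sum (λ i → sum (f i)) + sum (λ i → sum (g i)) ≈ sum (λ i → sum (λ j → f i j + g i j))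
          sum₂-+ f g = trans (sym (∑-distrib-+ (λ i → sum (f i)) (λ i → sum (g i))))
            (sum-cong-≋ λ i → sym (∑-distrib-+ (f i) (g i)))

          rearrange : ∀ i j → ω i j * (P̂ i s * P̂ i s′) + - (ω i j * (Q̂ j s * Q̂ j s′))
            ≈ ω i j * (P̂ i s - Q̂ j s) * P̂ i s′ + Q̂ j s * (ω i j * (P̂ i s′ - Q̂ j s′))
          rearrange i j = solve 5 (λ w x x′ y y′ →
            w :* (x :* x′) :+ (:- (w :* (y :* y′))) := w :* (x :- y) :* x′ :+ y :* (w :* (x′ :- y′)))
            refl (ω i j) (P̂ i s) (P̂ i s′) (Q̂ j s) (Q̂ j s′)

          P-part : σ * (X s * X s′) + sum (λ i → sum (λ j → ω i j * (P̂ i s - Q̂ j s) * P̂ i s′)) ≈ 0#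
          P-part = begin
            σ * (X s * X s′) + sum (λ i → sum (λ j → ω i j * (P̂ i s - Q̂ j s) * P̂ i s′))
              ≈⟨ +-cong σ-term (sum-cong-≋ λ i → sym (*-distribʳ-sum (P̂ i s′) (λ j → ω i j * (P̂ i s - Q̂ j s)))) ⟩
            sum (λ i → σ * ((δ i a - δ i c) * X s) * P̂ i s′) + sum (λ i → sum (λ j → ω i j * (P̂ i s - Q̂ j s)) * P̂ i s′)
              ≈⟨ ∑-distrib-+ (λ i → σ * ((δ i a - δ i c) * X s) * P̂ i s′) (λ i → sum (λ j → ω i j * (P̂ i s - Q̂ j s)) * P̂ i s′) ⟨
            sum (λ i → σ * ((δ i a - δ i c) * X s) * P̂ i s′ + sum (λ j → ω i j * (P̂ i s - Q̂ j s)) * P̂ i s′)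
              ≈⟨ sum-zero (λ i → trans (sym (distribʳ (P̂ i s′) _ _)) (trans (*-congʳ (hat-P i s)) (zeroˡ _))) ⟩
            0# ∎
            where
            σ-term : σ * (X s * X s′) ≈ sum (λ i → σ * ((δ i a - δ i c) * X s) * P̂ i s′)
            σ-term = begin
              σ * (X s * X s′)                                          ≈⟨ *-assoc _ _ _ ⟨
              σ * X s * X s′                                            ≈⟨ *-congˡ (sum-endpoints (λ i → P̂ i s′)) ⟨
              σ * X s * sum (λ i → (δ i a - δ i c) * P̂ i s′)            ≈⟨ *-distribˡ-sum (σ * X s) (λ i → (δ i a - δ i c) * P̂ i s′) ⟩
              sum (λ i → σ * X s * ((δ i a - δ i c) * P̂ i s′))
                ≈⟨ sum-cong-≋ (λ i → solve 4 (λ w x y z → w :* x :* (y :* z) := w :* (y :* x) :* z) refl σ (X s) (δ i a - δ i c) (P̂ i s′)) ⟩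
              sum (λ i → σ * ((δ i a - δ i c) * X s) * P̂ i s′)          ∎

          Q-part : sum (λ i → sum (λ j → Q̂ j s * (ω i j * (P̂ i s′ - Q̂ j s′)))) ≈ 0#
          Q-part = trans (∑-comm (λ i j → Q̂ j s * (ω i j * (P̂ i s′ - Q̂ j s′)))) (sum-zero λ j → trans
            (sym (*-distribˡ-sum (Q̂ j s) (λ i → ω i j * (P̂ i s′ - Q̂ j s′)))) (trans (*-congˡ (hat-Q j s′)) (zeroʳ _)))

        vanishing = independent σ α (λ j → - β j) (λ (s , s′) → quadric-relation s s′)

        drop-constant : ∀ {m} (w : Fin m → Carrier) (x : Carrier) (y : Fin m → Carrier) → sum w ≈ 0# →
          sum (λ i → w i * (x - y i)) ≈ - sum (λ i → w i * y i)
        drop-constant w x y w≈0 = begin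
          sum (λ i → w i * (x - y i))
            ≈⟨ sum-cong-≋ (λ i → solve 3 (λ w x y → w :* (x :- y) := w :* x :+ (:- (w :* y))) refl (w i) x (y i)) ⟩
          sum (λ i → w i * x + - (w i * y i))
            ≈⟨ ∑-distrib-+ (λ i → w i * x) (λ i → - (w i * y i)) ⟩
          sum (λ i → w i * x) + sum (λ i → - (w i * y i))
            ≈⟨ +-cong (trans (sym (*-distribʳ-sum x w)) (trans (*-congʳ w≈0) (zeroˡ _))) (sum-neg (λ i → w i * y i)) ⟩
          0# + - sum (λ i → w i * y i)
            ≈⟨ +-identityˡ _ ⟩
          - sum (λ i → w i * y i) ∎

        -‿≈0 : ∀ {x} → - x ≈ 0# → x ≈ 0#
        -‿≈0 {x} h = trans (solve 1 (λ x → x := :- (:- x)) refl x) (trans (-‿cong h) -0#≈0#)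

      σ≈0 : σ ≈ 0#
      σ≈0 = proj₁ vanishing

      -- Independence of the squares makes the row sums `α i` vanish along with `σ`, so `P i` drops
      -- out of its own equilibrium and only the combination of the points `Q j` remains.
      row-dependency : ∀ i s → sum (λ j → ω i j * Q̂ j s) ≈ 0#
      row-dependency i s = -‿≈0 (begin
        - sum (λ j → ω i j * Q̂ j s)                ≈⟨ drop-constant (ω i) (P̂ i s) (λ j → Q̂ j s) (proj₁ (proj₂ vanishing) i) ⟨
        sum (λ j → ω i j * (P̂ i s - Q̂ j s))        ≈⟨ +-identityˡ _ ⟨
        0# + sum (λ j → ω i j * (P̂ i s - Q̂ j s))   ≈⟨ +-congʳ (trans (*-congʳ σ≈0) (zeroˡ _)) ⟨
        σ * ((δ i a - δ i c) * X s) + sum (λ j → ω i j * (P̂ i s - Q̂ j s))   ≈⟨ hat-P i s ⟩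
        0# ∎)

      -- The same at `Q j`, with the vanishing column sums `β j`.
      column-dependency : ∀ j s → sum (λ i → ω i j * P̂ i s) ≈ 0#
      column-dependency j s = -‿≈0 (begin
        - sum (λ i → ω i j * P̂ i s)               ≈⟨ drop-constant (λ i → ω i j) (Q̂ j s) (λ i → P̂ i s) (-‿≈0 (proj₂ (proj₂ vanishing) j)) ⟨
        sum (λ i → ω i j * (Q̂ j s - P̂ i s))
          ≈⟨ sum-cong-≋ (λ i → solve 3 (λ w x y → w :* (y :- x) := :- (w :* (x :- y))) refl (ω i j) (P̂ i s) (Q̂ j s)) ⟩
        sum (λ i → - (ω i j * (P̂ i s - Q̂ j s)))   ≈⟨ sum-neg (λ i → ω i j * (P̂ i s - Q̂ j s)) ⟩
        - sum (λ i → ω i j * (P̂ i s - Q̂ j s))     ≈⟨ -‿cong (hat-Q j s) ⟩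
        - 0#                                      ≈⟨ -0#≈0# ⟩
        0# ∎)


    private
      weighted : ∀ {m} (c : Carrier) (w : Fin m → Carrier) u (f : Fin m → Carrier) →
        sum (λ j → w j * ι 1ℚ) ≈ 0# → sum (λ j → w j * f j) ≈ 0# → sum (λ j → c * w j * (u - f j)) ≈ 0#
      weighted c w u f w≈0 wf≈0 = begin
        sum (λ j → c * w j * (u - f j))
          ≈⟨ sum-cong-≋ (λ j → solve 4 (λ c w u f → c :* w :* (u :- f) := (c :* u) :* (w :* con 1ℚ) :+ (:- c) :* (w :* f)) refl c (w j) u (f j)) ⟩
        sum (λ j → c * u * (w j * ι 1ℚ) + - c * (w j * f j))
          ≈⟨ ∑-distrib-+ (λ j → c * u * (w j * ι 1ℚ)) (λ j → - c * (w j * f j)) ⟩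
        sum (λ j → c * u * (w j * ι 1ℚ)) + sum (λ j → - c * (w j * f j))
          ≈⟨ +-cong (sym (*-distribˡ-sum (c * u) (λ j → w j * ι 1ℚ))) (sym (*-distribˡ-sum (- c) (λ j → w j * f j))) ⟩
        c * u * sum (λ j → w j * ι 1ℚ) + - c * sum (λ j → w j * f j)
          ≈⟨ +-cong (trans (*-congˡ w≈0) (zeroʳ _)) (trans (*-congˡ wf≈0) (zeroʳ _)) ⟩
        0# + 0#
          ≈⟨ +-identityˡ _ ⟩
        0# ∎

    -- The converse construction: a product of affine dependencies is a stress. The coordinate
    -- `zero` of the dependency `y` removes the multiple of `P i`, its other coordinates remove the
    -- points `Q j`.
    rank-one-equilibrium-P : ∀ (x : Fin m → Carrier) (y : Fin k → Carrier) →
      (∀ s → sum (λ j → y j * homogeneous (Q j) s) ≈ 0#) →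
      ∀ i r → sum (λ j → x i * y j * (P i r - Q j r)) ≈ 0#
    rank-one-equilibrium-P x y hy i r = weighted (x i) y (P i r) (λ j → Q j r) (hy zero) (hy (suc r))

    rank-one-equilibrium-Q : ∀ (x : Fin m → Carrier) (y : Fin k → Carrier) →
      (∀ s → sum (λ i → x i * homogeneous (P i) s) ≈ 0#) →
      ∀ j r → sum (λ i → x i * y j * (P i r - Q j r)) ≈ 0#
    rank-one-equilibrium-Q x y hx j r = begin
      sum (λ i → x i * y j * (P i r - Q j r))
        ≈⟨ sum-cong-≋ (λ i → solve 4 (λ x y u v → x :* y :* (u :- v) := :- (y :* x :* (v :- u))) refl (x i) (y j) (P i r) (Q j r)) ⟩
      sum (λ i → - (y j * x i * (Q j r - P i r)))
        ≈⟨ sum-neg (λ i → y j * x i * (Q j r - P i r)) ⟩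
      - sum (λ i → y j * x i * (Q j r - P i r))
        ≈⟨ -‿cong (weighted (y j) x (Q j r) (λ i → P i r) (hx zero) (hx (suc r))) ⟩
      - 0#
        ≈⟨ -0#≈0# ⟩
      0# ∎

-- b disjoint copies of the vertex set of a complete bipartite graph with parts of sizes m and k.
module Vertices (b m k : ℕ) where

  n : ℕ
  n = b ℕ.* m ℕ.+ b ℕ.* k

  abstract
    P : Fin b → Fin m → Fin n
    P t i = combine t i ↑ˡ (b ℕ.* k)

    Q : Fin b → Fin k → Fin n
    Q t j = (b ℕ.* m) ↑ʳ combine t j

  data View : Fin n → Set where
    inP : ∀ t i → View (P t i)
    inQ : ∀ t j → View (Q t j)

  abstract
    -- Forgets the block: in the special placement used by `Transfer` all blocks lie on top of each
    -- other.
    coordinates : Fin n → Fin m ⊎ Fin k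
    coordinates v with splitAt (b ℕ.* m) v
    ... | inj₁ x = inj₁ (proj₂ (remQuot {b} m x))
    ... | inj₂ y = inj₂ (proj₂ (remQuot {b} k y))

    coordinates-P : ∀ t i → coordinates (P t i) ≡ inj₁ i
    coordinates-P t i rewrite splitAt-↑ˡ (b ℕ.* m) (combine t i) (b ℕ.* k) =
      ≡.cong (inj₁ ∘ proj₂) (remQuot-combine t i)

    coordinates-Q : ∀ t j → coordinates (Q t j) ≡ inj₂ j
    coordinates-Q t j rewrite splitAt-↑ʳ (b ℕ.* m) (b ℕ.* k) (combine t j) =
      ≡.cong (inj₂ ∘ proj₂) (remQuot-combine t j)

    view : ∀ v → View v
    view v with splitAt (b ℕ.* m) v in eq
    ... | inj₁ x = ≡.subst View (≡.trans (≡.cong (_↑ˡ (b ℕ.* k)) (combine-remQuot {b} m x)) (splitAt⁻¹-↑ˡ eq))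
                     (uncurry inP (remQuot {b} m x))
    ... | inj₂ y = ≡.subst View (≡.trans (≡.cong ((b ℕ.* m) ↑ʳ_) (combine-remQuot {b} k y)) (splitAt⁻¹-↑ʳ eq))
                     (uncurry inQ (remQuot {b} k y))

    P≢Q : ∀ {t i u j} → P t i ≢ Q u j
    P≢Q {t} {i} {u} {j} eq with () ←
      ≡.trans (≡.sym (coordinates-P t i)) (≡.trans (≡.cong coordinates eq) (coordinates-Q u j))

    P-injective : ∀ {t i u j} → P t i ≡ P u j → t ≡ u × i ≡ j
    P-injective eq = combine-injective _ _ _ _ (↑ˡ-injective (b ℕ.* k) _ _ eq)

    Q-injective : ∀ {t i u j} → Q t i ≡ Q u j → t ≡ u × i ≡ j
    Q-injective eq = combine-injective _ _ _ _ (↑ʳ-injective (b ℕ.* m) _ _ eq)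

    -- The vertices P of all blocks precede all vertices Q, so the complete graph lists each
    -- bipartite edge with the orientation from P to Q.
    P<Q : ∀ {t i u j} → P t i < Q u j
    P<Q = ≡.subst₂ ℕ._<_ (≡.sym (toℕ-↑ˡ _ (b ℕ.* k))) (≡.sym (toℕ-↑ʳ (b ℕ.* m) _))
      (ℕₚ.<-≤-trans (toℕ<n _) (ℕₚ.m≤m+n (b ℕ.* m) _))

module Transfer (F : StableDomain) {n d m k : ℕ} where
  open LinearAlgebra F
  open Stack F
  open Polynomials F n d
  open Affine F n d

  module _
    {p : Pl} (gen : GenericPlacement p)
    {P : Fin m → Fin n} {Q : Fin k → Fin n} (label : Fin n → Fin m ⊎ Fin k)
    (label-P : ∀ i → label (P i) ≡ inj₁ i) (label-Q : ∀ j → label (Q j) ≡ inj₂ j)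
    {X : Fin m → Fin d → Carrier} {Y : Fin k → Fin d → Carrier}
    where

    private
      hat² : Fin n → Fin (suc d) × Fin (suc d) → Pl → Carrier
      hat² v j p = square (p v) j

      difference² : Fin n → Fin n → Fin (suc d) × Fin (suc d) → Pl → Carrier
      difference² u v j p = difference-square (p u) (p v) j

    -- The base configuration is computed for a single difference `X x`, `X y`. Permuting the points
    -- `X` over the vertices puts this pair at `P a` and `P c` and merely relabels the squares, so
    -- every pair is covered.
    transfer : ∀ {a c x y} → a ≢ c → x ≢ y →
      JointlyIndependent (difference-square (X x) (X y)) (square ∘ X) (square ∘ Y) →
      JointlyIndependent (difference-square (p (P a)) (p (P c))) (square ∘ p ∘ P) (square ∘ p ∘ Q)
    transfer {a} {c} {x} {y} a≢c x≢y base = specialise-joint {p = p} gen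
        (difference² (P a) (P c)) (hat² ∘ P) (hat² ∘ Q)
        (λ (s , s′) → *-isPoly (∸-isPoly (hat-isPoly (P a) s) (hat-isPoly (P c) s))
                               (∸-isPoly (hat-isPoly (P a) s′) (hat-isPoly (P c) s′)))
        (λ i (s , s′) → *-isPoly (hat-isPoly (P i) s) (hat-isPoly (P i) s′))
        (λ i (s , s′) → *-isPoly (hat-isPoly (Q i) s) (hat-isPoly (Q i) s′))
        q joint
      where
      π : Permutation m m
      π = proj₁ (two-point-permutation a≢c x≢y)

      permuted : Fin m ⊎ Fin k → Fin d → Carrier
      permuted (inj₁ i) = X (π ⟨$⟩ʳ i)
      permuted (inj₂ j) = Y j

      q : Pl
      q v = permuted (label v)

      q-P : ∀ {i z} s → π ⟨$⟩ʳ i ≡ z → homogeneous (X z) s ≡ homogeneous (q (P i)) s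
      q-P {i} s ≡.refl = ≡.cong (λ z → homogeneous (permuted z) s) (≡.sym (label-P i))

      q-Q : ∀ j s → homogeneous (Y j) s ≡ homogeneous (q (Q j)) s
      q-Q j s = ≡.cong (λ z → homogeneous (permuted z) s) (≡.sym (label-Q j))

      joint : JointlyIndependent (difference-square (q (P a)) (q (P c))) (square ∘ q ∘ P) (square ∘ q ∘ Q)
      joint σ α β h =
        proj₁ vanishing
        , (λ i → trans (reflexive (≡.cong α (≡.sym (Perm.inverseˡ π)))) (proj₁ (proj₂ vanishing) (π ⟨$⟩ʳ i)))
        , proj₂ (proj₂ vanishing)
        where
        πa = proj₁ (proj₂ (two-point-permutation a≢c x≢y))
        πc = proj₂ (proj₂ (two-point-permutation a≢c x≢y))
        relation : ∀ s s′ → σ * difference-square (X x) (X y) (s , s′)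
          + (sum (λ i → α (π ⟨$⟩ˡ i) * square (X i) (s , s′)) + sum (λ j → β j * square (Y j) (s , s′))) ≈ 0#
        relation s s′ = trans
          (+-cong
            (*-congˡ (*-cong
              (+-cong (reflexive (q-P s πa)) (-‿cong (reflexive (q-P s πc))))
              (+-cong (reflexive (q-P s′ πa)) (-‿cong (reflexive (q-P s′ πc))))))
            (+-cong
              (trans (sum-permute (λ i → α (π ⟨$⟩ˡ i) * square (X i) (s , s′)) π)
                (sum-cong-≋ P-term))
              (sum-cong-≋ Q-term)))
          (h (s , s′))
          where
          P-term : ∀ i → α (π ⟨$⟩ˡ (π ⟨$⟩ʳ i)) * square (X (π ⟨$⟩ʳ i)) (s , s′) ≈ α i * square (q (P i)) (s , s′)
          P-term i = *-cong (reflexive (≡.cong α (Perm.inverseˡ π)))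
            (*-cong (reflexive (q-P {i} s ≡.refl)) (reflexive (q-P {i} s′ ≡.refl)))
          Q-term : ∀ j → β j * square (Y j) (s , s′) ≈ β j * square (q (Q j)) (s , s′)
          Q-term j = *-congˡ (*-cong (reflexive (q-Q j s)) (reflexive (q-Q j s′)))
        vanishing = base σ (λ i → α (π ⟨$⟩ˡ i)) β (λ (s , s′) → relation s s′)

-- Fold circuits of blocks of stars

module Combinatorics where

  open import Data.Fin.Subset using (_-_; inside; outside)
  open import Data.List.Relation.Unary.Any using (here; there)
  open import Data.Nat using (_+_; s≤s; z≤n)
  open import Data.Vec using (here; there)
  open ≡ using (refl; sym; trans; cong; cong₂; subst)

  module _ {m : ℕ} where

    abstract
      select : {R : Fin m → Set} → Decidable R → Subset m
      select R? = Vec.tabulate (does ∘ R?)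

      ∈-select⁺ : ∀ {R : Fin m → Set} (R? : Decidable R) {e} → R e → e ∈ select R?
      ∈-select⁺ R? {e} r = Vecₚ.lookup⇒[]= e _ (trans (Vecₚ.lookup∘tabulate (does ∘ R?) e) (dec-true (R? e) r))

      ∈-select⁻ : ∀ {R : Fin m → Set} (R? : Decidable R) {e} → e ∈ select R? → R e
      ∈-select⁻ R? {e} e∈ with trans (sym (Vecₚ.lookup∘tabulate (does ∘ R?) e)) (Vecₚ.[]=⇒lookup e∈)
      ... | eq with R? e
      ...   | yes r = r
      ...   | no _ with () ← eq

  x∈p─q⇒x∉q : ∀ {m} {x : Fin m} (p q : Subset m) → x ∈ p ─ q → x ∉ q
  x∈p─q⇒x∉q (_ ∷ p) (outside ∷ q) here        ()
  x∈p─q⇒x∉q (_ ∷ p) (_ ∷ q)       (there x∈p) (there x∈q) = x∈p─q⇒x∉q p q x∈p x∈q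

  x∈p⇒1+∣p-x∣≡∣p∣ : ∀ {m} {x : Fin m} (p : Subset m) → x ∈ p → suc ∣ p - x ∣ ≡ ∣ p ∣
  x∈p⇒1+∣p-x∣≡∣p∣ (inside  ∷ p) here        = cong (suc ∘ ∣_∣) (p─⊥≡p p)
  x∈p⇒1+∣p-x∣≡∣p∣ (inside  ∷ p) (there x∈p) = cong suc (x∈p⇒1+∣p-x∣≡∣p∣ p x∈p)
  x∈p⇒1+∣p-x∣≡∣p∣ (outside ∷ p) (there x∈p) = x∈p⇒1+∣p-x∣≡∣p∣ p x∈p

  removeAll : ∀ {m} → Subset m → List (Fin m) → Subset m
  removeAll p = foldr (λ x q → q - x) p

  removeAll⊆ : ∀ {m} (p : Subset m) xs → removeAll p xs ⊆ p
  removeAll⊆ p []       = λ x∈ → x∈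
  removeAll⊆ p (x ∷ xs) = removeAll⊆ p xs ∘ p─q⊆p (removeAll p xs) ⁅ x ⁆

  ∈-removeAll⁺ : ∀ {m} {p : Subset m} {x} xs → x ∈ p → x ∉ˡ xs → x ∈ removeAll p xs
  ∈-removeAll⁺ []       x∈p _    = x∈p
  ∈-removeAll⁺ (y ∷ xs) x∈p x∉xs =
    x∈p∧x≢y⇒x∈p-y (∈-removeAll⁺ xs x∈p (x∉xs ∘ there)) (x∉xs ∘ here)

  ∈-removeAll⁻ : ∀ {m} {p : Subset m} {x} xs → x ∈ removeAll p xs → x ∉ˡ xs
  ∈-removeAll⁻ {p = p} (y ∷ xs) x∈ (here refl)  = x∈p─q⇒x∉q (removeAll p xs) ⁅ y ⁆ x∈ (x∈⁅x⁆ y)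
  ∈-removeAll⁻ {p = p} (y ∷ xs) x∈ (there x∈xs) = ∈-removeAll⁻ xs (p─q⊆p (removeAll p xs) ⁅ y ⁆ x∈) x∈xs

  ∣removeAll∣ : ∀ {m} (p : Subset m) {xs} → Unique xs → All (_∈ p) xs → ∣ removeAll p xs ∣ + length xs ≡ ∣ p ∣
  ∣removeAll∣ p {[]}     _         _            = ℕₚ.+-identityʳ _
  ∣removeAll∣ p {x ∷ xs} (x≢ ∷ un) (x∈p ∷ xs∈p) = trans (ℕₚ.+-suc _ _)
    (trans (cong (_+ length xs) (x∈p⇒1+∣p-x∣≡∣p∣ (removeAll p xs) (∈-removeAll⁺ xs x∈p λ x∈xs → All.lookup x≢ x∈xs refl)))
           (∣removeAll∣ p un xs∈p))

  total : ∀ {n} → (Fin n → ℕ) → ℕ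
  total {zero}  f = 0
  total {suc n} f = f zero + total (f ∘ suc)

  total-cong : ∀ {n} {f g : Fin n → ℕ} → (∀ i → f i ≡ g i) → total f ≡ total g
  total-cong {zero}  h = refl
  total-cong {suc n} h = cong₂ _+_ (h zero) (total-cong (h ∘ suc))

  total-mono : ∀ {n} {f g : Fin n → ℕ} → (∀ i → f i ≤ g i) → total f ≤ total g
  total-mono {zero}  h = z≤n
  total-mono {suc n} h = ℕₚ.+-mono-≤ (h zero) (total-mono (h ∘ suc))

  total-pinch : ∀ {n} {f g : Fin n → ℕ} → (∀ i → f i ≤ g i) → total f ≡ total g → ∀ i → f i ≡ g i
  total-pinch {suc n} {f} {g} h eq = λ { zero → head ; (suc i) → total-pinch (h ∘ suc) tail i }
    where
    head : f zero ≡ g zero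
    head = ℕₚ.≤-antisym (h zero) (ℕₚ.+-cancelʳ-≤ (total (f ∘ suc)) (g zero) (f zero)
      (ℕₚ.≤-trans (ℕₚ.+-monoʳ-≤ (g zero) (total-mono (h ∘ suc))) (ℕₚ.≤-reflexive (sym eq))))
    tail : total (f ∘ suc) ≡ total (g ∘ suc)
    tail = ℕₚ.+-cancelˡ-≡ (f zero) _ _ (trans eq (cong (_+ total (g ∘ suc)) (sym head)))

  total-drop : ∀ {n} {f g : Fin n → ℕ} i → f i ≡ suc (g i) → (∀ j → j ≢ i → f j ≡ g j) → total f ≡ suc (total g)
  total-drop {suc n} {f} {g} zero    fi others = cong₂ _+_ fi (total-cong λ j → others (suc j) λ ())
  total-drop {suc n} {f} {g} (suc i) fi others = trans
    (cong₂ _+_ (others zero λ ()) (total-drop i fi λ j j≢i → others (suc j) λ { refl → j≢i refl }))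
    (ℕₚ.+-suc (g zero) (total (g ∘ suc)))

  total-1 : ∀ n → total {n} (λ _ → 1) ≡ n
  total-1 zero    = refl
  total-1 (suc n) = cong suc (total-1 n)

  length-concat-tabulate : ∀ {A : Set} {n} (f : Fin n → List A) → length (concat (tabulate f)) ≡ total (length ∘ f)
  length-concat-tabulate {n = zero}  f = refl
  length-concat-tabulate {n = suc n} f =
    trans (length-++ (f zero)) (cong (length (f zero) +_) (length-concat-tabulate (f ∘ suc)))

  rank-unique : ∀ {m} (Indep : IndependenceSystem m) {X r r′} → HasRank Indep X r → HasRank Indep X r′ → r ≡ r′
  rank-unique Indep ((I , I⊆X , iI , refl) , ub) ((J , J⊆X , iJ , refl) , ub′) =
    ℕₚ.≤-antisym (ub′ I I⊆X iI) (ub J J⊆X iJ)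

  module Stars {m b M K : ℕ} (ε : Fin b → Fin M → Fin K → Fin m) where

    MissesTwo : Subset m → Fin b → Set
    MissesTwo J t = ∃[ i₀ ] ∃[ j₀ ] ∃[ i₁ ] ∃[ j₁ ] j₀ ≢ j₁ × ε t i₀ j₀ ∉ J × ε t i₁ j₁ ∉ J

    ContainsAllButOne : Subset m → Fin b → Set
    ContainsAllButOne J t = ∃[ j₀ ] (∀ i j → j ≢ j₀ → ε t i j ∈ J)

    InBlocks : Fin m → Set
    InBlocks e = ∃[ t ] ∃[ i ] ∃[ j ] e ≡ ε t i j

  -- An independence system containing b blocks of edges ε t i j, where j is the star of the
  -- edge.  Within the blocks a set is independent exactly when in every block
  -- it misses edges from two different stars.
  module Blocks {m : ℕ} (Indep : IndependenceSystem m) (b′ M′ K′ : ℕ)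
    (ε : Fin (suc b′) → Fin (suc M′) → Fin (2 + K′) → Fin m)
    (ε-injective : ∀ {t i j t′ i′ j′} → ε t i j ≡ ε t′ i′ j′ → t ≡ t′ × i ≡ i′ × j ≡ j′)
    (independent : ∀ J → (∀ {e} → e ∈ J → Stars.InBlocks ε e) → (∀ t → Stars.MissesTwo ε J t) → Indep J)
    (dependent : ∀ J t → Stars.ContainsAllButOne ε J t → ¬ Indep J)
    where

    open Stars ε

    b K : ℕ
    b = suc b′
    K = suc (suc K′)

    -- Membership in `J` is decidable, so this finite search decides independence inside the blocks
    -- without deciding anything about ℝ.
    dichotomy : ∀ J t → MissesTwo J t ⊎ ContainsAllButOne J t
    dichotomy J t with any? (λ j → any? λ i → ¬? (ε t i j ∈? J))
    ... | no none = inj₂ (zero , λ i j _ → decidable-stable (ε t i j ∈? J) λ ∉J → none (j , i , ∉J))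
    ... | yes (j₀ , i₀ , ∉J) with any? (λ j → any? λ i → ¬? (j ≟ᶠ j₀) ×-dec ¬? (ε t i j ∈? J))
    ...   | no none = inj₂ (j₀ , λ i j j≢j₀ → decidable-stable (ε t i j ∈? J) λ ∉J → none (j , i , j≢j₀ , ∉J))
    ...   | yes (j₁ , i₁ , j₁≢j₀ , ∉J′) = inj₁ (i₀ , j₀ , i₁ , j₁ , j₁≢j₀ ∘ sym , ∉J , ∉J′)

    independent⇒missesTwo : ∀ {J} → Indep J → ∀ t → MissesTwo J t
    independent⇒missesTwo {J} iJ t with dichotomy J t
    ... | inj₁ misses   = misses
    ... | inj₂ contains = contradiction iJ (dependent J t contains)

    -- The traces that a cyclic set can leave on a block: all of it, all but one star, or nothing.
    -- Their nullities are given by `fold`.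
    data State : Set where
      full  : State
      minus : Fin K → State
      empty : State

    Present : State → Fin K → Set
    Present full       j = ⊤
    Present (minus j₀) j = j ≢ j₀
    Present empty      j = Empty.⊥

    present? : ∀ s j → Dec (Present s j)
    present? full       j = yes tt
    present? (minus j₀) j = ¬? (j ≟ᶠ j₀)
    present? empty      j = no λ ()

    fold : State → ℕ
    fold full      = 2
    fold (minus _) = 1
    fold empty     = 0

    other : Fin K → Fin K
    other zero    = 1F
    other (suc _) = 0F

    other≢ : ∀ j → other j ≢ j
    other≢ zero    ()
    other≢ (suc _) ()

    Active : (Fin b → State) → Fin m → Set
    Active s e = ∃[ t ] ∃[ i ] ∃[ j ] e ≡ ε t i j × Present (s t) j

    abstract
      active? : ∀ s → Decidable (Active s)
      active? s e = any? λ t → any? λ i → any? λ j → (e ≟ᶠ ε t i j) ×-dec present? (s t) j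

      D : (Fin b → State) → Subset m
      D s = select (active? s)

      ∈D⁻ : ∀ {s e} → e ∈ D s → Active s e
      ∈D⁻ {s} = ∈-select⁻ (active? s)

      ε∈D⁺ : ∀ {s t i j} → Present (s t) j → ε t i j ∈ D s
      ε∈D⁺ {s} pr = ∈-select⁺ (active? s) (_ , _ , _ , refl , pr)

    ε∈D⁻ : ∀ {s t i j} → ε t i j ∈ D s → Present (s t) j
    ε∈D⁻ {s} ∈D with t , i , j , eq , pr ← ∈D⁻ {s} ∈D with refl , refl , refl ← ε-injective eq = pr

    D-inBlocks : ∀ s {e} → e ∈ D s → InBlocks e
    D-inBlocks s e∈ with t , i , j , eq , _ ← ∈D⁻ {s} e∈ = t , i , j , eq

    -- Edges of D s outside J, as many in each block as its nullity.
    Omitted : (Fin b → State) → Subset m → Fin b → Set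
    Omitted s J t = Σ (List (Fin m)) λ L → Unique L × length L ≡ fold (s t)
      × All (λ e → (∃[ i ] ∃[ j ] e ≡ ε t i j × Present (s t) j) × e ∉ J) L

    module _ {s J} (omitted : ∀ t → Omitted s J t) where

      omissions : List (Fin m)
      omissions = concat (tabulate (proj₁ ∘ omitted))

      omissions-unique : Unique omissions
      omissions-unique = Uniqueₚ.concat⁺ (Allₚ.tabulate⁺ (proj₁ ∘ proj₂ ∘ omitted))
        (AllPairsₚ.tabulate⁺ λ {t} {u} t≢u (x∈t , x∈u) →
          let (_ , _ , eq , _) , _ = All.lookup (proj₂ (proj₂ (proj₂ (omitted t)))) x∈t
              (_ , _ , eq′ , _) , _ = All.lookup (proj₂ (proj₂ (proj₂ (omitted u)))) x∈u
          in t≢u (proj₁ (ε-injective (trans (sym eq) eq′))))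

      omissions-all : ∀ {R : Fin m → Set} →
        (∀ {e} t → (∃[ i ] ∃[ j ] e ≡ ε t i j × Present (s t) j) × e ∉ J → R e) → All R omissions
      omissions-all f = Allₚ.concat⁺ (Allₚ.tabulate⁺ λ t → All.map (f t) (proj₂ (proj₂ (proj₂ (omitted t)))))

      omissions∈D : All (_∈ D s) omissions
      omissions∈D = omissions-all λ { t ((i , j , refl , pr) , _) → ε∈D⁺ {s} pr }

      omissions∉J : All (_∉ J) omissions
      omissions∉J = omissions-all λ _ → proj₂

      length-omissions : length omissions ≡ total (fold ∘ s)
      length-omissions = trans (length-concat-tabulate (proj₁ ∘ omitted)) (total-cong (proj₁ ∘ proj₂ ∘ proj₂ ∘ omitted))

      ∣D∖omissions∣ : ∣ removeAll (D s) omissions ∣ + total (fold ∘ s) ≡ ∣ D s ∣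
      ∣D∖omissions∣ = trans (cong (∣ removeAll (D s) omissions ∣ +_) (sym length-omissions))
        (∣removeAll∣ (D s) omissions-unique omissions∈D)

    -- The edges whose removal from `D s` leaves a basis. Being outside `∅` is no restriction, so
    -- `Omitted` can be reused for them.
    representatives : ∀ s t → Omitted s ∅ t
    representatives s t with s t
    ... | full    = ε t 0F 0F ∷ ε t 0F 1F ∷ []
                  , ((λ eq → 0≢1 (proj₂ (proj₂ (ε-injective eq)))) ∷ []) ∷ [] ∷ []
                  , refl , ((0F , 0F , refl , tt) , ∉⊥) ∷ ((0F , 1F , refl , tt) , ∉⊥) ∷ []
      where
      0≢1 : 0F ≢ 1F
      0≢1 ()
    ... | minus j = ε t 0F (other j) ∷ [] , [] ∷ [] , refl , ((0F , other j , refl , other≢ j) , ∉⊥) ∷ []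
    ... | empty   = [] , [] , refl , []

    basis : (Fin b → State) → Subset m
    basis s = removeAll (D s) (omissions (representatives s))

    basis⊆D : ∀ s → basis s ⊆ D s
    basis⊆D s = removeAll⊆ (D s) (omissions (representatives s))

    basis-independent : ∀ s → Indep (basis s)
    basis-independent s = independent (basis s) (D-inBlocks s ∘ basis⊆D s) misses
      where
      omit : ∀ t {e} → e ∈ˡ proj₁ (representatives s t) → e ∉ basis s
      omit t e∈ e∈basis = ∈-removeAll⁻ (omissions (representatives s)) e∈basis
        (∈-concat⁺′ e∈ (∈-tabulate⁺ {f = proj₁ ∘ representatives s} t))
      absent : ∀ t {i j} → ¬ Present (s t) j → ε t i j ∉ basis s
      absent t ¬pr = ¬pr ∘ ε∈D⁻ {s} ∘ basis⊆D s
      misses : ∀ t → MissesTwo (basis s) t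
      misses t with s t in eq | omit t | absent t
      ... | full    | om | _  = 0F , 0F , 0F , 1F , (λ ()) , om (here refl) , om (there (here refl))
      ... | minus j | om | ab = 0F , other j , 0F , j , other≢ j , om (here refl) , ab (λ j≢j → j≢j refl)
      ... | empty   | _  | ab = 0F , 0F , 0F , 1F , (λ ()) , ab (λ ()) , ab (λ ())

    -- `J` misses edges of two different stars. If star `j` is absent from `D s`, at most one of the
    -- two lies in it, so the other is an omitted edge of `D s`.
    missing : ∀ s J → Indep J → ∀ t → Omitted s J t
    missing s J iJ t with i₀ , j₀ , i₁ , j₁ , j₀≢j₁ , ∉₀ , ∉₁ ← independent⇒missesTwo iJ t with s t
    ... | full    = ε t i₀ j₀ ∷ ε t i₁ j₁ ∷ []
                  , ((λ eq → j₀≢j₁ (proj₂ (proj₂ (ε-injective eq)))) ∷ []) ∷ [] ∷ []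
                  , refl , ((i₀ , j₀ , refl , tt) , ∉₀) ∷ ((i₁ , j₁ , refl , tt) , ∉₁) ∷ []
    ... | empty   = [] , [] , refl , []
    ... | minus j with j₀ ≟ᶠ j
    ...   | no j₀≢j  = ε t i₀ j₀ ∷ [] , [] ∷ [] , refl , ((i₀ , j₀ , refl , j₀≢j) , ∉₀) ∷ []
    ...   | yes refl = ε t i₁ j₁ ∷ [] , [] ∷ [] , refl , ((i₁ , j₁ , refl , j₀≢j₁ ∘ sym) , ∉₁) ∷ []

    -- The basis omits exactly `fold (s t)` edges in block t, and by `missing` every independent
    -- subset of `D s` omits at least as many.
    D-rank : ∀ s → ∃[ r ] HasRank Indep (D s) r × r + total (fold ∘ s) ≡ ∣ D s ∣
    D-rank s = ∣ basis s ∣ , ((basis s , basis⊆D s , basis-independent s , refl) , upper)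
             , ∣D∖omissions∣ (representatives s)
      where
      upper : ∀ J → J ⊆ D s → Indep J → ∣ J ∣ ≤ ∣ basis s ∣
      upper J J⊆D iJ = ℕₚ.≤-trans
        (p⊆q⇒∣p∣≤∣q∣ λ x∈J → ∈-removeAll⁺ (omissions om) (J⊆D x∈J) λ x∈om → All.lookup (omissions∉J om) x∈om x∈J)
        (ℕₚ.≤-reflexive (ℕₚ.+-cancelʳ-≡ (total (fold ∘ s)) _ _
          (trans (∣D∖omissions∣ om) (sym (∣D∖omissions∣ (representatives s))))))
        where om = missing s J iJ

    only : Fin b → State → Fin b → State
    only t st u with u ≟ᶠ t
    ... | yes _ = st
    ... | no  _ = empty

    only-present⁺ : ∀ t {st j} → Present st j → Present (only t st t) j
    only-present⁺ t pr with t ≟ᶠ t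
    ... | yes _  = pr
    ... | no t≢t = contradiction refl t≢t

    only-present⁻ : ∀ {t st u j} → Present (only t st u) j → u ≡ t × Present st j
    only-present⁻ {t} {st} {u} pr with u ≟ᶠ t
    ... | yes u≡t = u≡t , pr

    circuit : Fin b → Fin K → Subset m
    circuit t j₀ = D (only t (minus j₀))

    -- Star `j₀` is absent already, so the loss of any further edge gives a second star with an
    -- absent edge.
    circuit-isCircuit : ∀ t j₀ → IsCircuit Indep (circuit t j₀)
    circuit-isCircuit t j₀ =
      dependent _ t (j₀ , λ i j j≢j₀ → ε∈D⁺ {only t (minus j₀)} (only-present⁺ t j≢j₀)) , proper
      where
      proper : ∀ X → X ⊂ circuit t j₀ → Indep X
      proper X (X⊆C , x , x∈C , x∉X) with u , i , j , refl , pr ← ∈D⁻ {only t (minus j₀)} x∈C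
        with refl , j≢j₀ ← only-present⁻ {t} {minus j₀} {u} pr =
        independent X (D-inBlocks (only t (minus j₀)) ∘ X⊆C) misses
        where
        absent : ∀ {u i j} → ¬ (u ≡ t × j ≢ j₀) → ε u i j ∉ X
        absent ¬pr e∈X = ¬pr (only-present⁻ {t} {minus j₀} (ε∈D⁻ {only t (minus j₀)} (X⊆C e∈X)))
        misses : ∀ u → MissesTwo X u
        misses u with u ≟ᶠ t
        ... | yes refl = i , j , 0F , j₀ , j≢j₀ , x∉X , absent (λ (_ , j₀≢j₀) → j₀≢j₀ refl)
        ... | no u≢t = 0F , 0F , 0F , 1F , (λ ()) , absent (u≢t ∘ proj₁) , absent (u≢t ∘ proj₁)

    D-cyclic : ∀ s → IsCyclic Indep (D s)
    D-cyclic s e e∈ with t , i , j , refl , pr ← ∈D⁻ {s} e∈ =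
      let j₀ , j≢j₀ , mono = pick in
      circuit t j₀ , circuit-isCircuit t j₀
      , (λ x∈ → sub j₀ mono x∈) , ε∈D⁺ {only t (minus j₀)} (only-present⁺ t j≢j₀)
      where
      pick : ∃[ j₀ ] j ≢ j₀ × (∀ {j′} → j′ ≢ j₀ → Present (s t) j′)
      pick with s t
      ... | full     = other j , other≢ j ∘ sym , λ _ → tt
      ... | minus j₀ = j₀ , pr , λ j′≢ → j′≢
      ... | empty    = ⊥-elim pr
      sub : ∀ j₀ → (∀ {j′} → j′ ≢ j₀ → Present (s t) j′) → circuit t j₀ ⊆ D s
      sub j₀ mono x∈ with u , i , j , refl , pr ← ∈D⁻ {only t (minus j₀)} x∈
        with refl , j≢j₀ ← only-present⁻ {t} {minus j₀} {u} pr = ε∈D⁺ {s} (mono j≢j₀)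

    D-isFoldCircuit : ∀ s → IsFoldCircuit Indep (total (fold ∘ s)) (D s)
    D-isFoldCircuit s = D-cyclic s , D-rank s

    -- A dependent set inside the blocks contains some block up to one star `j₀`. If the given edge
    -- were not in that part, `C` would stay dependent after its removal, against minimality.
    circuit-contains : ∀ {C} → IsCircuit Indep C → (∀ {e} → e ∈ C → InBlocks e) →
      ∀ {t i j} → ε t i j ∈ C → ∃[ j₀ ] j ≢ j₀ × (∀ i′ j′ → j′ ≢ j₀ → ε t i′ j′ ∈ C)
    circuit-contains {C} (¬iC , proper) inBlocks {t} {i} {j} e∈C with search
      where
      search : ∃[ u ] ContainsAllButOne C u
      search with any? (λ u → any? λ j₀ → all? λ i → all? λ j → ¬? (j ≟ᶠ j₀) →-dec (ε u i j ∈? C))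
      ... | yes found = found
      ... | no none = contradiction (independent C inBlocks misses) ¬iC
        where
        misses : ∀ u → MissesTwo C u
        misses u with dichotomy C u
        ... | inj₁ two = two
        ... | inj₂ all = contradiction (u , all) none
    ... | u , j₀ , all with t ≟ᶠ u | j ≟ᶠ j₀
    ...   | yes refl | no j≢j₀ = j₀ , j≢j₀ , all
    ...   | no t≢u   | _       = contradiction (proper (C - ε t i j) (x∈p⇒p-x⊂p e∈C))
            (dependent _ u (j₀ , λ i′ j′ j′≢ → x∈p∧x≢y⇒x∈p-y (all i′ j′ j′≢) (λ eq → t≢u (sym (proj₁ (ε-injective eq))))))
    ...   | yes refl | yes refl = contradiction (proper (C - ε t i j) (x∈p⇒p-x⊂p e∈C))
            (dependent _ t (j₀ , λ i′ j′ j′≢ → x∈p∧x≢y⇒x∈p-y (all i′ j′ j′≢) (λ eq → j′≢ (proj₂ (proj₂ (ε-injective eq))))))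

    -- An edge of `X` in the block lies in a circuit, which brings in every star but some `j₀`. If
    -- `X` also has an edge of star `j₀`, the circuit through that edge leaves out a different star
    -- and so brings in star `j₀` entirely.
    cyclic-state : ∀ {X} → IsCyclic Indep X → (∀ {e} → e ∈ X → InBlocks e) →
      ∀ t → Σ State λ st → (∀ i j → ε t i j ∈ X ⇔ Present st j)
    cyclic-state {X} cyc inBlocks t with any? (λ j → any? λ i → ε t i j ∈? X)
    ... | no none = empty , λ i j → mk⇔ (λ e∈ → none (j , i , e∈)) (λ ())
    ... | yes (j , i , e∈) with C , isC , C⊆X , e∈C ← cyc _ e∈
      with j₀ , j≢j₀ , all ← circuit-contains isC (inBlocks ∘ C⊆X) e∈C
      with any? (λ i → ε t i j₀ ∈? X)
    ...   | no none = minus j₀ , λ i′ j′ → mk⇔ (λ { e∈′ refl → none (i′ , e∈′) }) (λ j′≢ → C⊆X (all i′ j′ j′≢))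
    ...   | yes (i₁ , e₁∈) with C₁ , isC₁ , C₁⊆X , e₁∈C₁ ← cyc _ e₁∈
      with j₁ , j₀≢j₁ , all₁ ← circuit-contains isC₁ (inBlocks ∘ C₁⊆X) e₁∈C₁ = full , λ i′ j′ → mk⇔ (λ _ → tt) (λ _ → both i′ j′)
      where
      both : ∀ i′ j′ → ε t i′ j′ ∈ X
      both i′ j′ with j′ ≟ᶠ j₀
      ... | yes refl = C₁⊆X (all₁ i′ j′ j₀≢j₁)
      ... | no j′≢j₀ = C⊆X (all i′ j′ j′≢j₀)

    cyclic≡D : ∀ {X} → IsCyclic Indep X → (∀ {e} → e ∈ X → InBlocks e) → Σ (Fin b → State) λ s → X ≡ D s
    cyclic≡D {X} cyc inBlocks = proj₁ ∘ state , ⊆-antisym to from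
      where
      open Function.Equivalence using () renaming (to to ⇒; from to ⇐)
      state = cyclic-state cyc inBlocks
      to : X ⊆ D (proj₁ ∘ state)
      to e∈ with t , i , j , refl ← inBlocks e∈ = ε∈D⁺ {proj₁ ∘ state} (⇒ (proj₂ (state t) i j) e∈)
      from : D (proj₁ ∘ state) ⊆ X
      from e∈ with t , i , j , refl , pr ← ∈D⁻ {proj₁ ∘ state} e∈ = ⇐ (proj₂ (state t) i j) pr

    _≼_ : State → State → Set
    s ≼ s′ = ∀ j → Present s j → Present s′ j

    ⊆⇒≼ : ∀ {s s′} → D s ⊆ D s′ → ∀ t → s t ≼ s′ t
    ⊆⇒≼ {s} {s′} sub t j pr = ε∈D⁻ {s′} {i = 0F} (sub (ε∈D⁺ {s} pr))

    ≼⇒⊆ : ∀ {s s′} → (∀ t → s t ≼ s′ t) → D s ⊆ D s′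
    ≼⇒⊆ {s} {s′} le e∈ with t , i , j , refl , pr ← ∈D⁻ {s} e∈ = ε∈D⁺ {s′} (le t j pr)

    ≼⇒fold≤ : ∀ {s s′} → s ≼ s′ → fold s ≤ fold s′
    ≼⇒fold≤ {empty}            le = z≤n
    ≼⇒fold≤ {minus j} {full}    le = s≤s z≤n
    ≼⇒fold≤ {minus j} {minus _} le = ℕₚ.≤-refl
    ≼⇒fold≤ {minus j} {empty}   le = ⊥-elim (le (other j) (other≢ j))
    ≼⇒fold≤ {full}    {full}    le = ℕₚ.≤-refl
    ≼⇒fold≤ {full}    {minus j} le = contradiction refl (le j tt)
    ≼⇒fold≤ {full}    {empty}   le = ⊥-elim (le 0F tt)

    ≼∧fold≡⇒≽ : ∀ {s s′} → s ≼ s′ → fold s ≡ fold s′ → s′ ≼ s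
    ≼∧fold≡⇒≽ {empty}   {empty}   le eq j ()
    ≼∧fold≡⇒≽ {full}    {full}    le eq j pr = tt
    ≼∧fold≡⇒≽ {minus i} {minus k} le eq j j≢k refl with k ≟ᶠ i
    ... | yes refl = j≢k refl
    ... | no k≢i   = le k k≢i refl
    ≼∧fold≡⇒≽ {empty}   {full}    le () 
    ≼∧fold≡⇒≽ {empty}   {minus _} le ()
    ≼∧fold≡⇒≽ {full}    {empty}   le ()
    ≼∧fold≡⇒≽ {full}    {minus _} le ()
    ≼∧fold≡⇒≽ {minus _} {empty}   le ()
    ≼∧fold≡⇒≽ {minus _} {full}    le ()

    -- The fold circuit of the theorem: block 0 entirely, the others without star 0.
    whole : Fin b → State
    whole zero    = full
    whole (suc _) = minus 0F

    -- Its principal partition: the stars of block 0, and the other blocks.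
    without : Fin K ⊎ Fin b′ → Fin b → State
    without (inj₁ j) zero    = minus j
    without (inj₁ j) (suc t) = minus 0F
    without (inj₂ u) zero    = full
    without (inj₂ u) (suc t) with t ≟ᶠ u
    ... | yes _ = empty
    ... | no  _ = minus 0F

    without-≼ : ∀ x t → without x t ≼ whole t
    without-≼ (inj₁ j) zero    _ _  = tt
    without-≼ (inj₁ j) (suc t) _ pr = pr
    without-≼ (inj₂ u) zero    _ pr = pr
    without-≼ (inj₂ u) (suc t) _ pr with t ≟ᶠ u
    ... | no _ = pr

    total-whole : total (fold ∘ whole) ≡ 2 + b′
    total-whole = cong (2 +_) (total-1 b′)

    total-without : ∀ x → total (fold ∘ without x) ≡ 1 + b′
    total-without x = ℕₚ.suc-injective (trans (sym (lemma x)) total-whole)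
      where
      lemma : ∀ x → total (fold ∘ whole) ≡ suc (total (fold ∘ without x))
      lemma (inj₁ j) = total-drop {f = fold ∘ whole} {g = fold ∘ without (inj₁ j)} zero refl
        λ { zero 0≢0 → contradiction refl 0≢0 ; (suc t) _ → refl }
      lemma (inj₂ u) = total-drop {f = fold ∘ whole} {g = fold ∘ without (inj₂ u)} (suc u) at off
        where
        at : 1 ≡ suc (fold (without (inj₂ u) (suc u)))
        at with u ≟ᶠ u
        ... | yes _  = refl
        ... | no u≢u = contradiction refl u≢u
        off : ∀ t → t ≢ suc u → fold (whole t) ≡ fold (without (inj₂ u) t)
        off zero    _   = refl
        off (suc t) t≢u with t ≟ᶠ u
        ... | yes refl = contradiction refl t≢u
        ... | no _     = refl

    private
      class : Fin (K + b′) → Fin K ⊎ Fin b′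
      class = splitAt K

    -- Defined as a complement, so that removing it from `D whole` gives back
    -- `D (without (class a))`. Edge by edge it is described by `classOf`.
    part : Fin (K + b′) → Subset m
    part a = D whole ─ D (without (class a))

    whole─part : ∀ a → D whole ─ part a ≡ D (without (class a))
    whole─part a = ⊆-antisym to from
      where
      W = D whole
      Y = D (without (class a))
      to : W ─ part a ⊆ Y
      to {x} x∈ with x ∈? Y
      ... | yes x∈Y = x∈Y
      ... | no x∉Y = contradiction (x∈p∧x∉q⇒x∈p─q (p─q⊆p W (part a) x∈) x∉Y) (x∈p─q⇒x∉q W (part a) x∈)
      from : Y ⊆ W ─ part a
      from x∈Y = x∈p∧x∉q⇒x∈p─q (≼⇒⊆ {without (class a)} {whole} (without-≼ (class a)) x∈Y)
        (λ x∈part → x∈p─q⇒x∉q W Y x∈part x∈Y)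

    classOf : ∀ t {j} → Present (whole t) j → Fin K ⊎ Fin b′
    classOf zero    {j} _ = inj₁ j
    classOf (suc t)     _ = inj₂ t

    classOf-spec : ∀ t {j} (pr : Present (whole t) j) x → ¬ Present (without x t) j → x ≡ classOf t pr
    classOf-spec zero {j} pr (inj₁ j₀) ¬pr = cong inj₁ (sym (decidable-stable (j ≟ᶠ j₀) ¬pr))
    classOf-spec zero     pr (inj₂ u)  ¬pr = contradiction tt ¬pr
    classOf-spec (suc t)  pr (inj₁ j₀) ¬pr = contradiction pr ¬pr
    classOf-spec (suc t)  pr (inj₂ u)  ¬pr with t ≟ᶠ u
    ... | yes refl = refl
    ... | no _     = contradiction pr ¬pr

    without-own : ∀ u j → ¬ Present (without (inj₂ u) (suc u)) j
    without-own u j pr with u ≟ᶠ u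
    ... | no u≢u = u≢u refl

    classOf-removed : ∀ t {j} (pr : Present (whole t) j) → ¬ Present (without (classOf t pr) t) j
    classOf-removed zero    pr j≢j = j≢j refl
    classOf-removed (suc t) pr     = without-own t _

    ∈part⇒class : ∀ {a e} → e ∈ part a → ∃[ t ] ∃[ i ] ∃[ j ] Σ (Present (whole t) j) λ pr →
      e ≡ ε t i j × class a ≡ classOf t pr
    ∈part⇒class {a} e∈ with t , i , j , refl , pr ← ∈D⁻ {whole} (p─q⊆p (D whole) _ e∈) =
      t , i , j , pr , refl
      , classOf-spec t pr (class a) λ pr′ → x∈p─q⇒x∉q (D whole) _ e∈ (ε∈D⁺ {without (class a)} pr′)

    class-injective : ∀ {a c} → class a ≡ class c → a ≡ c
    class-injective {a} {c} eq = trans (sym (join-splitAt K b′ a)) (trans (cong (join K b′) eq) (join-splitAt K b′ c))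

    ∈part : ∀ t {i j} (pr : Present (whole t) j) → ε t i j ∈ part (join K b′ (classOf t pr))
    ∈part t {i} {j} pr = x∈p∧x∉q⇒x∈p─q (ε∈D⁺ {whole} pr) λ e∈ →
      classOf-removed t pr (subst (λ x → Present (without x t) j) (splitAt-join K b′ (classOf t pr))
        (ε∈D⁻ {without (class (join K b′ (classOf t pr)))} e∈))

    part-nonempty : ∀ a → ∃[ e ] e ∈ part a
    part-nonempty a = subst (λ c → ∃[ e ] e ∈ part c) (join-splitAt K b′ a) (nonempty (class a))
      where
      nonempty : ∀ x → ∃[ e ] e ∈ part (join K b′ x)
      nonempty (inj₁ j) = ε zero 0F j , ∈part zero tt
      nonempty (inj₂ u) = ε (suc u) 0F 1F , ∈part (suc u) {j = 1F} (λ ())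

    isPrincipalPartition : IsPrincipalPartition Indep (2 + b′) (D whole) part
    isPrincipalPartition = record
      { nonempty = part-nonempty
      ; disjoint = disjoint
      ; covers   = λ e → mk⇔ cover λ (a , e∈) → p─q⊆p (D whole) _ e∈
      ; sound    = λ a → subst (IsFoldCircuit Indep (1 + b′)) (sym (whole─part a))
                     (subst (λ k → IsFoldCircuit Indep k (D (without (class a)))) (total-without (class a))
                       (D-isFoldCircuit (without (class a))))
      ; complete = complete
      }
      where
      disjoint : ∀ a c → a ≢ c → ∀ e → e ∈ part a → e ∉ part c
      disjoint a c a≢c e e∈a e∈c
        with t , i , j , pr , refl , eq ← ∈part⇒class {a} e∈a
           | t′ , i′ , j′ , pr′ , eqε , eq′ ← ∈part⇒class {c} e∈c
        with refl , refl , refl ← ε-injective eqε =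
        a≢c (class-injective (trans eq (trans (classOf-irrelevant t pr pr′) (sym eq′))))
        where
        classOf-irrelevant : ∀ t {j} (pr pr′ : Present (whole t) j) → classOf t pr ≡ classOf t pr′
        classOf-irrelevant zero    _ _ = refl
        classOf-irrelevant (suc t) _ _ = refl

      cover : ∀ {e} → e ∈ D whole → ∃[ a ] e ∈ part a
      cover e∈ with t , i , j , refl , pr ← ∈D⁻ {whole} e∈ =
          join K b′ (classOf t pr) , ∈part t pr

      -- A cyclic `X` is some `D s` with `s` below `whole`. Its total nullity is smaller by one, so
      -- some block has lost something, which puts `s` below some `without x`. As the total
      -- nullities of these two agree, they agree in every block.
      complete : ∀ X → X ⊆ D whole → IsFoldCircuit Indep (1 + b′) X → ∃[ a ] X ≡ D whole ─ part a
      complete X X⊆W (cyc , r , hasRank , r+k≡)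
        with s , refl ← cyclic≡D cyc (D-inBlocks whole ∘ X⊆W) = conclude (smaller-block find)
        where
        total-s : total (fold ∘ s) ≡ 1 + b′
        total-s =
          let r′ , hasRank′ , r′+ = D-rank s
          in ℕₚ.+-cancelˡ-≡ r _ _ (trans (cong (_+ total (fold ∘ s)) (rank-unique Indep hasRank hasRank′))
               (trans r′+ (sym r+k≡)))

        le : ∀ t → s t ≼ whole t
        le = ⊆⇒≼ {s} {whole} X⊆W

        find : ∃[ t ] fold (s t) ≢ fold (whole t)
        find = ¬∀⟶∃¬ b _ (λ t → fold (s t) ℕ.≟ fold (whole t)) λ eq →
          ℕₚ.1+n≢n (trans (sym (trans (total-cong eq) total-whole)) total-s)

        smaller-block : ∃[ t ] fold (s t) ≢ fold (whole t) → Σ (Fin K ⊎ Fin b′) λ x → ∀ t → s t ≼ without x t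
        smaller-block (zero , ne) with s zero in eq
        ... | full    = contradiction refl ne
        ... | minus j = inj₁ j , λ { zero k pr → subst (λ z → Present z k) eq pr ; (suc t) → le (suc t) }
        -- A default star. The count of nullities excludes this case, but here only an upper bound
        -- for `s` is asked for.
        ... | empty   = inj₁ 0F , λ { zero k pr → ⊥-elim (subst (λ z → Present z k) eq pr) ; (suc t) → le (suc t) }
        smaller-block (suc u , ne) with s (suc u) in eq
        ... | full    = contradiction refl (subst (_≼ minus 0F) eq (le (suc u)) 0F tt)
        ... | minus j = contradiction refl ne
        ... | empty   = inj₂ u , λ { zero → le zero ; (suc t) → at t }
          where
          at : ∀ t → s (suc t) ≼ without (inj₂ u) (suc t)
          at t with t ≟ᶠ u
          ... | yes refl = λ k pr → subst (λ z → Present z k) eq pr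
          ... | no _     = le (suc t)

        conclude : (Σ (Fin K ⊎ Fin b′) λ x → ∀ t → s t ≼ without x t) → ∃[ a ] D s ≡ D whole ─ part a
        conclude (x , s≼) = join K b′ x , trans equal (sym (trans (whole─part (join K b′ x)) (cong (D ∘ without) (splitAt-join K b′ x))))
          where
          folds : ∀ t → fold (s t) ≡ fold (without x t)
          folds = total-pinch {f = fold ∘ s} {g = fold ∘ without x} (λ t → ≼⇒fold≤ {s t} {without x t} (s≼ t))
            (trans total-s (sym (total-without x)))
          equal : D s ≡ D (without x)
          equal = ⊆-antisym (≼⇒⊆ {s} {without x} s≼) (≼⇒⊆ {without x} {s} λ t → ≼∧fold≡⇒≽ {s t} {without x t} (s≼ t) (folds t))

    whole-isFoldCircuit : IsFoldCircuit Indep (2 + b′) (D whole)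
    whole-isFoldCircuit = subst (λ k → IsFoldCircuit Indep k (D whole)) total-whole (D-isFoldCircuit whole)

open Combinatorics

-- Stresses and closures in rigidity matroids

module Framework (F : StableDomain) {n d m : ℕ} (endpoints : Fin m → Fin n × Fin n)
                 (p : Fin n → Fin d → CommutativeRing.Carrier (StableDomain.commutativeRing F)) where
  open LinearAlgebra F
  open Stack F

  source target : Fin m → Fin n
  source = proj₁ ∘ endpoints
  target = proj₂ ∘ endpoints

  -- The row of the rigidity matrix as one product: the first factor is 1 at the source, -1 at the
  -- target and 0 at the other vertices of an edge that is not a loop.
  row : Fin m → Fin n → Fin d → Carrier
  row e w r = (δ w (source e) - δ w (target e)) * (p (source e) r - p (target e) r)

  row-nonincident : ∀ {e w} → w ≢ source e → w ≢ target e → ∀ r → row e w r ≈ 0#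
  row-nonincident w≢s w≢t r = trans (*-congʳ (+-cong (δ-≢ w≢s) (-‿cong (δ-≢ w≢t))))
    (trans (*-congʳ (-‿inverseʳ 0#)) (zeroˡ _))

  row-source : ∀ {e w} → w ≡ source e → w ≢ target e → ∀ r → row e w r ≈ p (source e) r - p (target e) r
  row-source w≡s w≢t r = trans (*-congʳ (+-cong (δ-≡ w≡s) (-‿cong (δ-≢ w≢t))))
    (trans (*-congʳ (trans (+-congˡ -0#≈0#) (+-identityʳ 1#))) (*-identityˡ _))

  row-target : ∀ {e w} → w ≢ source e → w ≡ target e → ∀ r → row e w r ≈ - (p (source e) r - p (target e) r)
  row-target w≢s w≡t r = trans (*-congʳ (+-cong (δ-≢ w≢s) (-‿cong (δ-≡ w≡t))))
    (trans (*-congʳ (+-identityˡ (- 1#))) (-1*x≈-x _))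

  IsStress : (Fin m → Carrier) → Set
  IsStress c = ∀ w r → sum (λ e → c e * row e w r) ≈ 0#

  StressFree : Subset m → Set
  StressFree S = ∀ c → (∀ e → e ∉ S → c e ≈ 0#) → IsStress c → ∀ e → c e ≈ 0#

  module _ (A : Fin m → Fin n × Fin d → Carrier)
    (loopless : ∀ e → source e ≢ target e)
    (A-source : ∀ e r → A e (source e , r) ≈ p (source e) r - p (target e) r)
    (A-target : ∀ e r → A e (target e , r) ≈ p (target e) r - p (source e) r)
    (A-nonincident : ∀ e w r → w ≢ source e → w ≢ target e → A e (w , r) ≈ 0#)
    where

    row≈ : ∀ e w r → row e w r ≈ A e (w , r)
    row≈ e w r = cases (w ≟ᶠ source e) (w ≟ᶠ target e)
      where
      cases : ∀ {w} → Dec (w ≡ source e) → Dec (w ≡ target e) → row e w r ≈ A e (w , r)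
      cases (yes ≡.refl) _            = trans (row-source ≡.refl (loopless e) r) (sym (A-source e r))
      cases (no w≢s)     (yes ≡.refl) = trans (row-target w≢s ≡.refl r) (trans
        (solve 2 (λ x y → :- (x :- y) := y :- x) refl (p (source e) r) (p (target e) r)) (sym (A-target e r)))
      cases (no w≢s)     (no w≢t)     = trans (row-nonincident w≢s w≢t r) (sym (A-nonincident e _ r w≢s w≢t))

    RowsIndependent : Subset m → Set
    RowsIndependent S = (c : Fin m → Carrier) → (∀ e → e ∉ S → c e ≈ 0#) →
      (∀ j → sum (λ e → c e * A e j) ≈ 0#) → ∀ e → c e ≈ 0#

    rowsIndependent⇒stressFree : ∀ {S} → RowsIndependent S → StressFree S
    rowsIndependent⇒stressFree free c support stress = free c support λ (w , r) →
      trans (sum-cong-≋ λ e → *-congˡ (sym (row≈ e w r))) (stress w r)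

    stressFree⇒rowsIndependent : ∀ {S} → StressFree S → RowsIndependent S
    stressFree⇒rowsIndependent free c support stress = free c support λ w r →
      trans (sum-cong-≋ λ e → *-congˡ (row≈ e w r)) (stress (w , r))

  module Closure {Indep : Subset m → Set}
    (to : ∀ {S} → Indep S → StressFree S) (from : ∀ {S} → StressFree S → Indep S) where

    -- If no stress on `X` and `x` uses `x`, then adding `x` to a maximum independent subset of `X`
    -- keeps it independent, so the rank grows.
    free⇒∉closure : ∀ {x X} → x ∉ X →
      (∀ c → (∀ e → e ∉ X → e ≢ x → c e ≈ 0#) → IsStress c → c x ≈ 0#) → ¬ InClosure Indep x X
    free⇒∉closure {x} {X} x∉X free (r , ((I , I⊆X , iI , ≡.refl) , _) , _ , bound) =
      ℕₚ.<-irrefl ≡.refl (ℕₚ.≤-trans larger (bound (I ∪ ⁅ x ⁆) I∪x⊆X∪x (from stressFree)))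
      where
      larger : ∣ I ∣ ℕ.< ∣ I ∪ ⁅ x ⁆ ∣
      larger = p⊂q⇒∣p∣<∣q∣ {p = I} {q = I ∪ ⁅ x ⁆}
        (p⊆p∪q ⁅ x ⁆ , x , q⊆p∪q I ⁅ x ⁆ (x∈⁅x⁆ x) , x∉X ∘ I⊆X)
      I∪x⊆X∪x : I ∪ ⁅ x ⁆ ⊆ X ∪ ⁅ x ⁆
      I∪x⊆X∪x y∈ with x∈p∪q⁻ I ⁅ x ⁆ y∈
      ... | inj₁ y∈I = p⊆p∪q ⁅ x ⁆ (I⊆X y∈I)
      ... | inj₂ y∈x = q⊆p∪q X ⁅ x ⁆ y∈x
      stressFree : StressFree (I ∪ ⁅ x ⁆)
      stressFree c support stress = to iI c supportI stress
        where
        outside : ∀ {e} → e ∉ I → e ≢ x → c e ≈ 0#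
        outside e∉I e≢x = support _ λ e∈ → case (x∈p∪q⁻ I ⁅ x ⁆ e∈)
          where
          case : _ → _
          case (inj₁ e∈I) = e∉I e∈I
          case (inj₂ e∈x) = e≢x (x∈⁅y⁆⇒x≡y x e∈x)
        supportI : ∀ e → e ∉ I → c e ≈ 0#
        supportI e e∉I with e ≟ᶠ x
        ... | yes ≡.refl = free c (λ e e∉X → outside (e∉X ∘ I⊆X)) stress
        ... | no e≢x     = outside e∉I e≢x

    module _ (distinct : ∀ {u v} → u ≢ v → ∃[ r ] p u r - p v r ≉0) (loopless : ∀ e → source e ≢ target e) where

      -- No edge of `X` meets `w`, so in the equilibrium at `w` the edge `x` stands alone; a
      -- coordinate in which its endpoints differ forces its coefficient to vanish.
      isolated⇒∉closure : ∀ {x X} w → w ≡ source x ⊎ w ≡ target x →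
        (∀ {e} → e ∈ X → w ≢ source e × w ≢ target e) → ¬ InClosure Indep x X
      isolated⇒∉closure {x} {X} w incident isolated with r , difference≉0 ← distinct (loopless x) = free⇒∉closure x∉X
        λ c support stress → *-cancel-0 row≉0 (trans (*-comm _ _)
          (trans (sym (sum-at (λ e → c e * row e w r) x (term c support))) (stress w r)))
        where
        x∉X : x ∉ X
        x∉X x∈X = clash incident (isolated x∈X)
          where
          clash : w ≡ source x ⊎ w ≡ target x → ¬ (w ≢ source x × w ≢ target x)
          clash (inj₁ w≡s) (w≢s , _) = w≢s w≡s
          clash (inj₂ w≡t) (_ , w≢t) = w≢t w≡t
        nonzero : w ≡ source x ⊎ w ≡ target x → row x w r ≉0
        nonzero (inj₁ w≡s) row≈0 = difference≉0
          (trans (sym (row-source w≡s (λ w≡t → loopless x (≡.trans (≡.sym w≡s) w≡t)) r)) row≈0)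
        nonzero (inj₂ w≡t) row≈0 = difference≉0 (begin
          p (source x) r - p (target x) r          ≈⟨ solve 1 (λ x → x := :- (:- x)) refl _ ⟩
          - - (p (source x) r - p (target x) r)
            ≈⟨ -‿cong (row-target (λ w≡s → loopless x (≡.trans (≡.sym w≡s) w≡t)) w≡t r) ⟨
          - row x w r                              ≈⟨ -‿cong row≈0 ⟩
          - 0#                                     ≈⟨ -0#≈0# ⟩
          0#                                       ∎)
        row≉0 : row x w r ≉0
        row≉0 = nonzero incident
        term : ∀ (c : Fin m → Carrier) → (∀ e → e ∉ X → e ≢ x → c e ≈ 0#) → ∀ e → e ≢ x → c e * row e w r ≈ 0#
        term c support e e≢x with e ∈? X
        ... | yes e∈X = trans (*-congˡ (row-nonincident (proj₁ (isolated e∈X)) (proj₂ (isolated e∈X)) r)) (zeroʳ _)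
        ... | no e∉X  = trans (*-congʳ (support e e∉X e≢x)) (zeroˡ _)

module BlockFramework (F : StableDomain) {d m b M K : ℕ}
  (endpoints : Fin m → Fin (Vertices.n b M K) × Fin (Vertices.n b M K))
  (p : Fin (Vertices.n b M K) → Fin d → CommutativeRing.Carrier (StableDomain.commutativeRing F))
  (ε : Fin b → Fin M → Fin K → Fin m)
  (endpoints-ε : ∀ t i j → endpoints (ε t i j) ≡ (Vertices.P b M K t i , Vertices.Q b M K t j))
  (endpoints-injective : ∀ {e e′} → endpoints e ≡ endpoints e′ → e ≡ e′)
  where
  open LinearAlgebra F
  open Stack F
  open BipartiteStress F
  open Vertices b M K
  open Framework F endpoints p

  source-ε : ∀ t i j → source (ε t i j) ≡ P t i
  source-ε t i j = ≡.cong proj₁ (endpoints-ε t i j)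

  target-ε : ∀ t i j → target (ε t i j) ≡ Q t j
  target-ε t i j = ≡.cong proj₂ (endpoints-ε t i j)

  ε-injective : ∀ {t i j t′ i′ j′} → ε t i j ≡ ε t′ i′ j′ → t ≡ t′ × i ≡ i′ × j ≡ j′
  ε-injective {t} {i} {j} {t′} {i′} {j′} eq =
    let t≡ , i≡ = P-injective (≡.trans (≡.sym (source-ε t i j)) (≡.trans (≡.cong source eq) (source-ε t′ i′ j′)))
        _  , j≡ = Q-injective (≡.trans (≡.sym (target-ε t i j)) (≡.trans (≡.cong target eq) (target-ε t′ i′ j′)))
    in t≡ , i≡ , j≡

  inBlocks? : ∀ e → Dec (∃[ t ] ∃[ i ] ∃[ j ] e ≡ ε t i j)
  inBlocks? e = any? λ t → any? λ i → any? λ j → e ≟ᶠ ε t i j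

  P≢target : ∀ {u i} t i′ j → P u i ≢ target (ε t i′ j)
  P≢target t i′ j eq = P≢Q (≡.trans eq (target-ε t i′ j))

  Q≢source : ∀ {u j} t i j′ → Q u j ≢ source (ε t i j′)
  Q≢source t i j′ eq = P≢Q (≡.sym (≡.trans eq (source-ε t i j′)))

  row-ε-P : ∀ t i j r → row (ε t i j) (P t i) r ≈ p (P t i) r - p (Q t j) r
  row-ε-P t i j r = trans (row-source (≡.sym (source-ε t i j)) (P≢target t i j) r)
    (reflexive (≡.cong₂ (λ u v → p u r - p v r) (source-ε t i j) (target-ε t i j)))

  row-ε-Q : ∀ t i j r → row (ε t i j) (Q t j) r ≈ - (p (P t i) r - p (Q t j) r)
  row-ε-Q t i j r = trans (row-target (Q≢source t i j) (≡.sym (target-ε t i j)) r)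
    (reflexive (≡.cong₂ (λ u v → - (p u r - p v r)) (source-ε t i j) (target-ε t i j)))

  row-ε-P-≢ : ∀ t i j u i′ r → (u , i′) ≢ (t , i) → row (ε t i j) (P u i′) r ≈ 0#
  row-ε-P-≢ t i j u i′ r ne = row-nonincident
    (λ eq → let u≡t , i′≡i = P-injective (≡.trans eq (source-ε t i j)) in ne (≡.cong₂ _,_ u≡t i′≡i))
    (P≢target t i j) r

  row-ε-Q-≢ : ∀ t i j u j′ r → (u , j′) ≢ (t , j) → row (ε t i j) (Q u j′) r ≈ 0#
  row-ε-Q-≢ t i j u j′ r ne = row-nonincident (Q≢source t i j)
    (λ eq → let u≡t , j′≡j = Q-injective (≡.trans eq (target-ε t i j)) in ne (≡.cong₂ _,_ u≡t j′≡j)) r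

  module _ {t : Fin b} {a a′ : Fin M} (a≢a′ : a ≢ a′) {x : Fin m} (endpoints-x : endpoints x ≡ (P t a , P t a′))
    {c : Fin m → Carrier} (support : ∀ e → e ≢ x → ¬ (∃[ t ] ∃[ i ] ∃[ j ] e ≡ ε t i j) → c e ≈ 0#)
    (stress : IsStress c)
    where

    private
      source-x : source x ≡ P t a
      source-x = ≡.cong proj₁ endpoints-x

      target-x : target x ≡ P t a′
      target-x = ≡.cong proj₂ endpoints-x

      x≢ε : ∀ {u i j} → x ≢ ε u i j
      x≢ε {u} {i} {j} ≡.refl = P≢Q (≡.trans (≡.sym target-x) (target-ε u i j))

      δ-P : ∀ i i′ → δ (P t i) (P t i′) ≈ δ i i′
      δ-P i i′ with i ≟ᶠ i′
      ... | yes ≡.refl = δ-≡ {i = P t i} ≡.refl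
      ... | no i≢i′    = δ-≢ (i≢i′ ∘ proj₂ ∘ P-injective)

    equilibrium-P : ∀ i r → c x * ((δ i a - δ i a′) * (p (P t a) r - p (P t a′) r))
                          + sum (λ j → c (ε t i j) * (p (P t i) r - p (Q t j) r)) ≈ 0#
    equilibrium-P i r = begin
      c x * ((δ i a - δ i a′) * (p (P t a) r - p (P t a′) r)) + sum (λ j → c (ε t i j) * (p (P t i) r - p (Q t j) r))
        ≈⟨ +-cong (*-congˡ row-x) (sum-cong-≋ λ j → *-congˡ (row-ε-P t i j r)) ⟨
      sum (λ k → f (g k))
        ≈⟨ sum-reindex f g g-injective outside ⟨
      sum f
        ≈⟨ stress (P t i) r ⟩
      0# ∎
      where
      f : Fin m → Carrier
      f e = c e * row e (P t i) r
      -- The diagonal is listed at every `P t i`; away from its endpoints its row vanishes, which is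
      -- what `row-x` records.
      g : Fin (suc K) → Fin m
      g zero    = x
      g (suc j) = ε t i j
      g-injective : ∀ k l → g k ≡ g l → k ≡ l
      g-injective zero    zero    _  = ≡.refl
      g-injective zero    (suc l) eq = contradiction eq x≢ε
      g-injective (suc k) zero    eq = contradiction (≡.sym eq) x≢ε
      g-injective (suc k) (suc l) eq = ≡.cong suc (proj₂ (proj₂ (ε-injective eq)))
      row-x : row x (P t i) r ≈ (δ i a - δ i a′) * (p (P t a) r - p (P t a′) r)
      row-x = trans (reflexive (≡.cong₂ (λ u v → (δ (P t i) u - δ (P t i) v) * (p u r - p v r)) source-x target-x))
        (*-congʳ (+-cong (δ-P i a) (-‿cong (δ-P i a′))))
      outside : ∀ e → (∀ k → g k ≢ e) → f e ≈ 0#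
      outside e ∉g with inBlocks? e
      ... | no ∉blocks = trans (*-congʳ (support e (∉g zero ∘ ≡.sym) ∉blocks)) (zeroˡ _)
      ... | yes (u , i′ , j , ≡.refl) = trans
              (*-congˡ (row-ε-P-≢ u i′ j t i r λ { ≡.refl → ∉g (suc j) ≡.refl })) (zeroʳ _)

    equilibrium-Q : ∀ j r → sum (λ i → c (ε t i j) * (p (P t i) r - p (Q t j) r)) ≈ 0#
    equilibrium-Q j r = begin
      sum (λ i → c (ε t i j) * (p (P t i) r - p (Q t j) r))
        ≈⟨ sum-cong-≋ (λ i → solve 2 (λ c y → c :* y := :- (c :* (:- y))) refl (c (ε t i j)) (p (P t i) r - p (Q t j) r)) ⟩
      sum (λ i → - (c (ε t i j) * - (p (P t i) r - p (Q t j) r)))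
        ≈⟨ sum-neg (λ i → c (ε t i j) * - (p (P t i) r - p (Q t j) r)) ⟩
      - sum (λ i → c (ε t i j) * - (p (P t i) r - p (Q t j) r))
        ≈⟨ -‿cong (sum-cong-≋ λ i → *-congˡ (row-ε-Q t i j r)) ⟨
      - sum (λ i → f (ε t i j))
        ≈⟨ -‿cong (sum-reindex f (λ i → ε t i j) (λ _ _ → proj₁ ∘ proj₂ ∘ ε-injective) outside) ⟨
      - sum f
        ≈⟨ -‿cong (stress (Q t j) r) ⟩
      - 0#
        ≈⟨ -0#≈0# ⟩
      0# ∎
      where
      f : Fin m → Carrier
      f e = c e * row e (Q t j) r
      outside : ∀ e → (∀ i → ε t i j ≢ e) → f e ≈ 0#
      outside e ∉g with inBlocks? e
      ... | yes (u , i , j′ , ≡.refl) = trans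
              (*-congˡ (row-ε-Q-≢ u i j′ t j r λ { ≡.refl → ∉g i ≡.refl })) (zeroʳ _)
      ... | no ∉blocks with e ≟ᶠ x
      ...   | no e≢x     = trans (*-congʳ (support e e≢x ∉blocks)) (zeroˡ _)
      ...   | yes ≡.refl = trans (*-congˡ (row-nonincident
                (λ eq → P≢Q (≡.sym (≡.trans eq source-x))) (λ eq → P≢Q (≡.sym (≡.trans eq target-x))) r)) (zeroʳ _)

  module _ (t : Fin b) (ω : Fin M → Fin K → Carrier) where

    extension : Fin m → Carrier
    extension e with any? (λ i → any? λ j → e ≟ᶠ ε t i j)
    ... | yes (i , j , _) = ω i j
    ... | no _            = 0#

    extension-ε : ∀ i j → extension (ε t i j) ≈ ω i j
    extension-ε i j with any? (λ i′ → any? λ j′ → ε t i j ≟ᶠ ε t i′ j′)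
    ... | yes (i′ , j′ , eq) = let _ , i≡ , j≡ = ε-injective eq in reflexive (≡.cong₂ ω (≡.sym i≡) (≡.sym j≡))
    ... | no none            = contradiction (i , j , ≡.refl) none

    extension-isStress :
      (∀ i r → sum (λ j → ω i j * (p (P t i) r - p (Q t j) r)) ≈ 0#) →
      (∀ j r → sum (λ i → ω i j * (p (P t i) r - p (Q t j) r)) ≈ 0#) →
      IsStress extension
    extension-isStress eqP eqQ w r with view w
    ... | inP u i = at (u ≟ᶠ t)
      where
      f : Fin m → Carrier
      f e = extension e * row e (P u i) r
      at : Dec (u ≡ t) → sum f ≈ 0#
      at (yes ≡.refl) = begin
        sum f
          ≈⟨ sum-reindex f (ε t i) (λ _ _ → proj₂ ∘ proj₂ ∘ ε-injective) outside ⟩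
        sum (λ j → f (ε t i j))
          ≈⟨ sum-cong-≋ (λ j → *-cong (extension-ε i j) (row-ε-P t i j r)) ⟩
        sum (λ j → ω i j * (p (P t i) r - p (Q t j) r))
          ≈⟨ eqP i r ⟩
        0# ∎
        where
        outside : ∀ e → (∀ j → ε t i j ≢ e) → f e ≈ 0#
        outside e ∉g with any? (λ i′ → any? λ j′ → e ≟ᶠ ε t i′ j′) in eq
        ... | yes (i′ , j′ , ≡.refl) = trans
                (*-congˡ (row-ε-P-≢ t i′ j′ t i r λ { ≡.refl → ∉g j′ ≡.refl })) (zeroʳ _)
        ... | no _ = zeroˡ _
      at (no u≢t) = sum-zero λ e → term e
        where
        term : ∀ e → f e ≈ 0#
        term e with any? (λ i′ → any? λ j′ → e ≟ᶠ ε t i′ j′)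
        ... | yes (i′ , j′ , ≡.refl) = trans
                (*-congˡ (row-ε-P-≢ t i′ j′ u i r λ { ≡.refl → u≢t ≡.refl })) (zeroʳ _)
        ... | no _ = zeroˡ _
    ... | inQ u j = at (u ≟ᶠ t)
      where
      f : Fin m → Carrier
      f e = extension e * row e (Q u j) r
      at : Dec (u ≡ t) → sum f ≈ 0#
      at (yes ≡.refl) = begin
        sum f
          ≈⟨ sum-reindex f (λ i → ε t i j) (λ _ _ → proj₁ ∘ proj₂ ∘ ε-injective) outside ⟩
        sum (λ i → f (ε t i j))
          ≈⟨ sum-cong-≋ (λ i → *-cong (extension-ε i j) (row-ε-Q t i j r)) ⟩
        sum (λ i → ω i j * - (p (P t i) r - p (Q t j) r))
          ≈⟨ sum-cong-≋ (λ i → sym (-‿distribʳ-* (ω i j) (p (P t i) r - p (Q t j) r))) ⟩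
        sum (λ i → - (ω i j * (p (P t i) r - p (Q t j) r)))
          ≈⟨ sum-neg (λ i → ω i j * (p (P t i) r - p (Q t j) r)) ⟩
        - sum (λ i → ω i j * (p (P t i) r - p (Q t j) r))
          ≈⟨ -‿cong (eqQ j r) ⟩
        - 0#
          ≈⟨ -0#≈0# ⟩
        0# ∎
        where
        outside : ∀ e → (∀ i → ε t i j ≢ e) → f e ≈ 0#
        outside e ∉g with any? (λ i′ → any? λ j′ → e ≟ᶠ ε t i′ j′) in eq
        ... | yes (i′ , j′ , ≡.refl) = trans
                (*-congˡ (row-ε-Q-≢ t i′ j′ t j r λ { ≡.refl → ∉g i′ ≡.refl })) (zeroʳ _)
        ... | no _ = zeroˡ _
      at (no u≢t) = sum-zero λ e → term e
        where
        term : ∀ e → f e ≈ 0#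
        term e with any? (λ i′ → any? λ j′ → e ≟ᶠ ε t i′ j′)
        ... | yes (i′ , j′ , ≡.refl) = trans
                (*-congˡ (row-ε-Q-≢ t i′ j′ u j r λ { ≡.refl → u≢t ≡.refl })) (zeroʳ _)
        ... | no _ = zeroˡ _

  module _
    (quadrics : ∀ t {a a′} → a ≢ a′ →
      JointlyIndependent (difference-square (p (P t a)) (p (P t a′))) (square ∘ p ∘ P t) (square ∘ p ∘ Q t))
    where

    diagonal-unstressed : ∀ {t a a′} → a ≢ a′ → ∀ {x} → endpoints x ≡ (P t a , P t a′) →
      ∀ {c} → (∀ e → e ≢ x → ¬ (∃[ t ] ∃[ i ] ∃[ j ] e ≡ ε t i j) → c e ≈ 0#) → IsStress c → c x ≈ 0#
    diagonal-unstressed {t} a≢a′ {x} eq {c} support stress =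
      σ≈0 (p ∘ P t) (p ∘ Q t) (quadrics t a≢a′) (c x) (λ i j → c (ε t i j))
        (equilibrium-P a≢a′ eq support stress) (equilibrium-Q a≢a′ eq support stress)

    module _
      (P-dependency : ∀ t (x : Fin M → Carrier) → (∀ s → sum (λ i → x i * homogeneous (p (P t i)) s) ≈ 0#) →
        ∀ i₀ → x i₀ ≈ 0# → ∀ i → x i ≈ 0#)
      (Q-dependency : ∀ t (y : Fin K → Carrier) → (∀ s → sum (λ j → y j * homogeneous (p (Q t j)) s) ≈ 0#) →
        ∀ {j₀ j₁} → j₀ ≢ j₁ → y j₀ ≈ 0# → y j₁ ≈ 0# → ∀ j → y j ≈ 0#)
      (diagonal : ∀ t → ∃[ x ] ∃[ a ] ∃[ a′ ] a ≢ a′ × endpoints x ≡ (P t a , P t a′))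
      where

      -- A column of a stress is an affine dependency of d + 2 points P, so one absent edge of star
      -- `j₀` makes the stress vanish on the whole star, and likewise for `j₁`. Every row is then an
      -- affine dependency of d + 3 points Q with two zeros. The diagonal edge lies outside `J`; it
      -- provides the pair of points at which `quadrics` is applied.
      missing-two⇒stressFree : ∀ J → (∀ {e} → e ∈ J → ∃[ t ] ∃[ i ] ∃[ j ] e ≡ ε t i j) →
        (∀ t → ∃[ i₀ ] ∃[ j₀ ] ∃[ i₁ ] ∃[ j₁ ] j₀ ≢ j₁ × ε t i₀ j₀ ∉ J × ε t i₁ j₁ ∉ J) → StressFree J
      missing-two⇒stressFree J J-blocks misses c supported stress e with inBlocks? e
      ... | no ∉blocks = supported e (∉blocks ∘ J-blocks)
      ... | yes (t , i , j , ≡.refl)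
        with i₀ , j₀ , i₁ , j₁ , j₀≢j₁ , ∉₀ , ∉₁ ← misses t | x , a , a′ , a≢a′ , eq ← diagonal t =
        Q-dependency t (λ j → c (ε t i j)) (row-dep i) j₀≢j₁ (column j₀ i₀ (supported _ ∉₀) i) (column j₁ i₁ (supported _ ∉₁) i) j
        where
        support : ∀ e → e ≢ x → ¬ (∃[ t ] ∃[ i ] ∃[ j ] e ≡ ε t i j) → c e ≈ 0#
        support e _ ∉blocks = supported e (∉blocks ∘ J-blocks)
        row-dep : ∀ i s → sum (λ j → c (ε t i j) * homogeneous (p (Q t j)) s) ≈ 0#
        row-dep = row-dependency (p ∘ P t) (p ∘ Q t) (quadrics t a≢a′) (c x) (λ i j → c (ε t i j))
          (equilibrium-P a≢a′ eq support stress) (equilibrium-Q a≢a′ eq support stress)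
        column-dep : ∀ j s → sum (λ i → c (ε t i j) * homogeneous (p (P t i)) s) ≈ 0#
        column-dep = column-dependency (p ∘ P t) (p ∘ Q t) (quadrics t a≢a′) (c x) (λ i j → c (ε t i j))
          (equilibrium-P a≢a′ eq support stress) (equilibrium-Q a≢a′ eq support stress)
        column : ∀ j i₀ → c (ε t i₀ j) ≈ 0# → ∀ i → c (ε t i j) ≈ 0#
        column j = P-dependency t (λ i → c (ε t i j)) (column-dep j)

  module _
    (P-kernel : ∀ t → ¬ ¬ (Σ (Fin M → Carrier) λ x → (∃[ i ] x i ≉0) ×
      (∀ s → sum (λ i → x i * homogeneous (p (P t i)) s) ≈ 0#)))
    (Q-kernel : ∀ t j₀ → ¬ ¬ (Σ (Fin K → Carrier) λ y → (∃[ j ] y j ≉0) × y j₀ ≈ 0# ×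
      (∀ s → sum (λ j → y j * homogeneous (p (Q t j)) s) ≈ 0#)))
    where

    -- The product of an affine dependency of the points P with one of the points Q that vanishes at
    -- `j₀` is a nonzero stress avoiding star `j₀`. The doubly negated kernels suffice for a negated
    -- goal.
    containing-all-but-one⇒¬stressFree : ∀ J t → (∃[ j₀ ] (∀ i j → j ≢ j₀ → ε t i j ∈ J)) → ¬ StressFree J
    containing-all-but-one⇒¬stressFree J t (j₀ , contains) free =
      P-kernel t λ (x , (i , xi≉0) , hx) → Q-kernel t j₀ λ (y , (j , yj≉0) , y₀≈0 , hy) →
      let ω = λ i j → x i * y j
          support : ∀ e → e ∉ J → extension t ω e ≈ 0#
          support e e∉J = zero-off-J x y y₀≈0 e e∉J
      in *-≉0 xi≉0 yj≉0 (trans (sym (extension-ε t ω i j))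
           (free (extension t ω) support
             (extension-isStress t ω (rank-one-equilibrium-P (p ∘ P t) (p ∘ Q t) x y hy)
                                     (rank-one-equilibrium-Q (p ∘ P t) (p ∘ Q t) x y hx))
             (ε t i j)))
      where
      zero-off-J : ∀ x y → y j₀ ≈ 0# → ∀ e → e ∉ J → extension t (λ i j → x i * y j) e ≈ 0#
      zero-off-J x y y₀≈0 e e∉J with any? (λ i → any? λ j → e ≟ᶠ ε t i j)
      ... | no _ = refl
      ... | yes (i , j , ≡.refl) with j ≟ᶠ j₀
      ...   | yes ≡.refl = trans (*-congˡ y₀≈0) (zeroʳ _)
      ...   | no j≢j₀    = contradiction (contains i j j≢j₀) e∉J

-- The intersection of the closures is empty

module Unbalanced (F : StableDomain) {d m b′ M′ K′ : ℕ} (2<K : 2 ℕ.< 2 ℕ.+ K′)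
  (endpoints : Fin m → Fin (Vertices.n (suc b′) (suc M′) (2 ℕ.+ K′)) × Fin (Vertices.n (suc b′) (suc M′) (2 ℕ.+ K′)))
  (p : Fin (Vertices.n (suc b′) (suc M′) (2 ℕ.+ K′)) → Fin d → CommutativeRing.Carrier (StableDomain.commutativeRing F))
  where
  open LinearAlgebra F
  open Vertices (suc b′) (suc M′) (2 ℕ.+ K′)
  open Framework F endpoints p

  module _ {Indep : Subset m → Set}
    (to : ∀ {S} → Indep S → StressFree S) (from : ∀ {S} → StressFree S → Indep S)
    (distinct : ∀ {u v} → u ≢ v → ∃[ r ] p u r - p v r ≉0)
    (loopless : ∀ e → source e ≢ target e)
    {ε : Fin (suc b′) → Fin (suc M′) → Fin (2 ℕ.+ K′) → Fin m}
    (endpoints-ε : ∀ t i j → endpoints (ε t i j) ≡ (P t i , Q t j))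
    (ε-injective : ∀ {t i j t′ i′ j′} → ε t i j ≡ ε t′ i′ j′ → t ≡ t′ × i ≡ i′ × j ≡ j′)
    (independent : ∀ J → (∀ {e} → e ∈ J → Stars.InBlocks ε e) → (∀ t → Stars.MissesTwo ε J t) → Indep J)
    (dependent : ∀ J t → Stars.ContainsAllButOne ε J t → ¬ Indep J)
    (diagonal-unstressed : ∀ {t a a′} → a ≢ a′ → ∀ {x} → endpoints x ≡ (P t a , P t a′) →
      ∀ {c} → (∀ e → e ≢ x → ¬ Stars.InBlocks ε e → c e ≈ 0#) → IsStress c → c x ≈ 0#)
    where

    open Closure to from
    open Blocks Indep b′ M′ K′ ε ε-injective independent dependent

    private
      -- The vertices all of whose edges lie in one part of the principal partition.
      data Owned : Fin n → Fin K ⊎ Fin b′ → Set where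
        Q₀ : ∀ j → Owned (Q zero j) (inj₁ j)
        Qₛ : ∀ t j → Owned (Q (suc t) j) (inj₂ t)
        Pₛ : ∀ t i → Owned (P (suc t) i) (inj₂ t)

      owned-isolated : ∀ {w x} → Owned w x → ∀ {e} → e ∈ D (without x) → w ≢ source e × w ≢ target e
      owned-isolated (Q₀ j₀) e∈ with t , i , j , ≡.refl , present ← ∈D⁻ {without (inj₁ j₀)} e∈ =
        (λ eq → P≢Q (≡.sym (≡.trans eq (≡.cong proj₁ (endpoints-ε t i j)))))
        , λ eq → clash present (Q-injective (≡.trans eq (≡.cong proj₂ (endpoints-ε t i j))))
        where
        clash : ∀ {t j} → Present (without (inj₁ j₀) t) j → ¬ (zero ≡ t × j₀ ≡ j)
        clash present (≡.refl , ≡.refl) = present ≡.refl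
      owned-isolated (Qₛ u j₀) e∈ with t , i , j , ≡.refl , present ← ∈D⁻ {without (inj₂ u)} e∈ =
        (λ eq → P≢Q (≡.sym (≡.trans eq (≡.cong proj₁ (endpoints-ε t i j)))))
        , λ eq → clash present (proj₁ (Q-injective (≡.trans eq (≡.cong proj₂ (endpoints-ε t i j)))))
        where
        clash : ∀ {t j} → Present (without (inj₂ u) t) j → suc u ≢ t
        clash {j = j} present ≡.refl = without-own u j present
      owned-isolated (Pₛ u i₀) e∈ with t , i , j , ≡.refl , present ← ∈D⁻ {without (inj₂ u)} e∈ =
        (λ eq → clash present (proj₁ (P-injective (≡.trans eq (≡.cong proj₁ (endpoints-ε t i j))))))
        , λ eq → P≢Q (≡.trans eq (≡.cong proj₂ (endpoints-ε t i j)))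
        where
        clash : ∀ {t j} → Present (without (inj₂ u) t) j → suc u ≢ t
        clash {j = j} present ≡.refl = without-own u j present

      owned-∉closure : ∀ {w x} → Owned w x → ∀ e → w ≡ source e ⊎ w ≡ target e → ¬ InClosure Indep e (D (without x))
      owned-∉closure {w} owned e incident = isolated⇒∉closure distinct loopless w incident (owned-isolated owned)

      diagonal-∉closure : ∀ {a a′ e} x → endpoints e ≡ (P zero a , P zero a′) → ¬ InClosure Indep e (D (without x))
      diagonal-∉closure {a} {a′} {e} x eq = free⇒∉closure e∉D λ c support stress →
        diagonal-unstressed a≢a′ eq
          (λ e′ e′≢e ∉blocks → support e′ (∉blocks ∘ D-inBlocks (without x)) e′≢e) stress
        where
        a≢a′ : a ≢ a′
        a≢a′ ≡.refl = loopless e (≡.trans (≡.cong proj₁ eq) (≡.sym (≡.cong proj₂ eq)))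
        e∉D : e ∉ D (without x)
        e∉D e∈ with t , i , j , ≡.refl ← D-inBlocks (without x) e∈ =
          P≢Q (≡.trans (≡.sym (≡.cong proj₂ eq)) (≡.cong proj₂ (endpoints-ε t i j)))

      -- The only vertices without an owner are the points P of block 0. An edge either has an owned
      -- endpoint, which is isolated once the owner is removed, or joins two points P of block 0 and
      -- lies in none of the closures.
      outside-some-closure : ∀ e → ∃[ x ] ¬ InClosure Indep e (D (without x))
      outside-some-closure e = cases (view (source e)) ≡.refl (view (target e)) ≡.refl
        where
        cases : ∀ {u v} → View u → u ≡ source e → View v → v ≡ target e → ∃[ x ] ¬ InClosure Indep e (D (without x))
        cases (inQ zero j)    s _              _ = inj₁ j , owned-∉closure (Q₀ j) e (inj₁ s)
        cases (inQ (suc t) j) s _              _ = inj₂ t , owned-∉closure (Qₛ t j) e (inj₁ s)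
        cases (inP (suc t) i) s _              _ = inj₂ t , owned-∉closure (Pₛ t i) e (inj₁ s)
        cases (inP zero i)    _ (inQ zero j)    t≡ = inj₁ j , owned-∉closure (Q₀ j) e (inj₂ t≡)
        cases (inP zero i)    _ (inQ (suc t) j) t≡ = inj₂ t , owned-∉closure (Qₛ t j) e (inj₂ t≡)
        cases (inP zero i)    _ (inP (suc t) j) t≡ = inj₂ t , owned-∉closure (Pₛ t j) e (inj₂ t≡)
        cases (inP zero i)    s (inP zero j)    t≡ = inj₁ zero ,
          diagonal-∉closure (inj₁ zero) (≡.cong₂ _,_ (≡.sym s) (≡.sym t≡))

      no-common-closure : ∀ e → ¬ (∀ a → InClosure Indep e (D whole ─ part a))
      no-common-closure e closed =
        let x , ∉closure = outside-some-closure e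
            a = join K b′ x
        in ∉closure (≡.subst (InClosure Indep e)
             (≡.trans (whole─part a) (≡.cong (D ∘ without) (splitAt-join K b′ x))) (closed a))

    -- With the empty intersection, balance would require 0 + (2 + b′) = K + b′, contrary to 2 < K.
    unbalanced : ∃[ C ] IsFoldCircuit Indep (2 ℕ.+ b′) C × ¬ IsBalanced Indep (2 ℕ.+ b′) C
    unbalanced = D whole , whole-isFoldCircuit , λ balanced →
      rank-mismatch (balanced part isPrincipalPartition ∅
        (λ e → mk⇔ (λ e∈∅ → contradiction e∈∅ ∉⊥) (λ closed → contradiction closed (no-common-closure e))))
      where
      rank-mismatch : ¬ (∃[ r ] HasRank Indep ∅ r × r ℕ.+ (2 ℕ.+ b′) ≡ K ℕ.+ b′)
      rank-mismatch (r , ((I , I⊆∅ , _ , ≡.refl) , _) , eq) =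
        ℕₚ.<-irrefl (≡.trans (≡.sym (≡.cong (ℕ._+ (2 ℕ.+ b′)) ∣I∣≡0)) eq)
          (ℕₚ.+-monoˡ-< b′ {2} {K} 2<K)
        where
        ∣I∣≡0 : ∣ I ∣ ≡ 0
        ∣I∣≡0 = ℕₚ.n≤0⇒n≡0 (ℕₚ.≤-trans (p⊆q⇒∣p∣≤∣q∣ {p = I} {q = ∅} I⊆∅) (ℕₚ.≤-reflexive (∣⊥∣≡0 m)))

-- The counterexample at a generic placement

module Counterexample (F : StableDomain) (d′ b′ : ℕ) where
  open BaseConfiguration F d′ using (d; baseP; baseQ; base-independent)
  open LinearAlgebra F
  open Stack F

  b M K : ℕ
  b = suc b′
  M = 2 ℕ.+ d
  K = 3 ℕ.+ d

  open Vertices b M K public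
  open Polynomials F n d
  open Affine F n d

  module _
    {m : ℕ} {endpoints : Fin m → Fin n × Fin n}
    (endpoints-injective : ∀ {e e′} → endpoints e ≡ endpoints e′ → e ≡ e′)
    (loopless : ∀ e → proj₁ (endpoints e) ≢ proj₂ (endpoints e))
    (edge : ∀ {u v} → u < v → ∃[ e ] endpoints e ≡ (u , v))
    {p : Fin n → Fin d → Carrier} (gen : GenericPlacement p)
    where

    open Framework F endpoints p

    private
      ε : Fin b → Fin M → Fin K → Fin m
      ε t i j = proj₁ (edge (P<Q {t} {i} {t} {j}))

      endpoints-ε : ∀ t i j → endpoints (ε t i j) ≡ (P t i , Q t j)
      endpoints-ε t i j = proj₂ (edge (P<Q {t} {i} {t} {j}))

    open BlockFramework F {d = d} {b = b} {M = M} {K = K} endpoints p ε endpoints-ε endpoints-injective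

    private
      quadrics : ∀ t {a a′} → a ≢ a′ →
        JointlyIndependent (difference-square (p (P t a)) (p (P t a′))) (square ∘ p ∘ P t) (square ∘ p ∘ Q t)
      -- In `baseP` the indices `2F` and `suc (suc 3F)` carry the unit vectors `e 0F` and `e 3F`,
      -- the pair for which `base-independent` is stated.
      quadrics t a≢a′ = Transfer.transfer F {p = p} gen {P = P t} {Q = Q t}
        coordinates (coordinates-P t) (coordinates-Q t) {X = baseP} {Y = baseQ}
        {x = 2F} {y = suc (suc 3F)} a≢a′ (λ ()) base-independent

      distinct : ∀ {u v} → u ≢ v → ∃[ r ] p u r - p v r ≉0
      distinct {u} {v} u≢v = 0F , generic-≉0 {p = p} gen (∸-isPoly (coordinate-isPoly u 0F) (coordinate-isPoly v 0F))
        (λ w _ → δ w u) λ difference≈0 → 1≉0 (begin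
          1#                     ≈⟨ +-identityʳ 1# ⟨
          1# + 0#                ≈⟨ +-congˡ -0#≈0# ⟨
          1# - 0#                ≈⟨ +-cong (δ-≡ {i = u} ≡.refl) (-‿cong (δ-≢ (u≢v ∘ ≡.sym))) ⟨
          δ u u - δ v u          ≈⟨ difference≈0 ⟩
          0#                     ∎)

      diagonal : ∀ t → ∃[ x ] ∃[ a ] ∃[ a′ ] a ≢ a′ × endpoints x ≡ (P t a , P t a′)
      diagonal t with <-cmp (P t 0F) (P t 1F)
      ... | tri< lt _ _ = let x , eq = edge lt in x , 0F , 1F , (λ ()) , eq
      ... | tri> _ _ gt = let x , eq = edge gt in x , 1F , 0F , (λ ()) , eq
      ... | tri≈ _ eq _ with () ← proj₂ (P-injective {t} {0F} {t} {1F} eq)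

    module _ {A : Fin m → Fin n × Fin d → Carrier}
      (A-source : ∀ e r → A e (proj₁ (endpoints e) , r)
        ≈ p (proj₁ (endpoints e)) r - p (proj₂ (endpoints e)) r)
      (A-target : ∀ e r → A e (proj₂ (endpoints e) , r)
        ≈ p (proj₂ (endpoints e)) r - p (proj₁ (endpoints e)) r)
      (A-nonincident : ∀ e w r → w ≢ proj₁ (endpoints e) → w ≢ proj₂ (endpoints e) → A e (w , r) ≈ 0#)
      {Indep : Subset m → Set}
      (Indep⇒rows : ∀ {S} → Indep S → (c : Fin m → Carrier) → (∀ e → e ∉ S → c e ≈ 0#) →
        (∀ j → sum (λ e → c e * A e j) ≈ 0#) → ∀ e → c e ≈ 0#)
      (rows⇒Indep : ∀ {S} → ((c : Fin m → Carrier) → (∀ e → e ∉ S → c e ≈ 0#) →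
        (∀ j → sum (λ e → c e * A e j) ≈ 0#) → ∀ e → c e ≈ 0#) → Indep S)
      where

      private
        to : ∀ {S} → Indep S → StressFree S
        to iS = rowsIndependent⇒stressFree A loopless A-source A-target A-nonincident (Indep⇒rows iS)

        from : ∀ {S} → StressFree S → Indep S
        from free = rows⇒Indep (stressFree⇒rowsIndependent A loopless A-source A-target A-nonincident free)

      private
        independent : ∀ J → (∀ {e} → e ∈ J → ∃[ t ] ∃[ i ] ∃[ j ] e ≡ ε t i j) →
          (∀ t → ∃[ i₀ ] ∃[ j₀ ] ∃[ i₁ ] ∃[ j₁ ] j₀ ≢ j₁ × ε t i₀ j₀ ∉ J × ε t i₁ j₁ ∉ J) → Indep J
        independent J blocks misses = from (missing-two⇒stressFree quadrics
          (λ t → independent-but-one {p = p} gen (P t) (λ i j → proj₂ ∘ P-injective {t} {i} {t} {j}))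
          (λ t → independent-but-two {p = p} gen (Q t) (λ i j → proj₂ ∘ Q-injective {t} {i} {t} {j}))
          diagonal J blocks misses)

        dependent : ∀ J t → (∃[ j₀ ] (∀ i j → j ≢ j₀ → ε t i j ∈ J)) → ¬ Indep J
        dependent J t contains iJ = containing-all-but-one⇒¬stressFree
          (λ t → kernel (suc d) (λ i → homogeneous (p (P t i))))
          (λ t → kernel-avoiding (suc d) (λ j → homogeneous (p (Q t j))))
          J t contains (to iJ)

      unbalanced-fold-circuit : ∃[ C ] IsFoldCircuit Indep (2 ℕ.+ b′) C × ¬ IsBalanced Indep (2 ℕ.+ b′) C
      unbalanced-fold-circuit = Unbalanced.unbalanced F (ℕ.s≤s (ℕ.s≤s (ℕ.s≤s ℕ.z≤n))) endpoints p
        to from distinct loopless endpoints-ε ε-injective independent dependent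
        (diagonal-unstressed quadrics)

-- The counterexample for any other presentation of the ring operations, so that
-- instantiating it never asks for a comparison of unfolded operations of the ring.
module Presented (F : StableDomain) where
  open LinearAlgebra F

  module _
    (_≈′_ : Carrier → Carrier → Set) (≈⇒≈′ : ∀ x y → x ≈ y → x ≈′ y) (≈′⇒≈ : ∀ x y → x ≈′ y → x ≈ y)
    (0′ : Carrier) (0-def : 0′ ≡ 0#) (ι′ : ℚ → Carrier) (ι-def : ∀ q → ι′ q ≡ ι q)
    (_+′_ _*′_ : Carrier → Carrier → Carrier) (-′_ : Carrier → Carrier)
    (+-def : ∀ x y → x +′ y ≡ x + y) (*-def : ∀ x y → x *′ y ≡ x * y) (neg-def : ∀ x → -′ x ≡ - x)
    (sum′ : ∀ {n} → (Fin n → Carrier) → Carrier) (sum-def : ∀ {n} (f : Fin n → Carrier) → sum′ f ≡ sum f)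
    (d′ b′ : ℕ)
    where

    open Counterexample F d′ b′ using (unbalanced-fold-circuit)

    private
      difference : ∀ x y → x +′ (-′ y) ≡ x - y
      difference x y = ≡.trans (+-def x (-′ y)) (≡.cong (x +_) (neg-def y))

      combination : ∀ {m} (c x : Fin m → Carrier) → sum′ (λ e → c e *′ x e) ≈ sum (λ e → c e * x e)
      combination c x = trans (reflexive (sum-def _)) (sum-cong-≋ λ e → reflexive (*-def (c e) (x e)))

      ≈0⇒ : ∀ {x y} → x ≈ y → x ≈ 0# → y ≈′ 0′
      ≈0⇒ {x} {y} x≈y x≈0 = ≈⇒≈′ y 0′ (trans (sym x≈y) (trans x≈0 (reflexive (≡.sym 0-def))))

      ⇒≈0 : ∀ {x y} → x ≈ y → x ≈′ 0′ → y ≈ 0#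
      ⇒≈0 {x} {y} x≈y x≈0 = trans (sym x≈y) (trans (≈′⇒≈ x 0′ x≈0) (reflexive 0-def))

    unbalanced-fold-circuit′ : ∀ {n d} → n ≡ Vertices.n (suc b′) (6 ℕ.+ d′) (7 ℕ.+ d′) → d ≡ 4 ℕ.+ d′ →
      (monomial′ : (Fin n → Fin d → Carrier) → (Fin n → Fin d → ℕ) → Carrier)
      (monomial-def : ∀ p a → monomial′ p a ≡ Polynomials.monomialAt F n d p a) →
      {p : Fin n → Fin d → Carrier} →
      (generic : ∀ {t} (c : Fin t → ℚ) (a : Fin t → Fin n → Fin d → ℕ) → (∀ s s′ → (∀ v i → a s v i ≡ a s′ v i) → s ≡ s′) →
        sum′ (λ s → ι′ (c s) *′ monomial′ p (a s)) ≈′ 0′ → ∀ s → c s ≡ 0ℚ) →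
      {m : ℕ} {endpoints : Fin m → Fin n × Fin n} →
      (endpoints-injective : ∀ {e e′} → endpoints e ≡ endpoints e′ → e ≡ e′) →
      (loopless : ∀ e → proj₁ (endpoints e) ≢ proj₂ (endpoints e)) →
      (edge : ∀ {u v} → u < v → ∃[ e ] endpoints e ≡ (u , v)) →
      {A : Fin m → Fin n × Fin d → Carrier} →
      (A-source : ∀ e r → A e (proj₁ (endpoints e) , r) ≡ p (proj₁ (endpoints e)) r +′ (-′ p (proj₂ (endpoints e)) r)) →
      (A-target : ∀ e r → A e (proj₂ (endpoints e) , r) ≡ p (proj₂ (endpoints e)) r +′ (-′ p (proj₁ (endpoints e)) r)) →
      (A-nonincident : ∀ e w r → w ≢ proj₁ (endpoints e) → w ≢ proj₂ (endpoints e) → A e (w , r) ≡ 0′) →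
      {Indep : Subset m → Set} →
      (Indep⇒rows : ∀ {S} → Indep S → (c : Fin m → Carrier) → (∀ e → e ∉ S → c e ≈′ 0′) →
        (∀ j → sum′ (λ e → c e *′ A e j) ≈′ 0′) → ∀ e → c e ≈′ 0′) →
      (rows⇒Indep : ∀ {S} → ((c : Fin m → Carrier) → (∀ e → e ∉ S → c e ≈′ 0′) →
        (∀ j → sum′ (λ e → c e *′ A e j) ≈′ 0′) → ∀ e → c e ≈′ 0′) → Indep S) →
      ∃[ C ] IsFoldCircuit Indep (2 ℕ.+ b′) C × ¬ IsBalanced Indep (2 ℕ.+ b′) C
    unbalanced-fold-circuit′ {n} {d} ≡.refl ≡.refl monomial′ monomial-def {p} generic {endpoints = endpoints}
      endpoints-injective loopless edge {A} A-source A-target A-nonincident Indep⇒rows rows⇒Indep =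
      unbalanced-fold-circuit endpoints-injective loopless edge {p} gen {A}
      (λ e r → reflexive (≡.trans (A-source e r) (difference _ _)))
      (λ e r → reflexive (≡.trans (A-target e r) (difference _ _)))
      (λ e w r w≢s w≢t → reflexive (≡.trans (A-nonincident e w r w≢s w≢t) 0-def))
      (λ iS c support stress e → ⇒≈0 refl (Indep⇒rows iS c
        (λ e e∉S → ≈0⇒ refl (support e e∉S)) (λ j → ≈0⇒ (sym (combination c (λ e → A e j))) (stress j)) e))
      (λ free → rows⇒Indep λ c support stress e → ≈0⇒ refl (free c
        (λ e e∉S → ⇒≈0 refl (support e e∉S)) (λ j → ⇒≈0 (combination c (λ e → A e j)) (stress j)) e))
      where
      gen : Polynomials.GenericPlacement F n d p
      gen c a distinct h = generic c a distinct (≈0⇒ (sym (trans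
        (combination (ι′ ∘ c) (monomial′ p ∘ a))
        (sum-cong-≋ λ s → *-cong (reflexive (ι-def (c s))) (reflexive (monomial-def p (a s)))))) h)

open ≡ using (refl; sym; trans; cong; subst)
open CauchyLemmas
open import Data.Nat using (_⊔_)

-- The real numbers

pointwise⇒≈ : ∀ x y → (∀ n → seq x n ≡ seq y n) → x ≈ℝ y
pointwise⇒≈ x y x≗y ε 0<ε = 0 , λ n _ →
  subst (ℚ._< ε)
    (sym (cong ℚ.∣_∣ (trans (cong (ℚ._- seq y n) (x≗y n)) (ℚₚ.+-inverseʳ (seq y n)))))
    0<ε

≈-refl : ∀ {x} → x ≈ℝ x
≈-refl {x} = pointwise⇒≈ x x (λ _ → refl)

≈-sym : ∀ {x y} → x ≈ℝ y → y ≈ℝ x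
≈-sym {x} {y} x≈y ε 0<ε = proj₁ (x≈y ε 0<ε) , λ n N≤n →
  subst (ℚ._< ε) (∣p-q∣≡∣q-p∣ (seq x n) (seq y n)) (proj₂ (x≈y ε 0<ε) n N≤n)
  where
  ∣p-q∣≡∣q-p∣ : ∀ p q → ℚ.∣ p ℚ.- q ∣ ≡ ℚ.∣ q ℚ.- p ∣
  ∣p-q∣≡∣q-p∣ p q = trans (sym (ℚₚ.∣-p∣≡∣p∣ (p ℚ.- q)))
    (cong ℚ.∣_∣ (solve 2 (λ p q → :- (p :- q) := q :- p) refl p q))
    where open +-*-Solver

both : ∀ {P Q : ℕ → Set} → ∃[ N ] (∀ n → N ≤ n → P n) → ∃[ N ] (∀ n → N ≤ n → Q n) →
  ∃[ N ] (∀ n → N ≤ n → P n × Q n)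
both (M , p) (N , q) = M ⊔ N , λ n M⊔N≤n →
  p n (ℕₚ.m⊔n≤o⇒m≤o M N M⊔N≤n) , q n (ℕₚ.m⊔n≤o⇒n≤o M N M⊔N≤n)

eventually-map : ∀ {P Q : ℕ → Set} → (∀ n → P n → Q n) →
  ∃[ N ] (∀ n → N ≤ n → P n) → ∃[ N ] (∀ n → N ≤ n → Q n)
eventually-map f (N , p) = N , λ n N≤n → f n (p n N≤n)

telescope : ∀ a b c → (a ℚ.- b) ℚ.+ (b ℚ.- c) ≡ a ℚ.- c
telescope a b c = trans (sym (ℚₚ.+-assoc (a ℚ.- b) b (ℚ.- c))) (cong (ℚ._- c) (shift a b))

≈-trans : ∀ {x y z} → x ≈ℝ y → y ≈ℝ z → x ≈ℝ z
≈-trans {x} {y} {z} x≈y y≈z ε 0<ε =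
  eventually-map
    (λ n (p , q) → subst (λ u → ℚ.∣ u ∣ ℚ.< ε) (telescope (seq x n) (seq y n) (seq z n))
      (small-sum (seq x n ℚ.- seq y n) (seq y n ℚ.- seq z n) p q))
    (both (x≈y (½ ℚ.* ε) (half-pos 0<ε)) (y≈z (½ ℚ.* ε) (half-pos 0<ε)))

+-cong : ∀ {x x′ y y′} → x ≈ℝ x′ → y ≈ℝ y′ → (x +ℝ y) ≈ℝ (x′ +ℝ y′)
+-cong {x} {x′} {y} {y′} x≈ y≈ ε 0<ε =
  eventually-map
    (λ n (p , q) → subst (λ u → ℚ.∣ u ∣ ℚ.< ε)
      (sym (sum-split (seq x n) (seq y n) (seq x′ n) (seq y′ n)))
      (small-sum (seq x n ℚ.- seq x′ n) (seq y n ℚ.- seq y′ n) p q))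
    (both (x≈ (½ ℚ.* ε) (half-pos 0<ε)) (y≈ (½ ℚ.* ε) (half-pos 0<ε)))

-‿cong : ∀ {x x′} → x ≈ℝ x′ → (-ℝ x) ≈ℝ (-ℝ x′)
-‿cong {x} {x′} x≈ ε 0<ε =
  eventually-map
    (λ n p → subst (ℚ._< ε)
      (sym (trans (cong ℚ.∣_∣ (neg-split (seq x n) (seq x′ n))) (ℚₚ.∣-p∣≡∣p∣ (seq x n ℚ.- seq x′ n))))
      p)
    (x≈ ε 0<ε)

*-cong : ∀ {x x′ y y′} → x ≈ℝ x′ → y ≈ℝ y′ → (x *ℝ y) ≈ℝ (x′ *ℝ y′)
*-cong {x} {x′} {y} {y′} x≈ y≈ ε 0<ε =
  let Bx , 0<Bx , bx = cauchy⇒bounded (seq x) (cauchy x)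
      By , 0<By , by = cauchy⇒bounded (seq y′) (cauchy y′)
      δ₁ , 0<δ₁ , e₁ = shrink Bx (½ ℚ.* ε) 0<Bx (half-pos 0<ε)
      δ₂ , 0<δ₂ , e₂ = shrink By (½ ℚ.* ε) 0<By (half-pos 0<ε)
  in eventually-map
    (λ n ((∣x∣≤ , ∣y′∣≤) , (p , q)) → subst (λ u → ℚ.∣ u ∣ ℚ.< ε)
      (sym (prod-split (seq x n) (seq y n) (seq x′ n) (seq y′ n)))
      (small-sum (seq x n ℚ.* (seq y n ℚ.- seq y′ n)) (seq y′ n ℚ.* (seq x n ℚ.- seq x′ n))
        (small-product (seq x n) (seq y n ℚ.- seq y′ n) 0<Bx e₁ ∣x∣≤ q)
        (small-product (seq y′ n) (seq x n ℚ.- seq x′ n) 0<By e₂ ∣y′∣≤ p)))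
    (both (both bx by) (both (x≈ δ₂ 0<δ₂) (y≈ δ₁ 0<δ₁)))

ℝ-isCommutativeRing : IsCommutativeRing _≈ℝ_ _+ℝ_ _*ℝ_ -ℝ_ (fromℚ 0ℚ) (fromℚ 1ℚ)
ℝ-isCommutativeRing = record
  { isRing = record
    { +-isAbelianGroup = record
      { isGroup = record
        { isMonoid = record
          { isSemigroup = record
            { isMagma = record
              { isEquivalence = record
                { refl = λ {x} → ≈-refl {x}
                ; sym = λ {x y} → ≈-sym {x} {y}
                ; trans = λ {x y z} → ≈-trans {x} {y} {z} }
              ; ∙-cong = λ {x x′ y y′} → +-cong {x} {x′} {y} {y′} }
            ; assoc = λ x y z → pointwise⇒≈ (x +ℝ y +ℝ z) (x +ℝ (y +ℝ z)) λ n → ℚₚ.+-assoc (seq x n) (seq y n) (seq z n) }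
          ; identity = (λ x → pointwise⇒≈ (fromℚ 0ℚ +ℝ x) x λ n → ℚₚ.+-identityˡ (seq x n))
                     , (λ x → pointwise⇒≈ (x +ℝ fromℚ 0ℚ) x λ n → ℚₚ.+-identityʳ (seq x n)) }
        ; inverse = (λ x → pointwise⇒≈ (-ℝ x +ℝ x) (fromℚ 0ℚ) λ n → ℚₚ.+-inverseˡ (seq x n))
                  , (λ x → pointwise⇒≈ (x +ℝ -ℝ x) (fromℚ 0ℚ) λ n → ℚₚ.+-inverseʳ (seq x n))
        ; ⁻¹-cong = λ {x x′} → -‿cong {x} {x′} }
      ; comm = λ x y → pointwise⇒≈ (x +ℝ y) (y +ℝ x) λ n → ℚₚ.+-comm (seq x n) (seq y n) }
    ; *-cong = λ {x x′ y y′} → *-cong {x} {x′} {y} {y′}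
    ; *-assoc = λ x y z → pointwise⇒≈ (x *ℝ y *ℝ z) (x *ℝ (y *ℝ z)) λ n → ℚₚ.*-assoc (seq x n) (seq y n) (seq z n)
    ; *-identity = (λ x → pointwise⇒≈ (fromℚ 1ℚ *ℝ x) x λ n → ℚₚ.*-identityˡ (seq x n))
                 , (λ x → pointwise⇒≈ (x *ℝ fromℚ 1ℚ) x λ n → ℚₚ.*-identityʳ (seq x n))
    ; distrib = (λ x y z → pointwise⇒≈ (x *ℝ (y +ℝ z)) (x *ℝ y +ℝ x *ℝ z) λ n → ℚₚ.*-distribˡ-+ (seq x n) (seq y n) (seq z n))
              , (λ x y z → pointwise⇒≈ ((y +ℝ z) *ℝ x) (y *ℝ x +ℝ z *ℝ x) λ n → ℚₚ.*-distribʳ-+ (seq x n) (seq y n) (seq z n)) }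
  ; *-comm = λ x y → pointwise⇒≈ (x *ℝ y) (y *ℝ x) λ n → ℚₚ.*-comm (seq x n) (seq y n) }

ℝ-commutativeRing : CommutativeRing 0ℓ 0ℓ
ℝ-commutativeRing = record { isCommutativeRing = ℝ-isCommutativeRing }

0ᵣ 1ᵣ : ℝ
0ᵣ = fromℚ 0ℚ
1ᵣ = fromℚ 1ℚ

infix 4 _≉0
_≉0 : ℝ → Set
x ≉0 = ¬ x ≈ℝ 0ᵣ

-- The positive form of being nonzero, with a lower bound to divide by. It is refuted exactly by
-- null sequences, whence the stability of `≈ℝ 0ᵣ`.
Apart : ℝ → Set
Apart x = ∃[ δ ] 0ℚ ℚ.< δ × ∃[ N ] (∀ n → N ≤ n → δ ℚ.≤ ℚ.∣ seq x n ∣)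

p-0≡p : ∀ p → p ℚ.- 0ℚ ≡ p
p-0≡p p = ℚₚ.+-identityʳ p

≈0-intro : ∀ {x} → (∀ ε → 0ℚ ℚ.< ε → ∃[ N ] (∀ n → N ≤ n → ℚ.∣ seq x n ∣ ℚ.< ε)) → x ≈ℝ 0ᵣ
≈0-intro {x} h ε 0<ε = eventually-map
  (λ n → subst (λ u → ℚ.∣ u ∣ ℚ.< ε) (sym (p-0≡p (seq x n)))) (h ε 0<ε)

≈0-elim : ∀ {x} → x ≈ℝ 0ᵣ → ∀ ε → 0ℚ ℚ.< ε → ∃[ N ] (∀ n → N ≤ n → ℚ.∣ seq x n ∣ ℚ.< ε)
≈0-elim {x} x≈0 ε 0<ε = eventually-map
  (λ n → subst (λ u → ℚ.∣ u ∣ ℚ.< ε) (p-0≡p (seq x n))) (x≈0 ε 0<ε)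

apart⇒≉0 : ∀ {x} → Apart x → x ≉0
apart⇒≉0 {x} (δ , 0<δ , a) x≈0 with N , h ← both a (≈0-elim {x} x≈0 δ 0<δ)
  with δ≤ , <δ ← h N ℕₚ.≤-refl = ℚₚ.<-irrefl refl (ℚₚ.≤-<-trans δ≤ <δ)

-- For each ε one rational comparison suffices, at an index `N` beyond which the sequence varies by
-- less than ε/4: if the term there is below ε/2, all later terms are below ε; otherwise all later
-- terms are at least ε/4 and `x` is apart from 0.
¬apart⇒≈0 : ∀ {x} → ¬ Apart x → x ≈ℝ 0ᵣ
¬apart⇒≈0 {x} ¬a = ≈0-intro {x} λ ε 0<ε → lemma ε 0<ε (cauchy x (½ ℚ.* (½ ℚ.* ε)) (half-pos (half-pos 0<ε)))
  where
  open ℚₚ.≤-Reasoning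
  lemma : ∀ ε → 0ℚ ℚ.< ε →
    ∃[ N ] (∀ m n → N ≤ m → N ≤ n → ℚ.∣ seq x m ℚ.- seq x n ∣ ℚ.< ½ ℚ.* (½ ℚ.* ε)) →
    ∃[ N ] (∀ n → N ≤ n → ℚ.∣ seq x n ∣ ℚ.< ε)
  lemma ε 0<ε (N , close) with ℚ.∣ seq x N ∣ ℚₚ.<? ½ ℚ.* ε
  ... | yes small = N , λ n N≤n → subst (λ u → ℚ.∣ u ∣ ℚ.< ε) (shift (seq x n) (seq x N))
          (small-sum (seq x n ℚ.- seq x N) (seq x N) (ℚₚ.<-trans (close n N N≤n ℕₚ.≤-refl) (half< (half-pos 0<ε))) small)
    where
    half< : ∀ {η} → 0ℚ ℚ.< η → ½ ℚ.* η ℚ.< η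
    half< {η} 0<η = begin-strict
      ½ ℚ.* η              ≡⟨ sym (ℚₚ.+-identityʳ (½ ℚ.* η)) ⟩
      ½ ℚ.* η ℚ.+ 0ℚ       <⟨ ℚₚ.+-monoʳ-< (½ ℚ.* η) (half-pos 0<η) ⟩
      ½ ℚ.* η ℚ.+ ½ ℚ.* η  ≡⟨ half-sum η ⟩
      η                    ∎
  ... | no big = contradiction (¼ε , half-pos (half-pos 0<ε) , N , far) ¬a
    where
    ¼ε = ½ ℚ.* (½ ℚ.* ε)
    far : ∀ n → N ≤ n → ¼ε ℚ.≤ ℚ.∣ seq x n ∣
    far n N≤n = ℚₚ.≮⇒≥ λ ∣xₙ∣<¼ε → big (subst (λ u → ℚ.∣ u ∣ ℚ.< ½ ℚ.* ε)
      (shift (seq x N) (seq x n)) (small-sum (seq x N ℚ.- seq x n) (seq x n) (close N n ℕₚ.≤-refl N≤n) ∣xₙ∣<¼ε))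

≈0-stable : ∀ {x} → ¬ ¬ x ≈ℝ 0ᵣ → x ≈ℝ 0ᵣ
≈0-stable {x} h = ¬apart⇒≈0 {x} λ a → h (apart⇒≉0 {x} a)

apart-cancel : ∀ {x y} → Apart y → x *ℝ y ≈ℝ 0ᵣ → x ≈ℝ 0ᵣ
apart-cancel {x} {y} (δ , 0<δ , a) xy≈0 = ≈0-intro {x} λ ε 0<ε →
  eventually-map (λ n (δ≤ , <εδ) → small ε (seq x n) (seq y n) δ≤ <εδ)
    (both a (≈0-elim {x *ℝ y} xy≈0 (ε ℚ.* δ) (pos-* ε 0<ε)))
  where
  open ℚₚ.≤-Reasoning
  instance _ = ℚ.positive 0<δ
  pos-* : ∀ ε → 0ℚ ℚ.< ε → 0ℚ ℚ.< ε ℚ.* δ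
  pos-* ε 0<ε = subst (ℚ._< ε ℚ.* δ) (ℚₚ.*-zeroˡ δ) (ℚₚ.*-monoˡ-<-pos δ 0<ε)
  small : ∀ ε u v → δ ℚ.≤ ℚ.∣ v ∣ → ℚ.∣ u ℚ.* v ∣ ℚ.< ε ℚ.* δ → ℚ.∣ u ∣ ℚ.< ε
  small ε u v δ≤ uv< = ℚₚ.*-cancelʳ-<-nonNeg δ {{ℚₚ.pos⇒nonNeg δ}} (begin-strict
    ℚ.∣ u ∣ ℚ.* δ        ≤⟨ ℚₚ.*-monoˡ-≤-nonNeg ℚ.∣ u ∣ {{ℚₚ.∣-∣-nonNeg u}} δ≤ ⟩
    ℚ.∣ u ∣ ℚ.* ℚ.∣ v ∣  ≡⟨ ℚₚ.∣p*q∣≡∣p∣*∣q∣ u v ⟨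
    ℚ.∣ u ℚ.* v ∣        <⟨ uv< ⟩
    ε ℚ.* δ              ∎)

-- It is the conclusion that gets tested: if `y` were apart from 0, dividing by it would give
-- `x ≈ℝ 0ᵣ`. No apartness of `x` has to be extracted from `x ≉0`.
*-cancelˡ-0 : ∀ {x y} → x ≉0 → x *ℝ y ≈ℝ 0ᵣ → y ≈ℝ 0ᵣ
*-cancelˡ-0 {x} {y} x≉0 xy≈0 = ¬apart⇒≈0 {y} λ a → x≉0 (apart-cancel {x} {y} a xy≈0)

fromℚ-≉0 : ∀ {q} → q ≢ 0ℚ → fromℚ q ≉0
fromℚ-≉0 {q} q≢0 = apart⇒≉0 {fromℚ q}
  ( ℚ.∣ q ∣ , ℚₚ.≰⇒> (λ ∣q∣≤0 → q≢0 (ℚₚ.∣p∣≡0⇒p≡0 q (ℚₚ.≤-antisym ∣q∣≤0 (ℚₚ.0≤∣p∣ q))))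
  , 0 , λ _ _ → ℚₚ.≤-refl)

ℝ-stableDomain : StableDomain
ℝ-stableDomain = record
  { commutativeRing = ℝ-commutativeRing
  ; ι          = fromℚ
  ; ι-+        = λ p q → ≈-refl {fromℚ (p ℚ.+ q)}
  ; ι-*        = λ p q → ≈-refl {fromℚ (p ℚ.* q)}
  ; ι-neg      = λ p → ≈-refl {fromℚ (ℚ.- p)}
  ; ι-0        = ≈-refl {fromℚ 0ℚ}
  ; ι-1        = ≈-refl {fromℚ 1ℚ}
  ; ι-≉0       = fromℚ-≉0
  ; ≈0-stable  = λ {x} → ≈0-stable {x}
  ; *-cancel-0 = λ {x y} → *-cancelˡ-0 {x} {y}
  }

-- Edges of the complete graph, entries of the rigidity matrix, and the conclusion

lookup-unique : ∀ {A : Set} {xs : List A} → Unique xs → ∀ i j → lookup xs i ≡ lookup xs j → i ≡ j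
lookup-unique (_ ∷ _)   zero    zero    _  = refl
lookup-unique (x≢ ∷ _)  zero    (suc j) eq = contradiction eq (All.lookup x≢ (∈-lookup j))
lookup-unique (x≢ ∷ _)  (suc i) zero    eq = contradiction (sym eq) (All.lookup x≢ (∈-lookup i))
lookup-unique (_ ∷ xs!) (suc i) (suc j) eq = cong suc (lookup-unique xs! i j eq)

module _ (n : ℕ) where

  private
    pairs : List (Fin n × Fin n)
    pairs = cartesianProduct (allFin n) (allFin n)

  completeGraph-injective : ∀ {e e′} → lookup (completeGraph n) e ≡ lookup (completeGraph n) e′ → e ≡ e′
  completeGraph-injective {e} {e′} = lookup-unique
    (Uniqueₚ.filter⁺ (uncurry _<?_) (Uniqueₚ.cartesianProduct⁺ (Uniqueₚ.allFin⁺ n) (Uniqueₚ.allFin⁺ n))) e e′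

  completeGraph-loopless : ∀ e → proj₁ (lookup (completeGraph n) e) ≢ proj₂ (lookup (completeGraph n) e)
  completeGraph-loopless e eq = <-irrefl eq (proj₂ (∈-filter⁻ (uncurry _<?_) {xs = pairs} (∈-lookup e)))

  completeGraph-edge : ∀ {u v} → u < v → ∃[ e ] lookup (completeGraph n) e ≡ (u , v)
  completeGraph-edge {u} {v} u<v = index uv∈ , sym (lookup-index uv∈)
    where
    uv∈ : (u , v) ∈ˡ completeGraph n
    uv∈ = ∈-filter⁺ (uncurry _<?_) (∈-cartesianProduct⁺ (∈-allFin u) (∈-allFin v)) u<v

module _ {n d : ℕ} (p : Placement d n) where

  private
    -- Hides the Cauchy moduli, which would otherwise be normalised at every case split.
    abstract
      _⊖_ : ℝ → ℝ → ℝ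
      x ⊖ y = x +ℝ -ℝ y

      ⊖-def : ∀ x y → x +ℝ -ℝ y ≡ x ⊖ y
      ⊖-def x y = refl

    source-entry : ∀ {u v w} i → w ≡ u → rigidityRow p (u , v) (w , i) ≡ p u i ⊖ p v i
    source-entry {u} {v} {w} i w≡u with w ≟ᶠ u | w ≟ᶠ v
    ... | yes _  | _ = ⊖-def (p u i) (p v i)
    ... | no w≢u | _ = contradiction w≡u w≢u

    target-entry : ∀ {u v w} i → w ≢ u → w ≡ v → rigidityRow p (u , v) (w , i) ≡ p v i ⊖ p u i
    target-entry {u} {v} {w} i w≢u w≡v with w ≟ᶠ u | w ≟ᶠ v
    ... | yes w≡u | _      = contradiction w≡u w≢u
    ... | no _    | yes _  = ⊖-def (p v i) (p u i)
    ... | no _    | no w≢v = contradiction w≡v w≢v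

  rigidityRow-source : ∀ {u v} i → rigidityRow p (u , v) (u , i) ≡ p u i +ℝ -ℝ p v i
  rigidityRow-source {u} {v} i = trans (source-entry i refl) (sym (⊖-def (p u i) (p v i)))

  rigidityRow-target : ∀ {u v} i → v ≢ u → rigidityRow p (u , v) (v , i) ≡ p v i +ℝ -ℝ p u i
  rigidityRow-target {u} {v} i v≢u = trans (target-entry i v≢u refl) (sym (⊖-def (p v i) (p u i)))

  rigidityRow-nonincident : ∀ {u v w} i → w ≢ u → w ≢ v → rigidityRow p (u , v) (w , i) ≡ fromℚ 0ℚ
  rigidityRow-nonincident {u} {v} {w} i w≢u w≢v with w ≟ᶠ u | w ≟ᶠ v
  ... | yes w≡u | _       = contradiction w≡u w≢u
  ... | no _    | yes w≡v = contradiction w≡v w≢v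
  ... | no _    | no _    = refl

monomial-def : ∀ {n d} (p : Placement d n) a → monomial p a ≡ Polynomials.monomialAt ℝ-stableDomain n d p a
monomial-def p a = refl

counterexample : ∀ d′ b′ {n d} → n ≡ Vertices.n (suc b′) (6 ℕ.+ d′) (7 ℕ.+ d′) → d ≡ 4 ℕ.+ d′ →
  (p : Placement d n) → Generic p →
  ∃[ D ] IsFoldCircuit (rigidityMatroid (completeGraph n) p) (2 ℕ.+ b′) D
       × ¬ IsBalanced (rigidityMatroid (completeGraph n) p) (2 ℕ.+ b′) D
counterexample d′ b′ {n} n≡ d≡ p generic = Presented.unbalanced-fold-circuit′ ℝ-stableDomain
  _≈ℝ_ (λ x y x≈y → x≈y) (λ x y x≈y → x≈y) (fromℚ 0ℚ) refl fromℚ (λ q → refl)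
  _+ℝ_ _*ℝ_ -ℝ_ (λ x y → refl) (λ x y → refl) (λ x → refl) sumℝ (λ f → refl) d′ b′ n≡ d≡
  monomial monomial-def {p} generic {endpoints = lookup (completeGraph n)}
  (completeGraph-injective n) (completeGraph-loopless n) (completeGraph-edge n) {rigidityMatrix (completeGraph n) p}
  (λ e r → rigidityRow-source p r) (λ e r → rigidityRow-target p r (completeGraph-loopless n e ∘ sym))
  (λ e w r → rigidityRow-nonincident p r)
  {rigidityMatroid (completeGraph n) p} (λ independent c support stress → independent c support stress)
  (λ independent c support stress → independent c support stress)

theorem3p7 : ∀ (d k : ℕ) → 4 ≤ d → 2 ≤ k →
    ∃[ n ] 1 ≤ n × (∀ (p : Placement d n) → Generic p →
    ∃[ D ] IsFoldCircuit (rigidityMatroid (completeGraph n) p) k D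
    × ¬ IsBalanced (rigidityMatroid (completeGraph n) p) k D)
theorem3p7 (suc (suc (suc (suc d′)))) (suc (suc b′)) (ℕ.s≤s (ℕ.s≤s (ℕ.s≤s (ℕ.s≤s ℕ.z≤n)))) (ℕ.s≤s (ℕ.s≤s ℕ.z≤n)) =
  -- With k = 2 + b′ there are k - 1 blocks on d + 2 and d + 3 vertices: one block of nullity 2, and
  -- b′ blocks which without their star 0 have nullity 1.
  Vertices.n (suc b′) (6 ℕ.+ d′) (7 ℕ.+ d′) , ℕ.s≤s ℕ.z≤n , counterexample d′ b′ refl refl
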